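{- Let $A$ be a $d\times n$ integer matrix of rank $d$ with columns $\mathbf{a}_1,\dots,\mathbf{a}_n$ and $\ker(A)\cap\mathbb{R}^n_{\ge 0}=\{\mathbf{0}\}$. Let $\gamma$ be a chamber of $A$, and suppose that the external columns of $A$ lying in $\gamma$ are exactly $\mathbf{a}_1,\dots,\mathbf{a}_\ell$. Assume that the affine semigroup $\mathcal{S}(\mathbf{a}_1,\dots,\mathbf{a}_\ell)$ is saturated in $\mathcal{L}(A)$. Let $\sigma$ be a simplicial cone of $A$ containing $\gamma$, let $M_{\sigma^\vee}$ be the dual ray matrix of $\sigma$ with respect to an ordering $\mathbf{v}_1,\dots,\mathbf{v}_d$ of the minimal ray generators of $\sigma$ in which $\mathbf{v}_i$ is a positive multiple of $\mathbf{a}_i$ for $i=1,\dots,\ell$, and let $B$ be the matrix obtained from $M_{\sigma^\vee}A$ by removing its first $\ell$ rows and first $\ell$ columns. Then there is a chamber $\gamma'$ of $B$ such that $$p_A^{\gamma}(\mathbf{b})=p_B^{\gamma'}\big((M_{\sigma^\vee}\mathbf{b})_{\ell+1},\dots,(M_{\sigma^\vee}\mathbf{b})_d\big)$$ for all $\mathbf{b}\in\gamma\cap\mathcal{S}(A)$.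
   Context: For vectors $\mathbf{u}_1,\dots,\mathbf{u}_k$, $\operatorname{pos}_{\mathbb{R}}(\mathbf{u}_1,\dots,\mathbf{u}_k)$ is the set of their nonnegative real combinations; for a matrix $M$, $\operatorname{pos}_{\mathbb{R}}(M)$ is the cone generated by its columns. For $s\subseteq\{1,\dots,n\}$, $A_s$ is the submatrix of $A$ with columns indexed by $s$, and $A_{\cdot,\hat j}$ is $A$ with column $j$ removed. A simplicial cone of $A$ is $\operatorname{pos}_{\mathbb{R}}(A_s)$ with $|s|=\operatorname{rank}(A_s)=d$. The chamber complex of $A$ is the fan consisting of the cones $\bigcap\{\operatorname{pos}_{\mathbb{R}}(A_s): \operatorname{pos}_{\mathbb{R}}(A_s)\text{ simplicial cone of }A\text{ containing }\mathbf{b}\}$ for $\mathbf{b}\in\operatorname{pos}_{\mathbb{R}}(A)$, together with all their faces; its $d$-dimensional cones are called chambers. The vector partition function is $p_A(\mathbf{b})=\#\{\mathbf{x}\in\mathbb{N}^n: A\mathbf{x}=\mathbf{b}\}$ for $\mathbf{b}\in\mathbb{Z}^d$; it is a piecewise quasi-polynomial, and for a chamber $\gamma$, $p_A^\gamma$ denotes the quasi-polynomial that agrees with $p_A$ on $\gamma\cap\mathbb{Z}^d$ (the same notation is used for any matrix, e.g. $p_B^{\gamma'}$). A column $\mathbf{a}_j$ is an external column of $A$ if $\mathbf{a}_j\notin\operatorname{pos}_{\mathbb{R}}(A_{\cdot,\hat j})$. $\mathcal{L}(A)=\{\sum\lambda_i\mathbf{a}_i:\lambda_i\in\mathbb{Z}\}$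 and $\mathcal{S}(A)=\{\sum\lambda_i\mathbf{a}_i:\lambda_i\in\mathbb{N}\}$; similarly $\mathcal{S}(\cdot)$ of a set of columns. A semigroup $\mathcal{S}(A_s)$ is saturated in $\mathcal{L}(A)$ if $\mathcal{S}(A_s)=\mathcal{L}(A)\cap\operatorname{pos}_{\mathbb{R}}(A_s)$. A minimal ray generator of a ray is its primitive integer generator (integer vector with coprime entries). For a simplicial cone $\sigma$ with ordered minimal ray generators $\mathbf{v}_1,\dots,\mathbf{v}_d$, let $\mathbf{w}_i$ be the primitive integer inner normal of the unique facet of $\sigma$ not containing $\mathbf{v}_i$; the dual ray matrix $M_{\sigma^\vee}$ is the $d\times d$ matrix with rows $\mathbf{w}_1,\dots,\mathbf{w}_d$. -}

module Defs where

open import Data.Nat as ℕ using (ℕ; zero; suc)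
open import Data.Integer as ℤ using (ℤ; +_)
open import Data.Integer.Divisibility as ℤD using ()
open import Data.Rational as ℚ using (ℚ; 0ℚ; 1ℚ)
open import Data.Fin using (Fin; zero; suc; _↑ˡ_; _↑ʳ_)
open import Data.Vec using (Vec; lookup)
open import Data.List using (List; length)
open import Data.List.Membership.Propositional using (_∈_)
open import Data.List.Relation.Unary.Unique.Propositional using (Unique)
open import Data.Product using (Σ; ∃; _×_; _,_)
open import Function.Definitions using (Injective)
open import Relation.Binary.PropositionalEquality using (_≡_; _≢_)
open import Relation.Nullary using (¬_)

Vecℤ : ℕ → Set
Vecℤ d = Fin d → ℤ

Vecℚ : ℕ → Set
Vecℚ d = Fin d → ℚ

Mat : ℕ → ℕ → Set
Mat d n = Fin d → Fin n → ℤ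

toℚ : ℤ → ℚ
toℚ z = z ℚ./ 1

fromℕℚ : ℕ → ℚ
fromℕℚ c = (+ c) ℚ./ 1

Σℤ : ∀ {n} → (Fin n → ℤ) → ℤ
Σℤ {zero} f = + 0
Σℤ {suc n} f = f zero ℤ.+ Σℤ (λ i → f (suc i))

Σℚ : ∀ {n} → (Fin n → ℚ) → ℚ
Σℚ {zero} f = 0ℚ
Σℚ {suc n} f = f zero ℚ.+ Σℚ (λ i → f (suc i))

Πℚ : ∀ {n} → (Fin n → ℚ) → ℚ
Πℚ {zero} f = 1ℚ
Πℚ {suc n} f = f zero ℚ.* Πℚ (λ i → f (suc i))

mulVec : ∀ {d n} → Mat d n → Vecℤ n → Vecℤ d
mulVec A x i = Σℤ (λ j → A i j ℤ.* x j)

matMul : ∀ {d e n} → Mat d e → Mat e n → Mat d n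
matMul M A i j = Σℤ (λ r → M i r ℤ.* A r j)

col : ∀ {d n} → Mat d n → Fin n → Vecℤ d
col A j i = A i j

colℚ : ∀ {d n} → Mat d n → Fin n → Vecℚ d
colℚ A j i = toℚ (A i j)

dot : ∀ {d} → Vecℤ d → Vecℤ d → ℤ
dot w v = Σℤ (λ i → w i ℤ.* v i)

InPos : ∀ {m d} → (Fin m → Vecℚ d) → Vecℚ d → Set
InPos {m} {d} g y =
  Σ (Fin m → ℚ) λ c → (∀ i → 0ℚ ℚ.≤ c i) × (∀ r → y r ≡ Σℚ (λ i → c i ℚ.* g i r))

InPosMat : ∀ {d n} → Mat d n → Vecℚ d → Set
InPosMat A y = InPos (colℚ A) y

LinIndep : ∀ {m d} → (Fin m → Vecℚ d) → Set
LinIndep {m} v = ∀ (c : Fin m → ℚ) → (∀ r → Σℚ (λ i → c i ℚ.* v i r) ≡ 0ℚ) → ∀ i → c i ≡ 0ℚ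

FullRank : ∀ {d n} → Mat d n → Set
FullRank {d} {n} A = Σ (Fin d → Fin n) λ s → LinIndep (λ i → colℚ A (s i))

PointedKernel : ∀ {d n} → Mat d n → Set
PointedKernel {d} {n} A =
  ∀ (x : Fin n → ℚ) → (∀ j → 0ℚ ℚ.≤ x j)
    → (∀ r → Σℚ (λ j → toℚ (A r j) ℚ.* x j) ≡ 0ℚ) → ∀ j → x j ≡ 0ℚ

-- s = {s 0,…,s (d-1)} with |s| = rank(A_s) = d : pos(A_s) is a simplicial cone of A
SimplicialCone : ∀ {d n} → Mat d n → (Fin d → Fin n) → Set
SimplicialCone A s = Injective _≡_ _≡_ s × LinIndep (λ i → colℚ A (s i))

InCone : ∀ {d n} → Mat d n → (Fin d → Fin n) → Vecℚ d → Set
InCone A s y = InPos (λ i → colℚ A (s i)) y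

-- the cone of the chamber complex determined by b:
-- ⋂ { pos(A_s) simplicial cone of A containing b }
Cell : ∀ {d n} → Mat d n → Vecℚ d → Vecℚ d → Set
Cell {d} {n} A b y = ∀ (s : Fin d → Fin n) → SimplicialCone A s → InCone A s b → InCone A s y

FullDim : ∀ {d} → (Vecℚ d → Set) → Set
FullDim {d} C = Σ (Fin d → Vecℚ d) λ v → (∀ i → C (v i)) × LinIndep v

-- b ∈ pos(A) and Cell A b is a chamber (d-dimensional cone of the chamber complex)
IsChamberPt : ∀ {d n} → Mat d n → Vecℚ d → Set
IsChamberPt A b = InPosMat A b × FullDim (Cell A b)

External : ∀ {d n} → Mat d n → Fin n → Set
External {d} {n} A j =
  ¬ (Σ (Fin n → ℚ) λ c → (∀ i → 0ℚ ℚ.≤ c i) × (c j ≡ 0ℚ)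
        × (∀ r → colℚ A j r ≡ Σℚ (λ i → c i ℚ.* colℚ A i r)))

InLattice : ∀ {d n} → Mat d n → Vecℤ d → Set
InLattice {d} {n} A y = Σ (Fin n → ℤ) λ λs → ∀ r → y r ≡ mulVec A λs r

InSemigroup : ∀ {d n} → Mat d n → Vecℤ d → Set
InSemigroup {d} {n} A y = Σ (Fin n → ℕ) λ λs → ∀ r → y r ≡ mulVec A (λ j → + λs j) r

Saturated : ∀ {d m n} → Mat d m → Mat d n → Set
Saturated {d} C A = ∀ (y : Vecℤ d) →
  (InSemigroup C y → InLattice A y × InPosMat C (λ r → toℚ (y r)))
  × (InLattice A y × InPosMat C (λ r → toℚ (y r)) → InSemigroup C y)

Primitive : ∀ {d} → Vecℤ d → Set
Primitive v = ∀ (g : ℕ) → (∀ i → (+ g) ℤD.∣ v i) → g ≡ 1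

PosMultiple : ∀ {d} → Vecℤ d → Vecℤ d → Set
PosMultiple v a = Σ ℚ λ q → (0ℚ ℚ.< q) × (∀ r → toℚ (v r) ≡ q ℚ.* toℚ (a r))

MinRayGen : ∀ {d} → Vecℤ d → Vecℤ d → Set
MinRayGen v a = Primitive v × PosMultiple v a

-- rows of M: w_i = primitive integer inner normal of the facet of
-- pos(v_1,…,v_d) not containing v_i
IsDualRayMatrix : ∀ {d} → (Fin d → Vecℤ d) → Mat d d → Set
IsDualRayMatrix {d} v M = ∀ i →
  Primitive (M i) × (∀ j → i ≢ j → dot (M i) (v j) ≡ + 0) × (+ 0 ℤ.< dot (M i) (v i))

Sol : ∀ {d n} → Mat d n → Vecℤ d → Vec ℕ n → Set
Sol A b x = ∀ r → mulVec A (λ j → + lookup x j) r ≡ b r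

PCount : ∀ {d n} → Mat d n → Vecℤ d → ℕ → Set
PCount {d} {n} A b c = Σ (List (Vec ℕ n)) λ L →
  (length L ≡ c) × Unique L × (∀ x → (x ∈ L → Sol A b x) × (Sol A b x → x ∈ L))

Poly : ℕ → Set
Poly k = List (ℚ × Vec ℕ k)

powℚ : ℚ → ℕ → ℚ
powℚ q zero = 1ℚ
powℚ q (suc e) = q ℚ.* powℚ q e

evalPoly : ∀ {k} → Poly k → Vecℤ k → ℚ
evalPoly Data.List.[] x = 0ℚ
evalPoly ((c , e) Data.List.∷ P) x = c ℚ.* Πℚ (λ i → powℚ (toℚ (x i)) (lookup e i)) ℚ.+ evalPoly P x

IsQuasiPoly : ∀ {k} → (Vecℤ k → ℚ) → Set
IsQuasiPoly {k} Q = Σ ℕ λ N → ∀ (r : Vecℤ k) → Σ (Poly k) λ P →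
  ∀ (x : Vecℤ k) → (∀ i → (+ suc N) ℤD.∣ (x i ℤ.- r i)) → Q x ≡ evalPoly P x

AgreesOn : ∀ {k m} → Mat k m → (Vecℚ k → Set) → (Vecℤ k → ℚ) → Set
AgreesOn {k} B C Q = ∀ (y : Vecℤ k) → C (λ r → toℚ (y r)) →
  Σ ℕ λ c → PCount B y c × Q y ≡ fromℕℚ c

{-# OPTIONS --safe #-}
module Submission where

-- Elimination of the external columns.  Let π(y) be the last k entries of M y: the first ℓ columns of A
-- span its kernel and the columns of B are the images of the others.  Minimising the coefficient of an
-- external column aᵢ of γ over the representations of a generic point of γ gives, by LP duality, a
-- functional that is 1 on aᵢ, nonpositive on all other columns and nonnegative on γ.  Hence if y ∈ γ is a
-- combination of columns whose coefficients at a_{ℓ+1}, …, a_n are nonnegative, all coefficients are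
-- nonnegative.  This makes B pointed, makes π map γ into a chamber of B, and, with saturation, makes the
-- projection to the last m coordinates a bijection from the solutions of A x = b to those of B x′ = π(b).
--
-- Quasi-polynomiality on a chamber (Lawrence–Varchenko).  Fix a nondegenerate cost e > 0.  For B x = y
-- with y in the chamber, [x ≥ 0] is the signed sum, over the bases t whose cone contains the chamber, of
-- the indicators of the tangent cones of the fibre at the vertices t, polarised by e.  Only x with
-- e · x ≥ 0 matter, and e · x is bounded on every polarised cone; after splitting the nonbasic coordinates
-- into residue classes the lattice points of a truncated cone are counted by binomial coefficients.

open import Defs
open import Data.Fin using (Fin; toℕ; _↑ˡ_; _↑ʳ_)
open import Data.Product using (Σ; _×_)
open import Data.Integer using (ℤ)
open import Data.Rational using (ℚ)
open import Relation.Binary.PropositionalEquality using (_≡_)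

-- Agreement is needed at every lattice point of the closed chamber, walls and short vectors
-- included. On a wall the tangent cones degenerate, so the indicator identity is first proved for
-- generic right-hand sides, and a point of the chamber is then moved inwards by a small multiple of
-- `z`. A zero coordinate of `x` counts as positive and stays nonnegative under this move, so the
-- sign vector can be kept fixed. Near the apex a truncated cone may be empty; `binom p` still
-- counts correctly because it vanishes at -1, ..., -p, and positivity of the cost `e` keeps its
-- argument in that range. The identity is proved for one sign vector at a time in the dual space:
-- the bases whose polarised cone admits these signs are the vertices of a cell in the arrangement
-- of the hyperplanes `u · g j = e j`. If some sign is negative, a ray leaving `y` turns membership
-- of `y` in a cone into a signed count of facets. The bases over one facet have their dual points
-- on one line, which the cell meets in the empty set or in an interval with two ends, and these
-- cancel. If all signs are positive, the single optimal basis remains.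

module VectorPartition where
  open import Data.Bool using (Bool; true; false)
  open import Data.Empty using (⊥-elim)
  open import Data.Fin as Fin using (zero; suc; punchIn; punchOut)
  import Data.Fin.Properties as Finₚ
  open import Data.Integer as ℤ using (-[1+_])
  import Data.Integer.Divisibility as ℤD
  import Data.Integer.Divisibility.Signed as ℤDS
  import Data.Integer.DivMod as ℤDM
  import Data.Integer.Properties as ℤₚ
  open import Data.List as List using (List; []; _∷_; _++_; allFin; length; filter; concatMap; deduplicate)
  import Data.List.Properties as Listₚ
  open import Data.List.Membership.Propositional using (_∈_; find)
  open import Data.List.Membership.Propositional.Properties
  open import Data.List.Relation.Unary.All as All using ([]; _∷_)
  import Data.List.Relation.Unary.All.Properties as Allₚ
  open import Data.List.Relation.Unary.AllPairs using ([]; _∷_)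
  open import Data.List.Relation.Unary.Any as Any using (here; there)
  import Data.List.Relation.Unary.Unique.DecPropositional.Properties as UniqueDecₚ
  open import Data.List.Relation.Unary.Unique.Propositional using (Unique)
  import Data.List.Relation.Unary.Unique.Propositional.Properties as Uniqueₚ
  open import Data.Maybe using (Maybe; just; nothing)
  open import Data.Nat as ℕ using (ℕ; zero; suc)
  import Data.Nat.Divisibility as ℕD
  import Data.Nat.DivMod as ℕDM
  import Data.Nat.Properties as ℕₚ
  open import Data.Product using (∃; _,_; proj₁; proj₂)
  open import Data.Rational hiding (floor)
  open import Data.Rational.Properties
  import Data.Rational.Unnormalised as ℚᵘ
  import Data.Rational.Unnormalised.Properties as ℚᵘₚ
  open import Data.Sum using (_⊎_; inj₁; inj₂; [_,_]′)
  open import Data.Vec as Vec using (Vec; []; _∷_; lookup; tabulate; replicate; zipWith; _[_]≔_)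
  open import Data.Vec.Functional using (insertAt)
  open import Data.Vec.Functional.Properties using (insertAt-lookup; insertAt-punchIn)
  import Data.Vec.Properties as Vecₚ
  open import Function using (_∘_)
  open import Function.Definitions using (Injective)
  open import Relation.Binary.Definitions using (tri<; tri≈; tri>)
  open import Relation.Binary.PropositionalEquality
  open import Relation.Nullary using (¬_; Dec; yes; no; ¬?)
  open import Relation.Nullary.Decidable using (decidable-stable; does; dec-true; _×-dec_)
  open import Tactic.RingSolver using (solve-∀)
  open import Tactic.RingSolver.Core.AlmostCommutativeRing using (AlmostCommutativeRing; fromCommutativeRing)

  -- Arithmetic in ℚ, finite sums and linear combinations

  ℚ-ring : AlmostCommutativeRing _ _
  ℚ-ring = fromCommutativeRing +-*-commutativeRing isZero
    where
    isZero : ∀ x → Maybe (0ℚ ≡ x)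
    isZero x with 0ℚ ≟ x
    ... | yes p = just p
    ... | no _ = nothing

  p-p≡0 : ∀ p → p - p ≡ 0ℚ
  p-p≡0 = solve-∀ ℚ-ring

  p-q≡0⇒p≡q : ∀ {p q} → p - q ≡ 0ℚ → p ≡ q
  p-q≡0⇒p≡q {p} {q} e = trans (lem p q) (trans (cong (_+ q) e) (+-identityˡ q))
    where
    lem : ∀ p q → p ≡ (p - q) + q
    lem = solve-∀ ℚ-ring

  p≡q⇒p-q≡0 : ∀ {p q} → p ≡ q → p - q ≡ 0ℚ
  p≡q⇒p-q≡0 {p} refl = p-p≡0 p

  p+q≡0⇒p≡-q : ∀ {p q} → p + q ≡ 0ℚ → p ≡ - q
  p+q≡0⇒p≡-q {p} {q} e = trans (lem p q) (trans (cong (_- q) e) (+-identityˡ (- q)))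
    where
    lem : ∀ p q → p ≡ (p + q) - q
    lem = solve-∀ ℚ-ring

  p≤q⇒0≤q-p : ∀ {p q} → p ≤ q → 0ℚ ≤ q - p
  p≤q⇒0≤q-p {p} {q} h = subst (_≤ q - p) (p-p≡0 p) (+-monoˡ-≤ (- p) h)

  0≤q-p⇒p≤q : ∀ {p q} → 0ℚ ≤ q - p → p ≤ q
  0≤q-p⇒p≤q {p} {q} h = subst₂ _≤_ (+-identityˡ p) (lem p q) (+-monoˡ-≤ p h)
    where
    lem : ∀ p q → (q - p) + p ≡ q
    lem = solve-∀ ℚ-ring

  p<q⇒0<q-p : ∀ {p q} → p < q → 0ℚ < q - p
  p<q⇒0<q-p {p} {q} h = subst (_< q - p) (p-p≡0 p) (+-monoˡ-< (- p) h)

  0<q-p⇒p<q : ∀ {p q} → 0ℚ < q - p → p < q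
  0<q-p⇒p<q {p} {q} h = subst₂ _<_ (+-identityˡ p) (lem p q) (+-monoˡ-< p h)
    where
    lem : ∀ p q → (q - p) + p ≡ q
    lem = solve-∀ ℚ-ring

  0≤p+q : ∀ {p q} → 0ℚ ≤ p → 0ℚ ≤ q → 0ℚ ≤ p + q
  0≤p+q {p} {q} hp hq = +-mono-≤ hp hq

  0<p+q : ∀ {p q} → 0ℚ < p → 0ℚ ≤ q → 0ℚ < p + q
  0<p+q {p} {q} hp hq = +-mono-<-≤ hp hq

  0≤p*q : ∀ {p q} → 0ℚ ≤ p → 0ℚ ≤ q → 0ℚ ≤ p * q
  0≤p*q {p} {q} hp hq =
    subst (_≤ p * q) (*-zeroʳ p) (*-monoˡ-≤-nonNeg p {{nonNegative hp}} hq)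

  0<p*q : ∀ {p q} → 0ℚ < p → 0ℚ < q → 0ℚ < p * q
  0<p*q {p} {q} hp hq =
    subst (_< p * q) (*-zeroʳ p) (*-monoʳ-<-pos p {{positive hp}} hq)

  0≤-p : ∀ {p} → p ≤ 0ℚ → 0ℚ ≤ - p
  0≤-p h = neg-antimono-≤ h

  -p≤0 : ∀ {p} → 0ℚ ≤ p → - p ≤ 0ℚ
  -p≤0 h = neg-antimono-≤ h

  0<-p : ∀ {p} → p < 0ℚ → 0ℚ < - p
  0<-p h = neg-antimono-< h

  p*q≤0 : ∀ {p q} → 0ℚ ≤ p → q ≤ 0ℚ → p * q ≤ 0ℚ
  p*q≤0 {p} {q} hp hq = subst (_≤ 0ℚ) (lem p q) (-p≤0 (0≤p*q hp (0≤-p hq)))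
    where
    lem : ∀ p q → - (p * - q) ≡ p * q
    lem = solve-∀ ℚ-ring

  ≤∧≢⇒< : ∀ {p q} → p ≤ q → p ≢ q → p < q
  ≤∧≢⇒< {p} {q} h n with <-cmp p q
  ... | tri< a _ _ = a
  ... | tri≈ _ b _ = ⊥-elim (n b)
  ... | tri> _ _ c = ⊥-elim (<-irrefl refl (<-≤-trans c h))

  <⇒≱ : ∀ {p q} → p < q → ¬ q ≤ p
  <⇒≱ h k = <-irrefl refl (<-≤-trans h k)

  1≢-1 : 1ℚ ≢ - 1ℚ
  1≢-1 ()

  0<1 : 0ℚ < 1ℚ
  0<1 = positive⁻¹ 1ℚ

  abstract
    -- inv 0 = 0
    inv : ℚ → ℚ
    inv p with p ≟ 0ℚ
    ... | yes _ = 0ℚ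
    ... | no p≢0 = 1/_ p {{≢-nonZero p≢0}}

    *-inv : ∀ {p} → p ≢ 0ℚ → p * inv p ≡ 1ℚ
    *-inv {p} h with p ≟ 0ℚ
    ... | yes e = ⊥-elim (h e)
    ... | no p≢0 = *-inverseʳ p {{≢-nonZero p≢0}}

    inv-* : ∀ {p} → p ≢ 0ℚ → inv p * p ≡ 1ℚ
    inv-* {p} h = trans (*-comm (inv p) p) (*-inv h)

    0<⇒≢0 : ∀ {p} → 0ℚ < p → p ≢ 0ℚ
    0<⇒≢0 h e = <-irrefl (sym e) h

    <0⇒≢0 : ∀ {p} → p < 0ℚ → p ≢ 0ℚ
    <0⇒≢0 h e = <-irrefl e h

    0<inv : ∀ {p} → 0ℚ < p → 0ℚ < inv p
    0<inv {p} h with p ≟ 0ℚ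
    ... | yes e = ⊥-elim (0<⇒≢0 h e)
    ... | no p≢0 = positive⁻¹ _ {{1/pos⇒pos p {{positive h}}}}

  *-cancelˡ-0 : ∀ {p q} → p ≢ 0ℚ → p * q ≡ 0ℚ → q ≡ 0ℚ
  *-cancelˡ-0 {p} {q} h e = begin
    q ≡⟨ sym (*-identityˡ q) ⟩
    1ℚ * q ≡⟨ cong (_* q) (sym (inv-* h)) ⟩
    inv p * p * q ≡⟨ *-assoc (inv p) p q ⟩
    inv p * (p * q) ≡⟨ cong (inv p *_) e ⟩
    inv p * 0ℚ ≡⟨ *-zeroʳ (inv p) ⟩
    0ℚ ∎
    where open ≡-Reasoning

  *-cancelʳ-0 : ∀ {p q} → q ≢ 0ℚ → p * q ≡ 0ℚ → p ≡ 0ℚ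
  *-cancelʳ-0 {p} {q} h e = *-cancelˡ-0 h (trans (*-comm q p) e)

  *-cancel-0<ʳ : ∀ {p q} → 0ℚ < q → 0ℚ < p * q → 0ℚ < p
  *-cancel-0<ʳ {p} {q} hq h = *-cancelʳ-<-nonNeg q {{nonNegative (<⇒≤ hq)}} (subst (_< p * q) (sym (*-zeroˡ q)) h)

  *-cancel-0≤ʳ : ∀ {p q} → 0ℚ < q → 0ℚ ≤ p * q → 0ℚ ≤ p
  *-cancel-0≤ʳ {p} {q} hq h = *-cancelʳ-≤-pos q {{positive hq}} (subst (_≤ p * q) (sym (*-zeroˡ q)) h)

  Σ-cong : ∀ {n} {f g : Fin n → ℚ} → (∀ i → f i ≡ g i) → Σℚ f ≡ Σℚ g
  Σ-cong {zero} h = refl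
  Σ-cong {suc n} h = cong₂ _+_ (h zero) (Σ-cong (h ∘ suc))

  Σ-0 : ∀ {n} {f : Fin n → ℚ} → (∀ i → f i ≡ 0ℚ) → Σℚ f ≡ 0ℚ
  Σ-0 {zero} h = refl
  Σ-0 {suc n} h = trans (cong₂ _+_ (h zero) (Σ-0 (h ∘ suc))) (+-identityˡ 0ℚ)

  Σ-+ : ∀ {n} (f g : Fin n → ℚ) → Σℚ (λ i → f i + g i) ≡ Σℚ f + Σℚ g
  Σ-+ {zero} f g = refl
  Σ-+ {suc n} f g = trans (cong (f zero + g zero +_) (Σ-+ (f ∘ suc) (g ∘ suc)))
    (lem (f zero) (g zero) (Σℚ (f ∘ suc)) (Σℚ (g ∘ suc)))
    where
    lem : ∀ a b c d → a + b + (c + d) ≡ a + c + (b + d)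
    lem = solve-∀ ℚ-ring

  Σ-*ˡ : ∀ {n} a (f : Fin n → ℚ) → Σℚ (λ i → a * f i) ≡ a * Σℚ f
  Σ-*ˡ {zero} a f = sym (*-zeroʳ a)
  Σ-*ˡ {suc n} a f = trans (cong (a * f zero +_) (Σ-*ˡ a (f ∘ suc))) (sym (*-distribˡ-+ a _ _))

  Σ-*ʳ : ∀ {n} a (f : Fin n → ℚ) → Σℚ (λ i → f i * a) ≡ Σℚ f * a
  Σ-*ʳ a f = trans (Σ-cong (λ i → *-comm (f i) a)) (trans (Σ-*ˡ a f) (*-comm a _))

  Σ-neg : ∀ {n} (f : Fin n → ℚ) → Σℚ (λ i → - f i) ≡ - Σℚ f
  Σ-neg {zero} f = refl
  Σ-neg {suc n} f = trans (cong (- f zero +_) (Σ-neg (f ∘ suc))) (sym (neg-distrib-+ (f zero) (Σℚ (f ∘ suc))))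

  Σ-- : ∀ {n} (f g : Fin n → ℚ) → Σℚ (λ i → f i - g i) ≡ Σℚ f - Σℚ g
  Σ-- f g = trans (Σ-+ f (λ i → - g i)) (cong (Σℚ f +_) (Σ-neg g))

  Σ-swap : ∀ {m n} (f : Fin m → Fin n → ℚ) →
    Σℚ (λ i → Σℚ (λ j → f i j)) ≡ Σℚ (λ j → Σℚ (λ i → f i j))
  Σ-swap {zero} {n} f = sym (Σ-0 {n} {λ _ → 0ℚ} (λ _ → refl))
  Σ-swap {suc m} f = trans (cong (Σℚ (f zero) +_) (Σ-swap (f ∘ suc)))
    (sym (Σ-+ (f zero) (λ j → Σℚ (λ i → f (suc i) j))))

  Σ-0≤ : ∀ {n} {f : Fin n → ℚ} → (∀ i → 0ℚ ≤ f i) → 0ℚ ≤ Σℚ f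
  Σ-0≤ {zero} h = ≤-refl
  Σ-0≤ {suc n} h = 0≤p+q (h zero) (Σ-0≤ (h ∘ suc))

  Σ-mono : ∀ {n} {f g : Fin n → ℚ} → (∀ i → f i ≤ g i) → Σℚ f ≤ Σℚ g
  Σ-mono {zero} h = ≤-refl
  Σ-mono {suc n} h = +-mono-≤ (h zero) (Σ-mono (h ∘ suc))

  Σ-punch : ∀ {n} (f : Fin (suc n) → ℚ) p → Σℚ f ≡ f p + Σℚ (f ∘ punchIn p)
  Σ-punch f zero = refl
  Σ-punch {suc n} f (suc p) = trans (cong (f zero +_) (Σ-punch (f ∘ suc) p))
    (lem (f zero) (f (suc p)) (Σℚ (f ∘ suc ∘ punchIn p)))
    where
    lem : ∀ a b c → a + (b + c) ≡ b + (a + c)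
    lem = solve-∀ ℚ-ring

  Σ-0≤≡0 : ∀ {n} {f : Fin n → ℚ} → (∀ i → 0ℚ ≤ f i) → Σℚ f ≡ 0ℚ → ∀ i → f i ≡ 0ℚ
  Σ-0≤≡0 {suc n} {f} h e i = ≤-antisym
    (subst (f i ≤_) (trans (sym (Σ-punch f i)) e)
      (subst (_≤ f i + Σℚ (f ∘ punchIn i)) (+-identityʳ (f i)) (+-monoʳ-≤ (f i) (Σ-0≤ (h ∘ punchIn i)))))
    (h i)

  Σ-0<-any : ∀ {n} {f : Fin n → ℚ} → (∀ i → 0ℚ ≤ f i) → ∀ i → 0ℚ < f i → 0ℚ < Σℚ f
  Σ-0<-any {suc n} {f} h i hi = subst (0ℚ <_) (sym (Σ-punch f i)) (0<p+q hi (Σ-0≤ (h ∘ punchIn i)))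

  δ : ∀ {n} → Fin n → Fin n → ℚ
  δ i j with i Fin.≟ j
  ... | yes _ = 1ℚ
  ... | no _ = 0ℚ

  δ-refl : ∀ {n} (i : Fin n) → δ i i ≡ 1ℚ
  δ-refl i with i Fin.≟ i
  ... | yes _ = refl
  ... | no h = ⊥-elim (h refl)

  δ-≢ : ∀ {n} {i j : Fin n} → i ≢ j → δ i j ≡ 0ℚ
  δ-≢ {i = i} {j} h with i Fin.≟ j
  ... | yes e = ⊥-elim (h e)
  ... | no _ = refl

  δ-sym : ∀ {n} (i j : Fin n) → δ i j ≡ δ j i
  δ-sym i j with i Fin.≟ j
  ... | yes refl = sym (δ-refl i)
  ... | no h = sym (δ-≢ (h ∘ sym))

  0≤δ : ∀ {n} (i j : Fin n) → 0ℚ ≤ δ i j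
  0≤δ i j with i Fin.≟ j
  ... | yes _ = <⇒≤ 0<1
  ... | no _ = ≤-refl

  Σ-single : ∀ {n} (f : Fin n → ℚ) i → (∀ j → j ≢ i → f j ≡ 0ℚ) → Σℚ f ≡ f i
  Σ-single {suc n} f i h = trans (Σ-punch f i)
    (trans (cong (f i +_) (Σ-0 (λ j → h (punchIn i j) (Finₚ.punchInᵢ≢i i j)))) (+-identityʳ (f i)))

  Σ-δ : ∀ {n} (f : Fin n → ℚ) i → Σℚ (λ j → δ i j * f j) ≡ f i
  Σ-δ f i = trans (Σ-single _ i (λ j h → trans (cong (_* f j) (δ-≢ (h ∘ sym))) (*-zeroˡ (f j))))
    (trans (cong (_* f i) (δ-refl i)) (*-identityˡ (f i)))

  infix 7 _·_
  _·_ : ∀ {k} → Vecℚ k → Vecℚ k → ℚ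
  w · y = Σℚ (λ r → w r * y r)

  ·-congʳ : ∀ {k} (w : Vecℚ k) {y y′ : Vecℚ k} → (∀ r → y r ≡ y′ r) → w · y ≡ w · y′
  ·-congʳ w h = Σ-cong (λ r → cong (w r *_) (h r))

  lin : ∀ {m k} → (Fin m → Vecℚ k) → (Fin m → ℚ) → Vecℚ k
  lin g c r = Σℚ (λ j → c j * g j r)

  ·-lin : ∀ {m k} (w : Vecℚ k) (g : Fin m → Vecℚ k) c → w · lin g c ≡ Σℚ (λ j → c j * (w · g j))
  ·-lin w g c = begin
    Σℚ (λ r → w r * Σℚ (λ j → c j * g j r))
      ≡⟨ Σ-cong (λ r → sym (Σ-*ˡ (w r) (λ j → c j * g j r))) ⟩
    Σℚ (λ r → Σℚ (λ j → w r * (c j * g j r)))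
      ≡⟨ Σ-swap (λ r j → w r * (c j * g j r)) ⟩
    Σℚ (λ j → Σℚ (λ r → w r * (c j * g j r)))
      ≡⟨ Σ-cong (λ j → trans (Σ-cong (λ r → lem (w r) (c j) (g j r))) (Σ-*ˡ (c j) (λ r → w r * g j r))) ⟩
    Σℚ (λ j → c j * (w · g j)) ∎
    where
    open ≡-Reasoning
    lem : ∀ a b c → a * (b * c) ≡ b * (a * c)
    lem = solve-∀ ℚ-ring

  lin-· : ∀ {m k} (y : Vecℚ k) (g : Fin m → Vecℚ k) c → lin g c · y ≡ Σℚ (λ j → c j * (g j · y))
  lin-· y g c = trans (Σ-cong (λ r → *-comm (lin g c r) (y r)))
    (trans (·-lin y g c) (Σ-cong (λ j → cong (c j *_) (Σ-cong (λ r → *-comm (y r) (g j r))))))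

  lin-+ : ∀ {m k} (g : Fin m → Vecℚ k) c d r → lin g (λ j → c j + d j) r ≡ lin g c r + lin g d r
  lin-+ g c d r = trans (Σ-cong (λ j → *-distribʳ-+ (g j r) (c j) (d j))) (Σ-+ (λ j → c j * g j r) (λ j → d j * g j r))

  lin-* : ∀ {m k} (g : Fin m → Vecℚ k) a c r → lin g (λ j → a * c j) r ≡ a * lin g c r
  lin-* g a c r = trans (Σ-cong (λ j → *-assoc a (c j) (g j r))) (Σ-*ˡ a (λ j → c j * g j r))

  lin-- : ∀ {m k} (g : Fin m → Vecℚ k) c d r → lin g (λ j → c j - d j) r ≡ lin g c r - lin g d r
  lin-- g c d r = trans (Σ-cong (λ j → lem (c j) (d j) (g j r))) (Σ-- (λ j → c j * g j r) (λ j → d j * g j r))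
    where
    lem : ∀ a b c → (a - b) * c ≡ a * c - b * c
    lem = solve-∀ ℚ-ring

  lin-cong : ∀ {m k} (g : Fin m → Vecℚ k) {c d} → (∀ j → c j ≡ d j) → ∀ r → lin g c r ≡ lin g d r
  lin-cong g h r = Σ-cong (λ j → cong (_* g j r) (h j))

  lin-δ : ∀ {m k} (g : Fin m → Vecℚ k) i r → lin g (δ i) r ≡ g i r
  lin-δ g i r = Σ-δ (λ j → g j r) i

  ·-+ʳ : ∀ {k} (w y z : Vecℚ k) → w · (λ r → y r + z r) ≡ w · y + w · z
  ·-+ʳ w y z = trans (Σ-cong (λ r → *-distribˡ-+ (w r) (y r) (z r))) (Σ-+ (λ r → w r * y r) (λ r → w r * z r))

  ·-*ʳ : ∀ {k} a (w y : Vecℚ k) → w · (λ r → a * y r) ≡ a * (w · y)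
  ·-*ʳ a w y = trans (Σ-cong (λ r → lem a (w r) (y r))) (Σ-*ˡ a (λ r → w r * y r))
    where
    lem : ∀ a b c → b * (a * c) ≡ a * (b * c)
    lem = solve-∀ ℚ-ring

  ·-+ˡ : ∀ {k} (v w y : Vecℚ k) → (λ r → v r + w r) · y ≡ v · y + w · y
  ·-+ˡ v w y = trans (Σ-cong (λ r → *-distribʳ-+ (y r) (v r) (w r))) (Σ-+ (λ r → v r * y r) (λ r → w r * y r))

  ·-*ˡ : ∀ {k} a (w y : Vecℚ k) → (λ r → a * w r) · y ≡ a * (w · y)
  ·-*ˡ a w y = trans (Σ-cong (λ r → *-assoc a (w r) (y r))) (Σ-*ˡ a (λ r → w r * y r))

  -- The finite choice behind every ratio test and every optimal basis below: it separates the case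
  -- without candidates, which is handled by a different argument each time.
  argmin-list : ∀ {a} {A : Set a} {P : A → Set} → (∀ x → Dec (P x)) → (f : A → ℚ) → (xs : List A) →
    (∀ x → x ∈ xs → ¬ P x) ⊎ Σ A (λ x → P x × (∀ y → y ∈ xs → P y → f x ≤ f y))
  argmin-list P? f [] = inj₁ (λ x ())
  argmin-list P? f (x ∷ xs) with P? x | argmin-list P? f xs
  ... | no ¬p | inj₁ h = inj₁ λ { y (here refl) → ¬p ; y (there y∈) → h y y∈ }
  ... | no ¬p | inj₂ (z , pz , h) = inj₂ (z , pz , λ { y (here refl) py → ⊥-elim (¬p py) ; y (there y∈) py → h y y∈ py })
  ... | yes p | inj₁ h = inj₂ (x , p , λ { y (here refl) py → ≤-refl ; y (there y∈) py → ⊥-elim (h y y∈ py) })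
  ... | yes p | inj₂ (z , pz , h) with ≤-total (f x) (f z)
  ... | inj₁ le = inj₂ (x , p , λ { y (here refl) py → ≤-refl ; y (there y∈) py → ≤-trans le (h y y∈ py) })
  ... | inj₂ ge = inj₂ (z , pz , λ { y (here refl) py → ge ; y (there y∈) py → h y y∈ py })

  argmin : ∀ {n} {P : Fin n → Set} → (∀ i → Dec (P i)) → (f : Fin n → ℚ) →
    (∀ i → ¬ P i) ⊎ Σ (Fin n) (λ i → P i × (∀ j → P j → f i ≤ f j))
  argmin {n} P? f with argmin-list P? f (allFin n)
  ... | inj₁ h = inj₁ (λ i → h i (∈-allFin i))
  ... | inj₂ (i , p , h) = inj₂ (i , p , λ j → h j (∈-allFin j))

  -- Linear algebra over ℚ

  Dependent : ∀ {n k} → (Fin n → Vecℚ k) → Set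
  Dependent {n} g = Σ (Fin n → ℚ) λ c → (∀ r → lin g c r ≡ 0ℚ) × Σ (Fin n) λ i → c i ≢ 0ℚ

  module Elimination {n k} (g : Fin (suc n) → Vecℚ (suc k)) (p : Fin (suc n)) (α≢0 : g p zero ≢ 0ℚ) where

    α = g p zero

    ρ : Fin n → ℚ
    ρ j = g (punchIn p j) zero * inv α

    reduced : Fin n → Vecℚ k
    reduced j r = g (punchIn p j) (suc r) - ρ j * g p (suc r)

    -- The coefficient that the pivot vector receives when every other vector is written as its
    -- reduced form plus `ρ j` times the pivot. A combination of `g` vanishes exactly when this sum
    -- and the reduced combination both vanish.
    pivotSum : (Fin (suc n) → ℚ) → ℚ
    pivotSum c = c p + Σℚ (λ j → c (punchIn p j) * ρ j)

    lin-zero : ∀ c → lin g c zero ≡ pivotSum c * α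
    lin-zero c = begin
      lin g c zero ≡⟨ Σ-punch (λ j → c j * g j zero) p ⟩
      c p * α + Σℚ (λ j → c (punchIn p j) * g (punchIn p j) zero)
        ≡⟨ cong (c p * α +_) (Σ-cong (λ j → eq (c (punchIn p j)) (g (punchIn p j) zero))) ⟩
      c p * α + Σℚ (λ j → c (punchIn p j) * ρ j * α)
        ≡⟨ cong (c p * α +_) (Σ-*ʳ α (λ j → c (punchIn p j) * ρ j)) ⟩
      c p * α + Σℚ (λ j → c (punchIn p j) * ρ j) * α
        ≡⟨ sym (*-distribʳ-+ α (c p) (Σℚ (λ j → c (punchIn p j) * ρ j))) ⟩
      pivotSum c * α ∎
      where
      open ≡-Reasoning
      lem : ∀ a b i α → a * (b * i) * α ≡ a * b * (i * α)
      lem = solve-∀ ℚ-ring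
      eq : ∀ a b → a * b ≡ a * (b * inv α) * α
      eq a b = sym (trans (lem a b (inv α) α) (trans (cong (a * b *_) (inv-* α≢0)) (*-identityʳ (a * b))))

    lin-suc : ∀ c r → lin g c (suc r) ≡ pivotSum c * g p (suc r) + lin reduced (c ∘ punchIn p) r
    lin-suc c r = begin
      lin g c (suc r) ≡⟨ Σ-punch (λ j → c j * g j (suc r)) p ⟩
      c p * γ + Σℚ (λ j → c′ j * g (punchIn p j) (suc r))
        ≡⟨ cong (c p * γ +_) (Σ-cong (λ j → lem₁ (c′ j) (ρ j) γ (g (punchIn p j) (suc r)))) ⟩
      c p * γ + Σℚ (λ j → c′ j * ρ j * γ + c′ j * reduced j r)
        ≡⟨ cong (c p * γ +_) (Σ-+ (λ j → c′ j * ρ j * γ) (λ j → c′ j * reduced j r)) ⟩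
      c p * γ + (Σℚ (λ j → c′ j * ρ j * γ) + lin reduced c′ r)
        ≡⟨ cong (λ s → c p * γ + (s + lin reduced c′ r)) (Σ-*ʳ γ (λ j → c′ j * ρ j)) ⟩
      c p * γ + (Σℚ (λ j → c′ j * ρ j) * γ + lin reduced c′ r)
        ≡⟨ lem₂ (c p) γ (Σℚ (λ j → c′ j * ρ j)) (lin reduced c′ r) ⟩
      pivotSum c * γ + lin reduced c′ r ∎
      where
      open ≡-Reasoning
      γ = g p (suc r)
      c′ = c ∘ punchIn p
      lem₁ : ∀ c ρ γ h → c * h ≡ c * ρ * γ + c * (h - ρ * γ)
      lem₁ = solve-∀ ℚ-ring
      lem₂ : ∀ a γ s l → a * γ + (s * γ + l) ≡ (a + s) * γ + l
      lem₂ = solve-∀ ℚ-ring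

    independent : LinIndep reduced → LinIndep g
    independent ind c h i = go (i Fin.≟ p)
      where
      piv≡0 : pivotSum c ≡ 0ℚ
      piv≡0 = *-cancelʳ-0 α≢0 (trans (sym (lin-zero c)) (h zero))
      rest≡0 : ∀ j → c (punchIn p j) ≡ 0ℚ
      rest≡0 = ind (c ∘ punchIn p) λ r → trans
        (sym (trans (cong (λ s → s * g p (suc r) + lin reduced (c ∘ punchIn p) r) piv≡0)
          (trans (cong (_+ lin reduced (c ∘ punchIn p) r) (*-zeroˡ (g p (suc r)))) (+-identityˡ (lin reduced (c ∘ punchIn p) r)))))
        (trans (sym (lin-suc c r)) (h (suc r)))
      go : Dec (i ≡ p) → c i ≡ 0ℚ
      go (yes refl) = trans (sym (+-identityʳ (c p)))
        (trans (cong (c p +_) (sym (Σ-0 (λ j → trans (cong (_* ρ j) (rest≡0 j)) (*-zeroˡ (ρ j)))))) piv≡0)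
      go (no i≢p) = subst (λ i → c i ≡ 0ℚ) (Finₚ.punchIn-punchOut (i≢p ∘ sym)) (rest≡0 (punchOut (i≢p ∘ sym)))

    dependent : Dependent reduced → Dependent g
    dependent (c , h , i , cᵢ≢0) = c⁺ , h⁺ , punchIn p i , λ e → cᵢ≢0 (trans (sym (rest i)) e)
      where
      s = Σℚ (λ j → c j * ρ j)
      c⁺ = insertAt c p (- s)
      rest : ∀ j → c⁺ (punchIn p j) ≡ c j
      rest j = insertAt-punchIn c p (- s) j
      piv≡0 : pivotSum c⁺ ≡ 0ℚ
      piv≡0 = trans (cong₂ _+_ (insertAt-lookup c p (- s)) (Σ-cong (λ j → cong (_* ρ j) (rest j)))) (+-inverseˡ s)
      h⁺ : ∀ r → lin g c⁺ r ≡ 0ℚ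
      h⁺ zero = trans (lin-zero c⁺) (trans (cong (_* α) piv≡0) (*-zeroˡ α))
      h⁺ (suc r) = trans (lin-suc c⁺ r) (trans
        (cong₂ _+_ (trans (cong (_* g p (suc r)) piv≡0) (*-zeroˡ (g p (suc r)))) (trans (lin-cong reduced rest r) (h r)))
        (+-identityˡ 0ℚ))

  -- Pivoting on the first coordinate lowers both the dimension and the number of vectors. The bound
  -- `n ≤ k` is carried along with independence, and all dimension counts below rest on it.
  gauss : ∀ {n k} (g : Fin n → Vecℚ k) → (LinIndep g × n ℕ.≤ k) ⊎ Dependent g
  gauss {zero} g = inj₁ ((λ c _ ()) , ℕ.z≤n)
  gauss {suc n} {zero} g = inj₂ ((λ _ → 1ℚ) , (λ ()) , zero , 1≢0)
  gauss {suc n} {suc k} g with Finₚ.any? (λ p → ¬? (g p zero ≟ 0ℚ))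
  ... | yes (p , α≢0) with gauss (Elimination.reduced g p α≢0)
  ...   | inj₁ (ind , n≤k) = inj₁ (Elimination.independent g p α≢0 ind , ℕ.s≤s n≤k)
  ...   | inj₂ dep = inj₂ (Elimination.dependent g p α≢0 dep)
  gauss {suc n} {suc k} g | no ¬pivot with gauss (λ j r → g j (suc r))
  ...   | inj₁ (ind , n≤k) = inj₁ ((λ c h → ind c (h ∘ suc)) , ℕₚ.m≤n⇒m≤1+n n≤k)
  ...   | inj₂ (c , h , nz) = inj₂ (c , h⁺ , nz)
    where
    h⁺ : ∀ r → lin g c r ≡ 0ℚ
    h⁺ zero = Σ-0 λ j → trans (cong (c j *_) (decidable-stable (g j zero ≟ 0ℚ) (λ ne → ¬pivot (j , ne)))) (*-zeroʳ (c j))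
    h⁺ (suc r) = h r

  Spanning : ∀ {n k} → (Fin n → Vecℚ k) → Set
  Spanning {n} {k} g = ∀ (y : Vecℚ k) → Σ (Fin n → ℚ) λ c → ∀ r → y r ≡ lin g c r

  -- Expanding the unit vectors in `g` gives `k` coefficient vectors in dimension `n`. A relation
  -- `y` among them would expand the vector `y` with zero coefficients, so they are independent and
  -- elimination bounds their number.
  spanning⇒≥ : ∀ {n k} (g : Fin n → Vecℚ k) → Spanning g → k ℕ.≤ n
  spanning⇒≥ {n} {k} g span with gauss C
    where
    C : Fin k → Vecℚ n
    C r = proj₁ (span (δ r))
  ... | inj₁ (_ , k≤n) = k≤n
  ... | inj₂ (y , h , i , yᵢ≢0) = ⊥-elim (yᵢ≢0 (trans (sym (eq i)) (zero-sum i)))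
    where
    open ≡-Reasoning
    C : Fin k → Vecℚ n
    C r = proj₁ (span (δ r))
    eq : ∀ i → Σℚ (λ r → y r * δ r i) ≡ y i
    eq i = trans (Σ-cong (λ r → trans (*-comm (y r) (δ r i)) (cong (_* y r) (δ-sym r i)))) (Σ-δ y i)
    zero-sum : ∀ i → Σℚ (λ r → y r * δ r i) ≡ 0ℚ
    zero-sum i = begin
      Σℚ (λ r → y r * δ r i) ≡⟨ Σ-cong (λ r → cong (y r *_) (proj₂ (span (δ r)) i)) ⟩
      Σℚ (λ r → y r * Σℚ (λ j → C r j * g j i)) ≡⟨ Σ-cong (λ r → sym (Σ-*ˡ (y r) (λ j → C r j * g j i))) ⟩
      Σℚ (λ r → Σℚ (λ j → y r * (C r j * g j i))) ≡⟨ Σ-swap (λ r j → y r * (C r j * g j i)) ⟩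
      Σℚ (λ j → Σℚ (λ r → y r * (C r j * g j i)))
        ≡⟨ Σ-cong (λ j → trans (Σ-cong (λ r → sym (*-assoc (y r) (C r j) (g j i)))) (Σ-*ʳ (g j i) (λ r → y r * C r j))) ⟩
      Σℚ (λ j → lin C y j * g j i) ≡⟨ Σ-0 (λ j → trans (cong (_* g j i) (h j)) (*-zeroˡ (g j i))) ⟩
      0ℚ ∎

  spanning⇒basis : ∀ {n k} (g : Fin n → Vecℚ k) → Spanning g → Σ (Fin k → Fin n) λ s → LinIndep (g ∘ s)
  spanning⇒basis {n} {k} g span with gauss g
  ... | inj₁ (ind , n≤k) with ℕₚ.≤-antisym n≤k (spanning⇒≥ g span)
  ...   | refl = (λ i → i) , ind
  spanning⇒basis {suc n} {k} g span | inj₂ (c , h , i , cᵢ≢0) =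
    let (s , ind) = spanning⇒basis (g ∘ punchIn i) span′ in punchIn i ∘ s , ind
    where
    open ≡-Reasoning
    κ = inv (c i)
    lem : ∀ a d c κ → a - d * κ * c ≡ a + (- (d * κ)) * c
    lem = solve-∀ ℚ-ring
    lem₂ : ∀ d κ c → d - d * κ * c ≡ d * (1ℚ - κ * c)
    lem₂ = solve-∀ ℚ-ring
    span′ : Spanning (g ∘ punchIn i)
    span′ y with span y
    ... | d , hd = e ∘ punchIn i , λ r → begin
      y r ≡⟨ hd r ⟩
      lin g d r ≡⟨ sym (trans (cong (λ q → lin g d r - q) (trans (lin-* g (d i * κ) c r)
                      (trans (cong (d i * κ *_) (h r)) (*-zeroʳ (d i * κ))))) (+-identityʳ (lin g d r))) ⟩
      lin g d r - lin g (λ j → d i * κ * c j) r ≡⟨ sym (lin-- g d (λ j → d i * κ * c j) r) ⟩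
      lin g e r ≡⟨ Σ-punch (λ j → e j * g j r) i ⟩
      e i * g i r + lin (g ∘ punchIn i) (e ∘ punchIn i) r
        ≡⟨ cong (_+ lin (g ∘ punchIn i) (e ∘ punchIn i) r) (trans (cong (_* g i r) eᵢ≡0) (*-zeroˡ (g i r))) ⟩
      0ℚ + lin (g ∘ punchIn i) (e ∘ punchIn i) r ≡⟨ +-identityˡ (lin (g ∘ punchIn i) (e ∘ punchIn i) r) ⟩
      lin (g ∘ punchIn i) (e ∘ punchIn i) r ∎
      where
      -- This multiple of the relation cancels the coefficient of the dropped vector.
      e : Fin (suc n) → ℚ
      e j = d j - d i * κ * c j
      eᵢ≡0 : e i ≡ 0ℚ
      eᵢ≡0 = trans (lem₂ (d i) κ (c i)) (trans (cong (λ q → d i * (1ℚ - q)) (inv-* cᵢ≢0))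
        (trans (cong (d i *_) (p-p≡0 1ℚ)) (*-zeroʳ (d i))))

  -- Together with `y` there is one vector too many for the dimension, so a relation exists. Its
  -- coefficient at `y` is nonzero because `g` is independent, and the relation can be solved for
  -- `y`.
  independent⇒spanning : ∀ {k} (g : Fin k → Vecℚ k) → LinIndep g → Spanning g
  independent⇒spanning {k} g ind y with gauss g⁺
    where
    g⁺ : Fin (suc k) → Vecℚ k
    g⁺ zero = y
    g⁺ (suc i) = g i
  ... | inj₁ (_ , 1+k≤k) = ⊥-elim (ℕₚ.<-irrefl refl 1+k≤k)
  ... | inj₂ (c , h , nz) = (λ i → - κ * c (suc i)) , λ r → begin
    y r ≡⟨ lem (y r) (c zero) κ (lin g (c ∘ suc) r) (inv-* c₀≢0) ⟩
    κ * (c zero * y r + lin g (c ∘ suc) r) + - κ * lin g (c ∘ suc) r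
      ≡⟨ cong (λ q → κ * q + - κ * lin g (c ∘ suc) r) (h r) ⟩
    κ * 0ℚ + - κ * lin g (c ∘ suc) r
      ≡⟨ trans (cong (_+ - κ * lin g (c ∘ suc) r) (*-zeroʳ κ)) (+-identityˡ (- κ * lin g (c ∘ suc) r)) ⟩
    - κ * lin g (c ∘ suc) r ≡⟨ sym (lin-* g (- κ) (c ∘ suc) r) ⟩
    lin g (λ i → - κ * c (suc i)) r ∎
    where
    open ≡-Reasoning
    κ = inv (c zero)
    c₀≢0 : c zero ≢ 0ℚ
    c₀≢0 e = go nz
      where
      tail : ∀ i → c (suc i) ≡ 0ℚ
      tail = ind (c ∘ suc) λ r → trans
        (sym (trans (cong (_+ lin g (c ∘ suc) r) (trans (cong (_* y r) e) (*-zeroˡ (y r)))) (+-identityˡ (lin g (c ∘ suc) r))))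
        (h r)
      go : ¬ Σ (Fin (suc k)) λ i → c i ≢ 0ℚ
      go (zero , ne) = ne e
      go (suc i , ne) = ne (tail i)
    lem₁ : ∀ y c κ l → κ * (c * y + l) + - κ * l ≡ κ * c * y
    lem₁ = solve-∀ ℚ-ring
    lem : ∀ y c κ l → κ * c ≡ 1ℚ → y ≡ κ * (c * y + l) + - κ * l
    lem y c κ l e = sym (trans (lem₁ y c κ l) (trans (cong (_* y) e) (*-identityˡ y)))

  -- Column sets as masks, and bases

  Mask : ℕ → Set
  Mask m = Vec Bool m

  true∨false : ∀ b → b ≡ true ⊎ b ≡ false
  true∨false true = inj₁ refl
  true∨false false = inj₂ refl

  true≢false : ∀ {b} → b ≡ true → b ≢ false
  true≢false refl ()

  by-mask : ∀ {P : Set} b → (b ≡ true → P) → (b ≡ false → P) → P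
  by-mask true f h = f refl
  by-mask false f h = h refl

  lookup-ext : ∀ {A : Set} {n} {v w : Vec A n} → (∀ j → lookup v j ≡ lookup w j) → v ≡ w
  lookup-ext {v = v} {w} h = trans (sym (Vecₚ.tabulate∘lookup v)) (trans (Vecₚ.tabulate-cong h) (Vecₚ.tabulate∘lookup w))

  size : ∀ {m} → Mask m → ℕ
  size [] = 0
  size (true ∷ t) = suc (size t)
  size (false ∷ t) = size t

  enum : ∀ {m} (t : Mask m) → Fin (size t) → Fin m
  enum (true ∷ t) zero = zero
  enum (true ∷ t) (suc i) = suc (enum t i)
  enum (false ∷ t) i = suc (enum t i)

  -- Sums over bases run over masks, where each column set occurs once; simplicial cones are given
  -- by tuples. This relation translates between the two.
  Enumerates : ∀ {n m} → (Fin n → Fin m) → Mask m → Set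
  Enumerates s t = (∀ i → lookup t (s i) ≡ true) × (∀ j → lookup t j ≡ true → Σ _ λ i → s i ≡ j)

  enum-enumerates : ∀ {m} (t : Mask m) → Enumerates (enum t) t
  enum-enumerates [] = (λ ()) , (λ ())
  enum-enumerates (true ∷ t) = (λ { zero → refl ; (suc i) → proj₁ (enum-enumerates t) i })
    , λ { zero _ → zero , refl
        ; (suc j) h → let (i , e) = proj₂ (enum-enumerates t) j h in suc i , cong suc e }
  enum-enumerates (false ∷ t) = proj₁ (enum-enumerates t)
    , λ { (suc j) h → let (i , e) = proj₂ (enum-enumerates t) j h in i , cong suc e }

  enum-injective : ∀ {m} (t : Mask m) → Injective _≡_ _≡_ (enum t)
  enum-injective (true ∷ t) {zero} {zero} e = refl
  enum-injective (true ∷ t) {suc i} {suc j} e = cong suc (enum-injective t (Finₚ.suc-injective e))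
  enum-injective (false ∷ t) e = enum-injective t (Finₚ.suc-injective e)

  image : ∀ {n m} → (Fin n → Fin m) → Mask m
  image s = tabulate (λ j → does (Finₚ.any? (λ i → s i Fin.≟ j)))

  image-enumerates : ∀ {n m} (s : Fin n → Fin m) → Enumerates s (image s)
  image-enumerates s = (λ i → trans (Vecₚ.lookup∘tabulate _ (s i)) (dec-true (Finₚ.any? (λ i′ → s i′ Fin.≟ s i)) (i , refl)))
    , λ j h → back j (trans (sym (Vecₚ.lookup∘tabulate _ j)) h)
    where
    back : ∀ j → does (Finₚ.any? (λ i → s i Fin.≟ j)) ≡ true → Σ _ λ i → s i ≡ j
    back j h with Finₚ.any? (λ i → s i Fin.≟ j)
    ... | yes p = p
    back j () | no _

  -- Extension of coefficients by zero along `s`. Values at coinciding indices add up, so `Σ-push`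
  -- holds for tuples with repetitions as well.
  push : ∀ {n m} → (Fin n → Fin m) → (Fin n → ℚ) → Fin m → ℚ
  push s c j = Σℚ (λ i → c i * δ (s i) j)

  Σ-push : ∀ {n m} (s : Fin n → Fin m) c (f : Fin m → ℚ) → Σℚ (λ j → push s c j * f j) ≡ Σℚ (λ i → c i * f (s i))
  Σ-push s c f = begin
    Σℚ (λ j → push s c j * f j) ≡⟨ Σ-cong (λ j → sym (Σ-*ʳ (f j) (λ i → c i * δ (s i) j))) ⟩
    Σℚ (λ j → Σℚ (λ i → c i * δ (s i) j * f j)) ≡⟨ Σ-swap (λ j i → c i * δ (s i) j * f j) ⟩
    Σℚ (λ i → Σℚ (λ j → c i * δ (s i) j * f j))
      ≡⟨ Σ-cong (λ i → trans (Σ-cong (λ j → *-assoc (c i) (δ (s i) j) (f j)))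
           (trans (Σ-*ˡ (c i) (λ j → δ (s i) j * f j)) (cong (c i *_) (Σ-δ f (s i))))) ⟩
    Σℚ (λ i → c i * f (s i)) ∎
    where open ≡-Reasoning

  push-at : ∀ {n m} (s : Fin n → Fin m) c → Injective _≡_ _≡_ s → ∀ i → push s c (s i) ≡ c i
  push-at s c inj i = trans
    (Σ-single (λ i′ → c i′ * δ (s i′) (s i)) i (λ i′ ne → trans (cong (c i′ *_) (δ-≢ (λ e → ne (inj e)))) (*-zeroʳ (c i′))))
    (trans (cong (c i *_) (δ-refl (s i))) (*-identityʳ (c i)))

  push-off : ∀ {n m} (s : Fin n → Fin m) c j → (∀ i → s i ≢ j) → push s c j ≡ 0ℚ
  push-off s c j h = Σ-0 (λ i → trans (cong (c i *_) (δ-≢ (h i))) (*-zeroʳ (c i)))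

  push-supported : ∀ {n m} (s : Fin n → Fin m) {t : Mask m} c → Enumerates s t → ∀ j → lookup t j ≡ false → push s c j ≡ 0ℚ
  push-supported s {t} c (e , _) j h = push-off s c j (λ i eq → true≢false (e i) (trans (cong (lookup t) eq) h))

  push-0≤ : ∀ {n m} (s : Fin n → Fin m) c → (∀ i → 0ℚ ≤ c i) → ∀ j → 0ℚ ≤ push s c j
  push-0≤ s c h j = Σ-0≤ (λ i → 0≤p*q (h i) (0≤δ (s i) j))

  push-∘ : ∀ {n m} (s : Fin n → Fin m) {t : Mask m} → Injective _≡_ _≡_ s → Enumerates s t → (c : Fin m → ℚ) →
    (∀ j → lookup t j ≡ false → c j ≡ 0ℚ) → ∀ j → push s (c ∘ s) j ≡ c j
  push-∘ s {t} inj en c off j with true∨false (lookup t j)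
  ... | inj₂ f = trans (push-supported s {t} (c ∘ s) en j f) (sym (off j f))
  ... | inj₁ tt with proj₂ en j tt
  ...   | i , refl = push-at s (c ∘ s) inj i

  independent⇒injective : ∀ {n k m} (g : Fin m → Vecℚ k) (s : Fin n → Fin m) → LinIndep (g ∘ s) → Injective _≡_ _≡_ s
  independent⇒injective g s ind {i} {j} e with i Fin.≟ j
  ... | yes i≡j = i≡j
  ... | no i≢j = ⊥-elim (1≢0 (trans (sym cᵢ) (ind c h i)))
    where
    c : Fin _ → ℚ
    c a = δ i a - δ j a
    cᵢ : c i ≡ 1ℚ
    cᵢ = trans (cong₂ _-_ (δ-refl i) (δ-≢ (i≢j ∘ sym))) (+-identityʳ 1ℚ)
    h : ∀ r → lin (g ∘ s) c r ≡ 0ℚ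
    h r = trans (lin-- (g ∘ s) (δ i) (δ j) r)
      (trans (cong₂ _-_ (lin-δ (g ∘ s) i r) (lin-δ (g ∘ s) j r))
        (p≡q⇒p-q≡0 (cong (λ a → g a r) e)))

  module Bases {m k} (g : Fin m → Vecℚ k) where

    -- W j is the coordinate functional of the column j, extended by zero off the mask.
    record Basis (t : Mask m) : Set where
      field
        W : Fin m → Vecℚ k
        W-off : ∀ j → lookup t j ≡ false → ∀ r → W j r ≡ 0ℚ
        expand : ∀ y r → y r ≡ lin g (λ j → W j · y) r
        dual : ∀ i j → lookup t j ≡ true → W i · g j ≡ δ i j

      W-off· : ∀ {j} → lookup t j ≡ false → ∀ y → W j · y ≡ 0ℚ
      W-off· {j} h y = Σ-0 (λ r → trans (cong (_* y r) (W-off j h r)) (*-zeroˡ (y r)))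

      W·g : ∀ c → (∀ j → lookup t j ≡ false → c j ≡ 0ℚ) → ∀ i → W i · lin g c ≡ c i
      W·g c off i = trans (·-lin (W i) g c) (trans (Σ-cong eq) (Σ-δ c i))
        where
        eq : ∀ j → c j * (W i · g j) ≡ δ i j * c j
        eq j with true∨false (lookup t j)
        ... | inj₁ h = trans (cong (c j *_) (dual i j h)) (*-comm (c j) (δ i j))
        ... | inj₂ h = trans (cong (_* (W i · g j)) (off j h))
          (trans (*-zeroˡ (W i · g j)) (sym (trans (cong (δ i j *_) (off j h)) (*-zeroʳ (δ i j)))))

      coord : ∀ y c → (∀ j → lookup t j ≡ false → c j ≡ 0ℚ) → (∀ r → y r ≡ lin g c r) → ∀ i → W i · y ≡ c i
      coord y c off h i = trans (·-congʳ (W i) h) (W·g c off i)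

      expand· : ∀ w y → w · y ≡ Σℚ (λ j → (W j · y) * (w · g j))
      expand· w y = trans (·-congʳ w (expand y)) (·-lin w g (λ j → W j · y))

      on⇐W≢0 : ∀ {j y} → W j · y ≢ 0ℚ → lookup t j ≡ true
      on⇐W≢0 {j} {y} ne with true∨false (lookup t j)
      ... | inj₁ h = h
      ... | inj₂ h = ⊥-elim (ne (W-off· h y))

      Feasible : Vecℚ k → Set
      Feasible y = ∀ j → 0ℚ ≤ W j · y

      feasible? : ∀ y → Dec (Feasible y)
      feasible? y = Finₚ.all? (λ j → 0ℚ ≤? W j · y)

    open Basis

    -- Coordinates depend on the mask alone. Sums over masks see only the witness selected by
    -- `basis?`, and this lemma moves statements about it to any other witness.
    W-unique : ∀ {t} (β β′ : Basis t) i y → W β i · y ≡ W β′ i · y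
    W-unique β β′ i y = coord β y (λ j → W β′ j · y) (λ j h → W-off· β′ h y) (expand β′ y) i

    -- The coordinate functionals are the rows of the inverse of the selected square matrix, whose
    -- column `r` holds the coefficients of the unit vector `δ r`. Duality is uniqueness of the
    -- expansion of `g (s i)`.
    tuple⇒basis : (s : Fin k → Fin m) → LinIndep (g ∘ s) → (t : Mask m) → Enumerates s t → Basis t
    tuple⇒basis s ind t en = record { W = W′ ; W-off = off ; expand = exp ; dual = du }
      where
      C : Fin k → Fin k → ℚ
      C r = proj₁ (independent⇒spanning (g ∘ s) ind (δ r))
      hC : ∀ r q → δ r q ≡ lin (g ∘ s) (C r) q
      hC r = proj₂ (independent⇒spanning (g ∘ s) ind (δ r))
      V : Fin k → Vecℚ k
      V i r = C r i
      W′ : Fin m → Vecℚ k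
      W′ j r = push s (λ i → V i r) j
      off : ∀ j → lookup t j ≡ false → ∀ r → W′ j r ≡ 0ℚ
      off j h r = push-supported s {t} (λ i → V i r) en j h
      W′· : ∀ j y → W′ j · y ≡ push s (λ i → V i · y) j
      W′· j y = begin
        Σℚ (λ r → Σℚ (λ i → V i r * δ (s i) j) * y r)
          ≡⟨ Σ-cong (λ r → sym (Σ-*ʳ (y r) (λ i → V i r * δ (s i) j))) ⟩
        Σℚ (λ r → Σℚ (λ i → V i r * δ (s i) j * y r))
          ≡⟨ Σ-swap (λ r i → V i r * δ (s i) j * y r) ⟩
        Σℚ (λ i → Σℚ (λ r → V i r * δ (s i) j * y r))
          ≡⟨ Σ-cong (λ i → trans (Σ-cong (λ r → lem (V i r) (δ (s i) j) (y r))) (Σ-*ʳ (δ (s i) j) (λ r → V i r * y r))) ⟩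
        Σℚ (λ i → (V i · y) * δ (s i) j) ∎
        where
        open ≡-Reasoning
        lem : ∀ a b c → a * b * c ≡ a * c * b
        lem = solve-∀ ℚ-ring
      V-exp : ∀ y q → y q ≡ lin (g ∘ s) (λ i → V i · y) q
      V-exp y q = begin
        y q ≡⟨ sym (Σ-δ y q) ⟩
        Σℚ (λ r → δ q r * y r) ≡⟨ Σ-cong (λ r → cong (_* y r) (trans (δ-sym q r) (hC r q))) ⟩
        Σℚ (λ r → Σℚ (λ i → C r i * g (s i) q) * y r) ≡⟨ Σ-cong (λ r → sym (Σ-*ʳ (y r) (λ i → C r i * g (s i) q))) ⟩
        Σℚ (λ r → Σℚ (λ i → C r i * g (s i) q * y r)) ≡⟨ Σ-swap (λ r i → C r i * g (s i) q * y r) ⟩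
        Σℚ (λ i → Σℚ (λ r → C r i * g (s i) q * y r))
          ≡⟨ Σ-cong (λ i → trans (Σ-cong (λ r → lem (C r i) (g (s i) q) (y r))) (Σ-*ʳ (g (s i) q) (λ r → C r i * y r))) ⟩
        Σℚ (λ i → (V i · y) * g (s i) q) ∎
        where
        open ≡-Reasoning
        lem : ∀ a b c → a * b * c ≡ a * c * b
        lem = solve-∀ ℚ-ring
      exp : ∀ y r → y r ≡ lin g (λ j → W′ j · y) r
      exp y r = trans (V-exp y r) (trans (sym (Σ-push s (λ i → V i · y) (λ j → g j r)))
        (Σ-cong (λ j → cong (_* g j r) (sym (W′· j y)))))
      V-dual : ∀ a i → V a · g (s i) ≡ δ a i
      V-dual a i = trans (p-q≡0⇒p≡q (ind (λ a → V a · g (s i) - δ i a) zero-comb a)) (δ-sym i a)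
        where
        zero-comb : ∀ r → lin (g ∘ s) (λ a → V a · g (s i) - δ i a) r ≡ 0ℚ
        zero-comb r = trans (lin-- (g ∘ s) (λ a → V a · g (s i)) (δ i) r)
          (p≡q⇒p-q≡0 (trans (sym (V-exp (g (s i)) r)) (sym (lin-δ (g ∘ s) i r))))
      du : ∀ i j → lookup t j ≡ true → W′ i · g j ≡ δ i j
      du i j h with proj₂ en j h
      ... | b , refl = trans (W′· i (g (s b))) (trans (Σ-cong (λ a → cong (_* δ (s a) i) (trans (V-dual a b) (δ-sym a b))))
        (trans (Σ-δ (λ a → δ (s a) i) b) (δ-sym (s b) i)))

    enum-independent : ∀ {t} → Basis t → LinIndep (g ∘ enum t)
    enum-independent {t} β c h i = begin
      c i ≡⟨ sym (push-at (enum t) c (enum-injective t) i) ⟩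
      push (enum t) c (enum t i)
        ≡⟨ sym (W·g β (push (enum t) c) (push-supported (enum t) {t} c (enum-enumerates t)) (enum t i)) ⟩
      W β (enum t i) · lin g (push (enum t) c)
        ≡⟨ Σ-0 (λ r → trans (cong (W β (enum t i) r *_) (trans (Σ-push (enum t) c (λ j → g j r)) (h r))) (*-zeroʳ (W β (enum t i) r))) ⟩
      0ℚ ∎
      where open ≡-Reasoning

    Σ-supported : ∀ {n} (s : Fin n → Fin m) {t : Mask m} → Injective _≡_ _≡_ s → Enumerates s t → (c f : Fin m → ℚ) →
      (∀ j → lookup t j ≡ false → c j ≡ 0ℚ) → Σℚ (λ j → c j * f j) ≡ Σℚ (λ i → c (s i) * f (s i))
    Σ-supported s {t} inj en c f off = trans (Σ-cong (λ j → cong (_* f j) (sym (push-∘ s {t} inj en c off j)))) (Σ-push s (c ∘ s) f)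

    size≡ : ∀ {t} → Basis t → size t ≡ k
    size≡ {t} β = ℕₚ.≤-antisym upper (spanning⇒≥ (g ∘ enum t) span)
      where
      upper : size t ℕ.≤ k
      upper with gauss (g ∘ enum t)
      ... | inj₁ (_ , le) = le
      ... | inj₂ (c , h , i , ne) = ⊥-elim (ne (enum-independent β c h i))
      span : Spanning (g ∘ enum t)
      span y = (λ i → W β (enum t i) · y) , λ r → trans (expand β y r)
        (Σ-supported (enum t) {t} (enum-injective t) (enum-enumerates t) (λ j → W β j · y) (λ j → g j r) (λ j h → W-off· β h y))

    abstract
      basis? : ∀ t → Dec (Basis t)
      basis? t with size t ℕ.≟ k
      ... | no ne = no (ne ∘ size≡)
      ... | yes e with gauss (g ∘ enum t)
      ...   | inj₂ (c , h , i , ne) = no (λ β → ne (enum-independent β c h i))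
      ...   | inj₁ (ind , _) = yes (go e (enum t) ind (enum-enumerates t))
        where
        go : ∀ {n} → n ≡ k → (s : Fin n → Fin m) → LinIndep (g ∘ s) → Enumerates s t → Basis t
        go refl s ind en = tuple⇒basis s ind t en

    basis⇒tuple : ∀ {t} → Basis t → Σ (Fin k → Fin m) λ s → Injective _≡_ _≡_ s × LinIndep (g ∘ s) × Enumerates s t
    basis⇒tuple {t} β = go (size≡ β) (enum t) (enum-injective t) (enum-independent β) (enum-enumerates t)
      where
      go : ∀ {n} → n ≡ k → (s : Fin n → Fin m) → Injective _≡_ _≡_ s → LinIndep (g ∘ s) → Enumerates s t →
        Σ (Fin k → Fin m) λ s → Injective _≡_ _≡_ s × LinIndep (g ∘ s) × Enumerates s t
      go refl s inj ind en = s , inj , ind , en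

    feasible⇒inPos : ∀ {n t} (β : Basis t) (s : Fin n → Fin m) → Injective _≡_ _≡_ s → Enumerates s t → ∀ {y} → Feasible β y → InPos (g ∘ s) y
    feasible⇒inPos {n} {t} β s inj en {y} f = (λ i → W β (s i) · y) , (λ i → f (s i)) , λ r → trans (expand β y r)
      (Σ-supported s {t} inj en (λ j → W β j · y) (λ j → g j r) (λ j h → W-off· β h y))

    inPos⇒feasible : ∀ {n t} (β : Basis t) (s : Fin n → Fin m) → Enumerates s t → ∀ {y} → InPos (g ∘ s) y → Feasible β y
    inPos⇒feasible {n} {t} β s en {y} (c , 0≤c , h) j =
      subst (0ℚ ≤_) (sym (coord β y (push s c) (push-supported s {t} c en) (λ r → trans (h r) (sym (Σ-push s c (λ j → g j r)))) j))
        (push-0≤ s c 0≤c j)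

    -- Says that `t′` is `t` with `i` replaced by `j`, through membership only. Thus it covers masks
    -- of the form `swap t i j` as well as two masks over a common facet.
    Exchange : Mask m → Fin m → Fin m → Mask m → Set
    Exchange t i j t′ =
      lookup t′ j ≡ true
      × (∀ l → lookup t′ l ≡ true → l ≢ j → l ≢ i × lookup t l ≡ true)
      × (∀ l → lookup t′ l ≡ false → l ≢ j × (l ≢ i → lookup t l ≡ false))

    -- The vector `θ` is the relation that cancels `g j` against its own expansion, so adding a
    -- multiple of it to the coordinates keeps them an expansion of `y`. The multiple is chosen to
    -- make coordinate `i` vanish, which gives one formula for all `l`, the entering column
    -- included.
    exchange : ∀ {t t′ i j} → Exchange t i j t′ → (β : Basis t) → lookup t i ≡ true → W β i · g j ≢ 0ℚ →
      Σ (Basis t′) λ β′ → ∀ l y →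
        W β′ l · y ≡ W β l · y + (δ l j - W β l · g j) * ((W β i · y) * inv (W β i · g j))
    exchange {t} {t′} {i} {j} (t′j , on , off) β tᵢ α≢0 =
      record { W = W′ ; W-off = off′ ; expand = exp′ ; dual = dual′ } , W′·
      where
      α = W β i · g j
      θ : Fin m → ℚ
      θ l = δ l j - W β l · g j
      W′ : Fin m → Vecℚ k
      W′ l r = W β l r + θ l * inv α * W β i r
      W′· : ∀ l y → W′ l · y ≡ W β l · y + θ l * ((W β i · y) * inv α)
      W′· l y = trans (·-+ˡ (W β l) (λ r → θ l * inv α * W β i r) y) (cong (W β l · y +_)
        (trans (·-*ˡ (θ l * inv α) (W β i) y) (lem (θ l) (inv α) (W β i · y))))
        where
        lem : ∀ a b c → a * b * c ≡ a * (c * b)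
        lem = solve-∀ ℚ-ring
      off′ : ∀ l → lookup t′ l ≡ false → ∀ r → W′ l r ≡ 0ℚ
      off′ l h r with proj₁ (off l h) | l Fin.≟ i
      ... | l≢j | yes refl = trans (cong (λ q → W β i r + (q - α) * inv α * W β i r) (δ-≢ l≢j))
        (trans (lem (W β i r) α (inv α)) (trans (cong (λ q → W β i r - q * W β i r) (*-inv α≢0)) (lem₂ (W β i r))))
        where
        lem : ∀ w α κ → w + (0ℚ - α) * κ * w ≡ w - α * κ * w
        lem = solve-∀ ℚ-ring
        lem₂ : ∀ w → w - 1ℚ * w ≡ 0ℚ
        lem₂ = solve-∀ ℚ-ring
      ... | l≢j | no l≢i = trans (cong₂ (λ a b → a + (b * inv α * W β i r)) (W-off β l tl r)
          (cong₂ _-_ (δ-≢ l≢j) (W-off· β tl (g j)))) (lem (inv α) (W β i r))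
        where
        tl = proj₂ (off l h) l≢i
        lem : ∀ a b → 0ℚ + (0ℚ - 0ℚ) * a * b ≡ 0ℚ
        lem = solve-∀ ℚ-ring
      exp′ : ∀ y r → y r ≡ lin g (λ l → W′ l · y) r
      exp′ y r = sym (begin
        lin g (λ l → W′ l · y) r
          ≡⟨ lin-cong g (λ l → trans (W′· l y) (cong (W β l · y +_) (*-comm (θ l) μ))) r ⟩
        lin g (λ l → W β l · y + μ * θ l) r ≡⟨ lin-+ g (λ l → W β l · y) (λ l → μ * θ l) r ⟩
        lin g (λ l → W β l · y) r + lin g (λ l → μ * θ l) r
          ≡⟨ cong₂ _+_ (sym (expand β y r)) (trans (lin-* g μ θ r) (trans (cong (μ *_) θ≡0) (*-zeroʳ μ))) ⟩
        y r + 0ℚ ≡⟨ +-identityʳ (y r) ⟩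
        y r ∎)
        where
        open ≡-Reasoning
        μ = (W β i · y) * inv α
        θ≡0 : lin g θ r ≡ 0ℚ
        θ≡0 = trans (lin-- g (λ l → δ l j) (λ l → W β l · g j) r)
          (p≡q⇒p-q≡0 (trans (lin-cong g (λ l → δ-sym l j) r) (trans (lin-δ g j r) (expand β (g j) r))))
      dual′ : ∀ l q → lookup t′ q ≡ true → W′ l · g q ≡ δ l q
      dual′ l q h with q Fin.≟ j
      ... | yes refl = trans (W′· l (g j)) (trans (cong (λ x → W β l · g j + θ l * x) (*-inv α≢0)) (lem (W β l · g j) (δ l j)))
        where
        lem : ∀ a b → a + (b - a) * 1ℚ ≡ b
        lem = solve-∀ ℚ-ring
      ... | no q≢j = trans (W′· l (g q)) (trans
        (cong₂ (λ a b → a + θ l * (b * inv α)) (dual β l q tq) (trans (dual β i q tq) (δ-≢ (q≢i ∘ sym))))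
        (lem (δ l q) (θ l) (inv α)))
        where
        q≢i = proj₁ (on q h q≢j)
        tq = proj₂ (on q h q≢j)
        lem : ∀ a b c → a + b * (0ℚ * c) ≡ a
        lem = solve-∀ ℚ-ring

    swap : Mask m → Fin m → Fin m → Mask m
    swap t i j = (t [ i ]≔ false) [ j ]≔ true

    swap-exchange : ∀ t {i j} → i ≢ j → Exchange t i j (swap t i j)
    swap-exchange t {i} {j} i≢j = Vecₚ.lookup∘update j (t [ i ]≔ false) true , on , off
      where
      at-l : ∀ l → l ≢ j → lookup (swap t i j) l ≡ lookup (t [ i ]≔ false) l
      at-l l ne = Vecₚ.lookup∘update′ ne (t [ i ]≔ false) true
      on : ∀ l → lookup (swap t i j) l ≡ true → l ≢ j → l ≢ i × lookup t l ≡ true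
      on l h ne with l Fin.≟ i
      ... | yes refl = ⊥-elim (true≢false (trans (sym (at-l l ne)) h) (Vecₚ.lookup∘update i t false))
      ... | no l≢i = l≢i , trans (sym (Vecₚ.lookup∘update′ l≢i t false)) (trans (sym (at-l l ne)) h)
      off : ∀ l → lookup (swap t i j) l ≡ false → l ≢ j × (l ≢ i → lookup t l ≡ false)
      off l h = l≢j , λ l≢i → trans (sym (Vecₚ.lookup∘update′ l≢i t false)) (trans (sym (at-l l l≢j)) h)
        where
        l≢j : l ≢ j
        l≢j refl = true≢false (Vecₚ.lookup∘update j (t [ i ]≔ false) true) h

  -- Perturbation, pivoting and chambers

  allMasks : ∀ m → List (Mask m)
  allMasks zero = [] ∷ []
  allMasks (suc m) = List.map (true ∷_) (allMasks m) ++ List.map (false ∷_) (allMasks m)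

  ∈-allMasks : ∀ {m} (t : Mask m) → t ∈ allMasks m
  ∈-allMasks [] = here refl
  ∈-allMasks {suc m} (true ∷ t) = ∈-++⁺ˡ (∈-map⁺ (true ∷_) (∈-allMasks t))
  ∈-allMasks {suc m} (false ∷ t) = ∈-++⁺ʳ (List.map (true ∷_) (allMasks m)) (∈-map⁺ (false ∷_) (∈-allMasks t))

  0<-perturb : ∀ {a} → 0ℚ < a → ∀ b → Σ ℚ λ ε₀ → 0ℚ < ε₀ × (∀ ε → 0ℚ < ε → ε ≤ ε₀ → 0ℚ < a + ε * b)
  0<-perturb {a} 0<a b with ≤-total 0ℚ b
  ... | inj₁ 0≤b = 1ℚ , 0<1 , λ ε 0<ε _ → 0<p+q 0<a (0≤p*q (<⇒≤ 0<ε) 0≤b)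
  -- The denominator `1ℚ - b`, unlike `- b`, is positive also when `b` is zero, and it leaves a
  -- margin: up to this threshold `a + ε * b` is at least `ε`.
  ... | inj₂ b≤0 = a * inv (1ℚ - b) , 0<p*q 0<a (0<inv 0<1-b) , λ ε 0<ε ε≤ →
      subst (0ℚ <_) (lem a b ε) (0<p+q 0<ε (p≤q⇒0≤q-p (le ε ε≤)))
    where
    0<1-b : 0ℚ < 1ℚ - b
    0<1-b = 0<p+q 0<1 (0≤-p b≤0)
    lem : ∀ a b ε → ε + (a - ε * (1ℚ - b)) ≡ a + ε * b
    lem = solve-∀ ℚ-ring
    le : ∀ ε → ε ≤ a * inv (1ℚ - b) → ε * (1ℚ - b) ≤ a
    le ε h = subst (ε * (1ℚ - b) ≤_) (trans (*-assoc a (inv (1ℚ - b)) (1ℚ - b))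
        (trans (cong (a *_) (inv-* (0<⇒≢0 0<1-b))) (*-identityʳ a)))
      (*-monoʳ-≤-nonNeg (1ℚ - b) {{nonNegative (<⇒≤ 0<1-b)}} h)

  -- Zero is left free: a perturbation preserves strict signs while vanishing values may become
  -- nonzero, and this is how a generic point is reached.
  KeepsSign : ℚ → ℚ → Set
  KeepsSign a a′ = (a < 0ℚ → a′ < 0ℚ) × (0ℚ < a → 0ℚ < a′)

  keepsSign⇒≢0 : ∀ {a a′} → KeepsSign a a′ → a′ ≡ 0ℚ → a ≡ 0ℚ
  keepsSign⇒≢0 {a} (neg , pos) e with <-cmp a 0ℚ
  ... | tri< lt _ _ = ⊥-elim (<0⇒≢0 (neg lt) e)
  ... | tri≈ _ eq _ = eq
  ... | tri> _ _ gt = ⊥-elim (0<⇒≢0 (pos gt) e)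

  keepsSign-trans : ∀ {a b c} → KeepsSign a b → KeepsSign b c → KeepsSign a c
  keepsSign-trans (n , p) (n′ , p′) = n′ ∘ n , p′ ∘ p

  perturb₁ : ∀ a b → Σ ℚ λ ε₀ → 0ℚ < ε₀ × (∀ ε → 0ℚ < ε → ε ≤ ε₀ → KeepsSign a (a + ε * b))
  perturb₁ a b with <-cmp a 0ℚ
  ... | tri≈ _ refl _ = 1ℚ , 0<1 , λ ε _ _ → (λ h → ⊥-elim (<-irrefl refl h)) , λ h → ⊥-elim (<-irrefl refl h)
  ... | tri> _ _ gt = let (ε₀ , p , h) = 0<-perturb gt b in
    ε₀ , p , λ ε q le → (λ lt → ⊥-elim (<-asym lt gt)) , λ _ → h ε q le
  ... | tri< lt _ _ = let (ε₀ , p , h) = 0<-perturb (0<-p lt) (- b) in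
    ε₀ , p , λ ε q le → (λ _ → 0<q-p⇒p<q (subst (0ℚ <_) (lem a b ε) (h ε q le))) , λ gt → ⊥-elim (<-asym lt gt)
    where
    lem : ∀ a b ε → - a + ε * - b ≡ 0ℚ - (a + ε * b)
    lem = solve-∀ ℚ-ring

  perturb-list : ∀ {a} {A : Set a} (f h : A → ℚ) (xs : List A) →
    Σ ℚ λ ε₀ → 0ℚ < ε₀ × (∀ ε → 0ℚ < ε → ε ≤ ε₀ → ∀ x → x ∈ xs → KeepsSign (f x) (f x + ε * h x))
  perturb-list f h [] = 1ℚ , 0<1 , λ ε _ _ x ()
  perturb-list f h (x ∷ xs) with perturb₁ (f x) (h x) | perturb-list f h xs
  ... | ε₁ , p₁ , h₁ | ε₂ , p₂ , h₂ with ≤-total ε₁ ε₂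
  ... | inj₁ le = ε₁ , p₁ , λ { ε p q y (here refl) → h₁ ε p q ; ε p q y (there y∈) → h₂ ε p (≤-trans q le) y y∈ }
  ... | inj₂ ge = ε₂ , p₂ , λ { ε p q y (here refl) → h₁ ε p (≤-trans q ge) ; ε p q y (there y∈) → h₂ ε p q y y∈ }

  -- One moves along the directions `v i` in turn, each time so little that all strict signs reached
  -- so far survive. A functional that vanishes at the end therefore vanished at every intermediate
  -- point, hence on every direction.
  perturb : ∀ {k n} (ws : List (Vecℚ k)) (b₀ : Vecℚ k) (v : Fin n → Vecℚ k) →
    Σ (Vecℚ k) λ z → Σ (Fin n → ℚ) λ c → (∀ i → 0ℚ < c i) × (∀ r → z r ≡ b₀ r + lin v c r)
      × (∀ w → w ∈ ws → KeepsSign (w · b₀) (w · z) × (w · z ≡ 0ℚ → ∀ i → w · v i ≡ 0ℚ))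
  perturb {n = zero} ws b₀ v = b₀ , (λ ()) , (λ ()) , (λ r → sym (+-identityʳ (b₀ r)))
    , λ w _ → ((λ h → h) , (λ h → h)) , λ _ ()
  perturb {k} {suc n} ws b₀ v with perturb-list (λ w → w · b₀) (λ w → w · v zero) ws
  ... | ε , 0<ε , keep with perturb ws (λ r → b₀ r + ε * v zero r) (v ∘ suc)
  ... | z , c , 0<c , eq , hz = z , c⁺ , 0<c⁺
    , (λ r → trans (eq r) (+-assoc (b₀ r) (ε * v zero r) (lin (v ∘ suc) c r)))
    , λ w w∈ → keepsSign-trans (keep₁ w w∈) (proj₁ (hz w w∈)) , vanish w w∈
    where
    c⁺ : Fin (suc n) → ℚ
    c⁺ zero = ε
    c⁺ (suc i) = c i
    0<c⁺ : ∀ i → 0ℚ < c⁺ i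
    0<c⁺ zero = 0<ε
    0<c⁺ (suc i) = 0<c i
    b₁ : Vecℚ k
    b₁ r = b₀ r + ε * v zero r
    w·b₁ : ∀ w → w · b₁ ≡ w · b₀ + ε * (w · v zero)
    w·b₁ w = trans (·-+ʳ w b₀ (λ r → ε * v zero r)) (cong (w · b₀ +_) (·-*ʳ ε w (v zero)))
    keep₁ : ∀ w → w ∈ ws → KeepsSign (w · b₀) (w · b₁)
    keep₁ w w∈ = subst (KeepsSign (w · b₀)) (sym (w·b₁ w)) (keep ε 0<ε ≤-refl w w∈)
    vanish : ∀ w → w ∈ ws → w · z ≡ 0ℚ → ∀ i → w · v i ≡ 0ℚ
    vanish w w∈ e (suc i) = proj₂ (hz w w∈) e i
    vanish w w∈ e zero = *-cancelˡ-0 (0<⇒≢0 0<ε) (trans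
      (sym (trans (cong (_+ ε * (w · v zero)) (keepsSign⇒≢0 (keep₁ w w∈) b₁≡0)) (+-identityˡ (ε * (w · v zero)))))
      (trans (sym (w·b₁ w)) b₁≡0))
      where
      b₁≡0 : w · b₁ ≡ 0ℚ
      b₁≡0 = keepsSign⇒≢0 (proj₁ (hz w w∈)) e

  module Chambers {m k} (g : Fin m → Vecℚ k) where
    open Bases g public
    open Basis public

    -- `z` lies on no hyperplane spanned by a basis with one column removed, so it is on the
    -- boundary of no simplicial cone.
    Generic : Vecℚ k → Set
    Generic z = ∀ {t} (β : Basis t) j → lookup t j ≡ true → W β j · z ≢ 0ℚ

    -- The cell of the chamber complex, with membership in simplicial cones replaced by signs of
    -- coordinates, which are decidable and behave well under perturbation.
    MaskCell : Vecℚ k → Vecℚ k → Set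
    MaskCell z y = ∀ {t} (β : Basis t) → Feasible β z → Feasible β y

    Pointed : Set
    Pointed = ∀ x → (∀ j → 0ℚ ≤ x j) → (∀ r → lin g x r ≡ 0ℚ) → ∀ j → x j ≡ 0ℚ

    functionalsOf : ∀ {a} {A : Set a} → (∀ {t} → Basis t → Fin m → A) → ∀ t → Dec (Basis t) → List A
    functionalsOf F t (yes β) = List.map (F β) (allFin m)
    functionalsOf F t (no _) = []

    functionals : ∀ {a} {A : Set a} → (∀ {t} → Basis t → Fin m → A) → List A
    functionals F = concatMap (λ t → functionalsOf F t (basis? t)) (allMasks m)

    ∈-functionals : ∀ {a} {A : Set a} (F : ∀ {t} → Basis t → Fin m → A) {t} → Basis t → ∀ j →
      Σ (Basis t) λ β → F β j ∈ functionals F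
    ∈-functionals F {t} β j = let (β′ , h) = canonical (basis? t) in
      β′ , ∈-concatMap⁺ (λ t → functionalsOf F t (basis? t)) (Any.map (λ { refl → h }) (∈-allMasks t))
      where
      canonical : (d : Dec (Basis t)) → Σ (Basis t) λ β′ → F β′ j ∈ functionalsOf F t d
      canonical (no ¬β) = ⊥-elim (¬β β)
      canonical (yes β′) = β′ , ∈-map⁺ (F β′) (∈-allFin j)

    -- If a coordinate functional vanished at `z`, it would vanish on the spanning family and hence
    -- on its own column, where its value is one. Strictly negative coordinates of `b₀` stay
    -- negative, so every cone containing `z` contains `b₀`.
    generic-perturbation : ∀ {n} (b₀ : Vecℚ k) (v : Fin n → Vecℚ k) → Spanning v →
      Σ (Vecℚ k) λ z → Σ (Fin n → ℚ) λ c → (∀ i → 0ℚ < c i) × (∀ r → z r ≡ b₀ r + lin v c r) × Generic z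
        × (∀ {t} (β : Basis t) → Feasible β z → Feasible β b₀)
    generic-perturbation b₀ v span with perturb (functionals W) b₀ v
    ... | z , c , 0<c , eq , h = z , c , 0<c , eq , gen , feas
      where
      gen : Generic z
      gen {t} β j tⱼ e with ∈-functionals W β j
      ... | β′ , w∈ = 1≢0 (trans (sym (trans (dual β′ j j tⱼ) (δ-refl j))) W≡0)
        where
        W≡0 : W β′ j · g j ≡ 0ℚ
        W≡0 = let (a , ha) = span (g j) in trans (·-congʳ (W β′ j) ha) (trans (·-lin (W β′ j) v a)
          (Σ-0 (λ i → trans (cong (a i *_) (proj₂ (h (W β′ j) w∈) (trans (W-unique β′ β j z) e) i)) (*-zeroʳ (a i)))))
      feas : ∀ {t} (β : Basis t) → Feasible β z → Feasible β b₀
      feas β f j with ∈-functionals W β j | 0ℚ ≤? W β j · b₀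
      ... | β′ , w∈ | yes p = p
      ... | β′ , w∈ | no ¬p = ⊥-elim (<⇒≱ (proj₁ (proj₁ (h (W β′ j) w∈))
        (subst (_< 0ℚ) (W-unique β β′ j b₀) (≰⇒> ¬p))) (subst (0ℚ ≤_) (W-unique β β′ j z) (f j)))

    off⇒θ≡0 : ∀ {t} (β : Basis t) {l j} → l ≢ j → lookup t l ≡ false → δ l j - W β l · g j ≡ 0ℚ
    off⇒θ≡0 β l≢j tl = trans (cong₂ _-_ (δ-≢ l≢j) (W-off· β tl (g _))) refl

    lin-θ : ∀ {t} (β : Basis t) j r → lin g (λ l → δ l j - W β l · g j) r ≡ 0ℚ
    lin-θ β j r = trans (lin-- g (λ l → δ l j) (λ l → W β l · g j) r)
      (p≡q⇒p-q≡0 (trans (lin-cong g (λ l → δ-sym l j) r) (trans (lin-δ g j r) (expand β (g j) r))))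

    θ-self : ∀ {t} (β : Basis t) j → lookup t j ≡ false → δ j j - W β j · g j ≡ 1ℚ
    θ-self β j tⱼ = trans (cong₂ _-_ (δ-refl j) (W-off· β tⱼ (g j))) (+-identityʳ 1ℚ)

    private
      -- Columns are pivoted into the basis one at a time; the list contains the columns off the
      -- basis that may still carry a nonzero coefficient.
      pivot-in : ∀ y (js : List (Fin m)) {t} (β : Basis t) c → (∀ j → 0ℚ ≤ c j) → (∀ r → y r ≡ lin g c r) →
        (∀ j → lookup t j ≡ false → c j ≢ 0ℚ → j ∈ js) → Σ (Mask m) λ t′ → Σ (Basis t′) λ β′ → Feasible β′ y
      pivot-in y [] {t} β c 0≤c eq off = t , β , λ j →
        subst (0ℚ ≤_) (sym (coord β y c (λ i h → decidable-stable (c i ≟ 0ℚ) (λ ne → nil (off i h ne))) eq j)) (0≤c j)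
        where
        nil : ∀ {i} → ¬ i ∈ []
        nil ()
      pivot-in y (j ∷ js) {t} β c 0≤c eq off with true∨false (lookup t j)
      ... | inj₁ tⱼ = pivot-in y js β c 0≤c eq rest
        where
        rest : ∀ i → lookup t i ≡ false → c i ≢ 0ℚ → i ∈ js
        rest i h ne with off i h ne
        ... | here refl = ⊥-elim (true≢false tⱼ h)
        ... | there i∈ = i∈
      -- Ratio test along the relation `δ l j - W β l · g j`, which lowers the coefficient of `j`.
      -- If the minimum is attained at `j` itself, that coefficient becomes zero and the basis
      -- stays; otherwise the basic column `l` reaches zero first and is exchanged for `j`.
      ... | inj₂ tⱼ with argmin (λ l → 0ℚ <? δ l j - W β l · g j) (λ l → c l * inv (δ l j - W β l · g j))
      ...   | inj₁ none = ⊥-elim (none j (subst (0ℚ <_) (sym (θ-self β j tⱼ)) 0<1))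
      ...   | inj₂ (l , 0<dₗ , min) = go (l Fin.≟ j)
        where
        d : Fin m → ℚ
        d i = δ i j - W β i · g j
        θ = c l * inv (d l)
        c′ : Fin m → ℚ
        c′ i = c i - θ * d i
        0≤θ : 0ℚ ≤ θ
        0≤θ = 0≤p*q (0≤c l) (<⇒≤ (0<inv 0<dₗ))
        0≤c′ : ∀ i → 0ℚ ≤ c′ i
        0≤c′ i with 0ℚ <? d i
        ... | yes 0<dᵢ = p≤q⇒0≤q-p (subst (θ * d i ≤_)
            (trans (*-assoc (c i) (inv (d i)) (d i)) (trans (cong (c i *_) (inv-* (0<⇒≢0 0<dᵢ))) (*-identityʳ (c i))))
            (*-monoʳ-≤-nonNeg (d i) {{nonNegative (<⇒≤ 0<dᵢ)}} (min i 0<dᵢ)))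
        ... | no ¬0<dᵢ = 0≤p+q (0≤c i) (0≤-p (p*q≤0 0≤θ (≮⇒≥ ¬0<dᵢ)))
        eq′ : ∀ r → y r ≡ lin g c′ r
        eq′ r = trans (eq r) (sym (trans (lin-- g c (λ i → θ * d i) r)
          (trans (cong (λ q → lin g c r - q) (trans (lin-* g θ d r) (trans (cong (θ *_) (lin-θ β j r)) (*-zeroʳ θ))))
            (+-identityʳ (lin g c r)))))
        c′ₗ≡0 : c′ l ≡ 0ℚ
        c′ₗ≡0 = p≡q⇒p-q≡0 (sym (trans (*-assoc (c l) (inv (d l)) (d l))
          (trans (cong (c l *_) (inv-* (0<⇒≢0 0<dₗ))) (*-identityʳ (c l)))))
        c′≡c : ∀ i → i ≢ j → lookup t i ≡ false → c′ i ≡ c i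
        c′≡c i i≢j h = trans (cong (λ q → c i - θ * q) (off⇒θ≡0 β i≢j h))
          (trans (cong (λ q → c i - q) (*-zeroʳ θ)) (+-identityʳ (c i)))
        carry : ∀ i → i ≢ j → lookup t i ≡ false → c′ i ≢ 0ℚ → i ∈ js
        carry i i≢j h ne with off i h (λ e → ne (trans (c′≡c i i≢j h) e))
        ... | here e = ⊥-elim (i≢j e)
        ... | there i∈ = i∈
        go : Dec (l ≡ j) → Σ (Mask m) λ t′ → Σ (Basis t′) λ β′ → Feasible β′ y
        go (yes refl) = pivot-in y js β c′ 0≤c′ eq′ (λ i h ne → carry i (λ { refl → ne c′ₗ≡0 }) h ne)
        go (no l≢j) = pivot-in y js {swap t l j} (proj₁ (exchange {t′ = swap t l j} (swap-exchange t l≢j) β (on⇐W≢0 β α≢0) α≢0)) c′ 0≤c′ eq′ rest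
          where
          α≢0 : W β l · g j ≢ 0ℚ
          α≢0 e = 0<⇒≢0 0<dₗ (cong₂ _-_ (δ-≢ l≢j) e)
          rest : ∀ i → lookup (swap t l j) i ≡ false → c′ i ≢ 0ℚ → i ∈ js
          rest i h ne with proj₂ (proj₂ (swap-exchange t l≢j)) i h
          ... | i≢j , back = carry i i≢j (back (λ { refl → ne c′ₗ≡0 })) ne

    caratheodory : ∀ {t} → Basis t → ∀ y → InPos g y → Σ (Mask m) λ t′ → Σ (Basis t′) λ β → Feasible β y
    caratheodory β y (c , 0≤c , eq) = pivot-in y (allFin m) β c 0≤c eq (λ j _ _ → ∈-allFin j)

    Feasibleᵐ : Vecℚ k → Mask m → Set
    Feasibleᵐ z t = Σ (Basis t) λ β → Feasible β z

    feasibleᵐ? : ∀ z t → Dec (Feasibleᵐ z t)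
    feasibleᵐ? z t with basis? t
    ... | no ¬β = no (¬β ∘ proj₁)
    ... | yes β with feasible? β z
    ...   | yes f = yes (β , f)
    ...   | no ¬f = no (λ { (β′ , f) → ¬f (λ j → subst (0ℚ ≤_) (W-unique β′ β j z) (f j)) })

    -- The dual solution of linear programming: the functional with value `e j` on each column of
    -- the basis. Its value at `z` is the cost of the basic solution for `z`.
    dualPoint : ∀ {t} → Basis t → (Fin m → ℚ) → Vecℚ k
    dualPoint β e = lin (W β) e

    dualPoint-· : ∀ {t} (β : Basis t) e y → dualPoint β e · y ≡ Σℚ (λ l → e l * (W β l · y))
    dualPoint-· β e y = lin-· y (W β) e

    dualPoint-on : ∀ {t} (β : Basis t) e j → lookup t j ≡ true → dualPoint β e · g j ≡ e j
    dualPoint-on β e j tⱼ = trans (dualPoint-· β e (g j))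
      (trans (Σ-cong (λ l → trans (cong (e l *_) (trans (dual β l j tⱼ) (δ-sym l j))) (*-comm (e l) (δ j l)))) (Σ-δ e j))

    cost : (Fin m → ℚ) → Vecℚ k → Mask m → ℚ
    cost e z t with basis? t
    ... | yes β = dualPoint β e · z
    ... | no _ = 0ℚ

    -- No simplex path has to be followed: a feasible basis of least cost is taken from the finite
    -- list. A violated dual inequality would allow a pivot, and since `z` is generic the step has
    -- positive length and lowers the cost strictly.
    lp-optimum : Pointed → ∀ {z} → Generic z → ∀ {t₀} → Basis t₀ → InPos g z → (e : Fin m → ℚ) →
      Σ (Mask m) λ t → Σ (Basis t) λ β → Feasible β z × (∀ j → dualPoint β e · g j ≤ e j)
    lp-optimum pointed {z} gen β₀ z∈ e with argmin-list (feasibleᵐ? z) (cost e z) (allMasks m)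
    ... | inj₁ none = let (t , β , f) = caratheodory β₀ z z∈ in ⊥-elim (none t (∈-allMasks t) (β , f))
    ... | inj₂ (t , (β , f) , min) = t , β , f , λ j → decidable-stable (dualPoint β e · g j ≤? e j) (λ ¬le → improve j (≰⇒> ¬le))
      where
      open ≡-Reasoning
      cost-≡ : ∀ {t} (β : Basis t) → cost e z t ≡ dualPoint β e · z
      cost-≡ {t} β with basis? t
      ... | no ¬β = ⊥-elim (¬β β)
      ... | yes β′ = trans (dualPoint-· β′ e z) (trans (Σ-cong (λ l → cong (e l *_) (W-unique β′ β l z))) (sym (dualPoint-· β e z)))
      improve : ∀ j → ¬ e j < dualPoint β e · g j
      improve j lt with argmin (λ l → 0ℚ <? W β l · g j) (λ l → (W β l · z) * inv (W β l · g j))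
      -- No basic column blocks the entering one. Then `θ` is a nonnegative relation among the
      -- columns with entry one at `j`, which pointedness excludes.
      ... | inj₁ none = 0<⇒≢0 0<θ (pointed θ 0≤θ (lin-θ β j) j)
        where
        tⱼ : lookup t j ≡ false
        tⱼ with true∨false (lookup t j)
        ... | inj₁ h = ⊥-elim (<-irrefl (sym (dualPoint-on β e j h)) lt)
        ... | inj₂ h = h
        θ : Fin m → ℚ
        θ l = δ l j - W β l · g j
        0≤θ : ∀ l → 0ℚ ≤ θ l
        0≤θ l = 0≤p+q (0≤δ l j) (0≤-p (≮⇒≥ (none l)))
        0<θ : 0ℚ < θ j
        0<θ = subst (0ℚ <_) (sym (θ-self β j tⱼ)) 0<1
      ... | inj₂ (l , 0<α , ratio) = <⇒≱ cost-decreases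
          (subst₂ _≤_ (cost-≡ β) (cost-≡ β′) (min (swap t l j) (∈-allMasks (swap t l j)) (β′ , feas′)))
        where
        α = W β l · g j
        tₗ : lookup t l ≡ true
        tₗ = on⇐W≢0 β (0<⇒≢0 0<α)
        l≢j : l ≢ j
        l≢j refl = <-irrefl (sym (dualPoint-on β e l tₗ)) lt
        ex = exchange {t′ = swap t l j} (swap-exchange t l≢j) β tₗ (0<⇒≢0 0<α)
        β′ = proj₁ ex
        μ = (W β l · z) * inv α
        0<μ : 0ℚ < μ
        0<μ = 0<p*q (≤∧≢⇒< (f l) (gen β l tₗ ∘ sym)) (0<inv 0<α)
        lem : ∀ a b c d → a + (b - c) * d ≡ (a - d * c) + b * d
        lem = solve-∀ ℚ-ring
        feas′ : Feasible β′ z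
        feas′ i = subst (0ℚ ≤_) (sym (trans (proj₂ ex i z) (lem (W β i · z) (δ i j) (W β i · g j) μ)))
          (0≤p+q main (0≤p*q (0≤δ i j) (<⇒≤ 0<μ)))
          where
          main : 0ℚ ≤ W β i · z - μ * (W β i · g j)
          main with 0ℚ <? W β i · g j
          ... | yes p = p≤q⇒0≤q-p (subst (μ * (W β i · g j) ≤_)
              (trans (*-assoc (W β i · z) (inv (W β i · g j)) (W β i · g j))
                (trans (cong ((W β i · z) *_) (inv-* (0<⇒≢0 p))) (*-identityʳ (W β i · z))))
              (*-monoʳ-≤-nonNeg (W β i · g j) {{nonNegative (<⇒≤ p)}} (ratio i p)))
          ... | no ¬p = 0≤p+q (f i) (0≤-p (p*q≤0 (<⇒≤ 0<μ) (≮⇒≥ ¬p)))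
        lem₂ : ∀ e a b c d → e * (a + (b - c) * d) ≡ e * a + (b * e - e * c) * d
        lem₂ = solve-∀ ℚ-ring
        cost′ : dualPoint β′ e · z ≡ dualPoint β e · z + (e j - dualPoint β e · g j) * μ
        cost′ = begin
          dualPoint β′ e · z ≡⟨ dualPoint-· β′ e z ⟩
          Σℚ (λ i → e i * (W β′ i · z)) ≡⟨ Σ-cong (λ i → trans (cong (e i *_) (trans (proj₂ ex i z)
               (cong (λ q → W β i · z + (q - W β i · g j) * μ) (δ-sym i j)))) (lem₂ (e i) (W β i · z) (δ j i) (W β i · g j) μ)) ⟩
          Σℚ (λ i → e i * (W β i · z) + (δ j i * e i - e i * (W β i · g j)) * μ)
            ≡⟨ Σ-+ (λ i → e i * (W β i · z)) (λ i → (δ j i * e i - e i * (W β i · g j)) * μ) ⟩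
          Σℚ (λ i → e i * (W β i · z)) + Σℚ (λ i → (δ j i * e i - e i * (W β i · g j)) * μ)
            ≡⟨ cong₂ _+_ (sym (dualPoint-· β e z)) (trans (Σ-*ʳ μ (λ i → δ j i * e i - e i * (W β i · g j)))
                 (cong (_* μ) (trans (Σ-- (λ i → δ j i * e i) (λ i → e i * (W β i · g j)))
                   (cong₂ _-_ (Σ-δ e j) (sym (dualPoint-· β e (g j))))))) ⟩
          dualPoint β e · z + (e j - dualPoint β e · g j) * μ ∎
        lem₃ : ∀ u x v μ → u - (u + (x - v) * μ) ≡ (v - x) * μ
        lem₃ = solve-∀ ℚ-ring
        cost-decreases : dualPoint β′ e · z < dualPoint β e · z
        cost-decreases = 0<q-p⇒p<q (subst (0ℚ <_)
          (sym (trans (cong (λ q → dualPoint β e · z - q) cost′) (lem₃ (dualPoint β e · z) (e j) (dualPoint β e · g j) μ)))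
          (0<p*q (p<q⇒0<q-p lt) 0<μ))

    offMask : Mask m → Fin m → ℚ
    offMask t j with lookup t j
    ... | true = 0ℚ
    ... | false = 1ℚ

    Externalᵛ : Fin m → Set
    Externalᵛ j = ¬ (Σ (Fin m → ℚ) λ c → (∀ i → 0ℚ ≤ c i) × (c j ≡ 0ℚ) × (∀ r → g j r ≡ lin g c r))

    module _ (pointed : Pointed) {z : Vecℚ k} (gen : Generic z) {t₀} (β₀ : Basis t₀) (z∈ : InPos g z) where

      -- The functional comes from minimising the i-th coefficient over all representations of z.
      external-functional : ∀ {i} → Externalᵛ i → MaskCell z (g i) →
        Σ (Vecℚ k) λ u → u · g i ≡ 1ℚ × (∀ j → j ≢ i → u · g j ≤ 0ℚ) × (∀ y → MaskCell z y → 0ℚ ≤ u · y)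
      external-functional {i} ext inCell with lp-optimum pointed gen β₀ z∈ (δ i)
      ... | t , β , f , opt with true∨false (lookup t i)
      -- The optimal cone contains `z` and hence `g i`. Without `i` in the basis, the coordinates of
      -- `g i` would express it by the other columns.
      ...   | inj₂ h = ⊥-elim (ext ((λ j → W β j · g i) , inCell β f , W-off· β h (g i) , expand β (g i)))
      ...   | inj₁ h = W β i , trans (dual β i i h) (δ-refl i)
        , (λ j j≢i → subst₂ _≤_ (trans (dualPoint-· β (δ i) (g j)) (Σ-δ (λ l → W β l · g j) i)) (δ-≢ (j≢i ∘ sym)) (opt j))
        , λ y cell → cell β f i

      -- On another column of `I` the functional is nonpositive as a column and nonnegative as a
      -- point of the cell, hence zero. So the coefficients of unknown sign drop out, and the value
      -- at `lin g x`, which is nonnegative, is at most `x i`.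
      external-nonNeg : (I : Fin m → Set) → (∀ i → I i → Externalᵛ i × MaskCell z (g i)) →
        ∀ x → MaskCell z (lin g x) → (∀ j → 0ℚ ≤ x j ⊎ I j) → ∀ j → 0ℚ ≤ x j
      external-nonNeg I hI x cell sgn i with sgn i
      ... | inj₁ p = p
      ... | inj₂ Iᵢ with external-functional (proj₁ (hI i Iᵢ)) (proj₂ (hI i Iᵢ))
      ...   | u , uᵢ , u≤0 , u≥0 = ≤-trans (u≥0 (lin g x) cell) (subst₂ _≤_ (sym (·-lin u g x)) (Σ-δ x i) (Σ-mono le))
        where
        le : ∀ j → x j * (u · g j) ≤ δ i j * x j
        le j with i Fin.≟ j
        ... | yes refl = ≤-reflexive (trans (cong (x i *_) uᵢ) (*-comm (x i) 1ℚ))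
        ... | no i≢j with sgn j
        ...   | inj₁ p = subst (x j * (u · g j) ≤_) (sym (*-zeroˡ (x j))) (p*q≤0 p (u≤0 j (i≢j ∘ sym)))
        ...   | inj₂ Iⱼ = ≤-reflexive (trans (cong (x j *_) (≤-antisym (u≤0 j (i≢j ∘ sym)) (u≥0 (g j) (proj₂ (hI j Iⱼ)))))
                  (trans (*-zeroʳ (x j)) (sym (*-zeroˡ (x j)))))

      -- Minimise the total weight off t over the representations of z: if y were in the cone of t,
      -- an optimal dual point would be nonpositive on y, so the optimal basis has to be t itself.
      fan : ∀ {y} → Generic y → MaskCell z y → ∀ {t} (β : Basis t) → Feasible β y → Feasible β z
      fan {y} gen-y cell {t} β fy with lp-optimum pointed gen β₀ z∈ (offMask t)
      ... | t* , β* , f* , opt = subst-mask (same on)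
        where
        e = offMask t
        e-on : ∀ {j} → lookup t j ≡ true → e j ≡ 0ℚ
        e-on {j} h with lookup t j
        ... | true = refl
        e-on {j} () | false
        e-off : ∀ {j} → lookup t j ≡ false → e j ≡ 1ℚ
        e-off {j} h with lookup t j
        ... | false = refl
        e-off {j} () | true
        0≤e : ∀ j → 0ℚ ≤ e j
        0≤e j with lookup t j
        ... | true = ≤-refl
        ... | false = <⇒≤ 0<1
        u = dualPoint β* e
        u·y≤0 : u · y ≤ 0ℚ
        u·y≤0 = subst₂ _≤_ (sym (expand· β u y)) (Σ-0 {m} {λ _ → 0ℚ} (λ _ → refl)) (Σ-mono le)
          where
          le : ∀ j → (W β j · y) * (u · g j) ≤ 0ℚ
          le j with true∨false (lookup t j)
          ... | inj₁ h = p*q≤0 (fy j) (subst (u · g j ≤_) (e-on h) (opt j))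
          ... | inj₂ h = ≤-reflexive (trans (cong (_* (u · g j)) (W-off· β h y)) (*-zeroˡ (u · g j)))
        terms : ∀ j → 0ℚ ≤ e j * (W β* j · y)
        terms j = 0≤p*q (0≤e j) (cell β* f* j)
        -- The terms of `u · y` over `t*` are nonnegative and their sum is at most zero. A column of
        -- `t*` outside `t` has weight one and, `y` being generic, would contribute a positive term.
        on : ∀ j → lookup t* j ≡ true → lookup t j ≡ true
        on j h with true∨false (lookup t j)
        ... | inj₁ p = p
        ... | inj₂ p = ⊥-elim (<⇒≱ (subst (0ℚ <_) (sym (dualPoint-· β* e y)) (Σ-0<-any terms j
          (subst (0ℚ <_) (sym (trans (cong (_* (W β* j · y)) (e-off p)) (*-identityˡ (W β* j · y))))
            (≤∧≢⇒< (cell β* f* j) (gen-y β* j h ∘ sym))))) u·y≤0)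
        -- A basis contained in a basis equals it: a further column of `t` would be a combination of
        -- columns of `t*`, all of which lie in `t`.
        same : (∀ j → lookup t* j ≡ true → lookup t j ≡ true) → ∀ j → lookup t j ≡ lookup t* j
        same sub j with true∨false (lookup t* j) | true∨false (lookup t j)
        ... | inj₁ p | _ = trans (sub j p) (sym p)
        ... | inj₂ p | inj₂ q = trans q (sym p)
        ... | inj₂ p | inj₁ q = ⊥-elim (1≢0 (trans (sym (δ-refl j)) (trans (sym (dual β j j q))
          (trans (coord β (g j) (λ i → W β* i · g j) supp (expand β* (g j)) j) (W-off· β* p (g j))))))
          where
          supp : ∀ i → lookup t i ≡ false → W β* i · g j ≡ 0ℚ
          supp i h with true∨false (lookup t* i)
          ... | inj₁ r = ⊥-elim (true≢false (sub i r) h)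
          ... | inj₂ r = W-off· β* r (g j)
        subst-mask : (∀ j → lookup t j ≡ lookup t* j) → Feasible β z
        subst-mask h j = subst (0ℚ ≤_) (sym (coord β z (λ i → W β* i · z) (λ i q → W-off· β* (trans (sym (h i)) q) z) (expand β* z) j)) (f* j)

  -- Signs, intervals and sums over masks

  𝟙 : ∀ {P : Set} → Dec P → ℚ
  𝟙 (yes _) = 1ℚ
  𝟙 (no _) = 0ℚ

  𝟙-yes : ∀ {P : Set} (d : Dec P) → P → 𝟙 d ≡ 1ℚ
  𝟙-yes (yes _) p = refl
  𝟙-yes (no ¬p) p = ⊥-elim (¬p p)

  𝟙-no : ∀ {P : Set} (d : Dec P) → ¬ P → 𝟙 d ≡ 0ℚ
  𝟙-no (yes p) ¬p = ⊥-elim (¬p p)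
  𝟙-no (no _) ¬p = refl

  𝟙-⇔ : ∀ {P Q : Set} (d : Dec P) (d′ : Dec Q) → (P → Q) → (Q → P) → 𝟙 d ≡ 𝟙 d′
  𝟙-⇔ (yes p) d′ f h = sym (𝟙-yes d′ (f p))
  𝟙-⇔ (no ¬p) d′ f h = sym (𝟙-no d′ (¬p ∘ h))

  𝟙-≢0 : ∀ {P : Set} (d : Dec P) → 𝟙 d ≢ 0ℚ → P
  𝟙-≢0 (yes p) _ = p
  𝟙-≢0 (no _) h = ⊥-elim (h refl)

  sgn : ℚ → ℚ
  sgn q with <-cmp q 0ℚ
  ... | tri< _ _ _ = - 1ℚ
  ... | tri≈ _ _ _ = 0ℚ
  ... | tri> _ _ _ = 1ℚ

  sgn-pos : ∀ {q} → 0ℚ < q → sgn q ≡ 1ℚ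
  sgn-pos {q} h with <-cmp q 0ℚ
  ... | tri< a _ _ = ⊥-elim (<-asym a h)
  ... | tri≈ _ b _ = ⊥-elim (0<⇒≢0 h b)
  ... | tri> _ _ _ = refl

  sgn-neg : ∀ {q} → q < 0ℚ → sgn q ≡ - 1ℚ
  sgn-neg {q} h with <-cmp q 0ℚ
  ... | tri< _ _ _ = refl
  ... | tri≈ _ b _ = ⊥-elim (<0⇒≢0 h b)
  ... | tri> _ _ c = ⊥-elim (<-asym c h)

  sgn-0 : ∀ {q} → q ≡ 0ℚ → sgn q ≡ 0ℚ
  sgn-0 refl = refl

  sgn-- : ∀ q → sgn (- q) ≡ - sgn q
  sgn-- q = go (<-cmp q 0ℚ)
    where
    go : _ → sgn (- q) ≡ - sgn q
    go (tri< a _ _) = trans (sgn-pos (0<-p a)) (cong -_ (sym (sgn-neg a)))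
    go (tri≈ _ b _) = trans (sgn-0 (cong -_ b)) (cong -_ (sym (sgn-0 b)))
    go (tri> _ _ c) = trans (sgn-neg (neg-antimono-< c)) (cong -_ (sym (sgn-pos c)))

  sgn-* : ∀ p q → sgn (p * q) ≡ sgn p * sgn q
  sgn-* p q = go (<-cmp p 0ℚ)
    where
    open ≡-Reasoning
    case⁺ : ∀ p → 0ℚ < p → sgn (p * q) ≡ sgn p * sgn q
    case⁺ p 0<p = trans (go′ (<-cmp q 0ℚ)) (trans (sym (*-identityˡ (sgn q))) (cong (_* sgn q) (sym (sgn-pos 0<p))))
      where
      go′ : _ → sgn (p * q) ≡ sgn q
      go′ (tri< a _ _) = trans (sgn-neg (subst (p * q <_) (*-zeroʳ p) (*-monoʳ-<-pos p {{positive 0<p}} a))) (sym (sgn-neg a))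
      go′ (tri≈ _ b _) = trans (sgn-0 (trans (cong (p *_) b) (*-zeroʳ p))) (sym (sgn-0 b))
      go′ (tri> _ _ c) = trans (sgn-pos (0<p*q 0<p c)) (sym (sgn-pos c))
    lem : ∀ p q → p * q ≡ - (- p * q)
    lem = solve-∀ ℚ-ring
    lem₂ : ∀ a b → - (- a * b) ≡ a * b
    lem₂ = solve-∀ ℚ-ring
    go : _ → sgn (p * q) ≡ sgn p * sgn q
    go (tri> _ _ c) = case⁺ p c
    go (tri≈ _ b _) = trans (sgn-0 (trans (cong (_* q) b) (*-zeroˡ q)))
      (trans (sym (*-zeroˡ (sgn q))) (cong (_* sgn q) (sym (sgn-0 b))))
    go (tri< a _ _) = begin
      sgn (p * q) ≡⟨ cong sgn (lem p q) ⟩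
      sgn (- (- p * q)) ≡⟨ sgn-- (- p * q) ⟩
      - sgn (- p * q) ≡⟨ cong -_ (case⁺ (- p) (0<-p a)) ⟩
      - (sgn (- p) * sgn q) ≡⟨ cong (λ s → - (s * sgn q)) (sgn-- p) ⟩
      - (- sgn p * sgn q) ≡⟨ lem₂ (sgn p) (sgn q) ⟩
      sgn p * sgn q ∎

  sgn-sq : ∀ {q} → q ≢ 0ℚ → sgn q * sgn q ≡ 1ℚ
  sgn-sq {q} h = go (<-cmp q 0ℚ)
    where
    go : _ → sgn q * sgn q ≡ 1ℚ
    go (tri< a _ _) = cong₂ _*_ (sgn-neg a) (sgn-neg a)
    go (tri≈ _ b _) = ⊥-elim (h b)
    go (tri> _ _ c) = cong₂ _*_ (sgn-pos c) (sgn-pos c)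

  div-unique : ∀ {a b x} → b ≢ 0ℚ → x * b ≡ a → a * inv b ≡ x
  div-unique {a} {b} {x} b≢0 e = trans (cong (_* inv b) (sym e)) (trans (*-assoc x b (inv b)) (trans (cong (x *_) (*-inv b≢0)) (*-identityʳ x)))

  div-* : ∀ {a b} → b ≢ 0ℚ → a * inv b * b ≡ a
  div-* {a} {b} b≢0 = trans (*-assoc a (inv b) b) (trans (cong (a *_) (inv-* b≢0)) (*-identityʳ a))

  -- Signed count of the endpoints of the interval { τ : c l − τ d l ≥ 0 for all l }.
  module Interval {n} (c d : Fin n → ℚ) where

    τ : Fin n → ℚ
    τ l = c l * inv (d l)

    Feas : ℚ → Set
    Feas x = ∀ l → 0ℚ ≤ c l - x * d l

    Hit : Fin n → Set
    Hit l = d l ≢ 0ℚ × Feas (τ l)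

    hit? : ∀ l → Dec (Hit l)
    hit? l = ¬? (d l ≟ 0ℚ) ×-dec Finₚ.all? (λ l′ → 0ℚ ≤? c l′ - τ l * d l′)

    private
      lem : ∀ {b} → b ≢ 0ℚ → ∀ a x → a - x * b ≡ (a * inv b - x) * b
      lem {b} h a x = trans (cong (_- x * b) (sym (div-* {a} h))) (lem₁ (a * inv b) x b)
        where
        lem₁ : ∀ t x b → t * b - x * b ≡ (t - x) * b
        lem₁ = solve-∀ ℚ-ring
      lem₂ : ∀ t x b → (t - x) * b ≡ (x - t) * - b
      lem₂ = solve-∀ ℚ-ring

    ≤τ⇒ : ∀ {l x} → 0ℚ < d l → x ≤ τ l → 0ℚ ≤ c l - x * d l
    ≤τ⇒ {l} {x} h le = subst (0ℚ ≤_) (sym (lem (0<⇒≢0 h) (c l) x)) (0≤p*q (p≤q⇒0≤q-p le) (<⇒≤ h))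

    ⇒≤τ : ∀ {l x} → 0ℚ < d l → 0ℚ ≤ c l - x * d l → x ≤ τ l
    ⇒≤τ {l} {x} h le = 0≤q-p⇒p≤q (*-cancel-0≤ʳ h (subst (0ℚ ≤_) (lem (0<⇒≢0 h) (c l) x) le))

    τ≤⇒ : ∀ {l x} → d l < 0ℚ → τ l ≤ x → 0ℚ ≤ c l - x * d l
    τ≤⇒ {l} {x} h le = subst (0ℚ ≤_) (sym (trans (lem (<0⇒≢0 h) (c l) x) (lem₂ (τ l) x (d l))))
      (0≤p*q (p≤q⇒0≤q-p le) (<⇒≤ (0<-p h)))

    ⇒τ≤ : ∀ {l x} → d l < 0ℚ → 0ℚ ≤ c l - x * d l → τ l ≤ x
    ⇒τ≤ {l} {x} h le = 0≤q-p⇒p≤q (*-cancel-0≤ʳ (0<-p h)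
      (subst (0ℚ ≤_) (trans (lem (<0⇒≢0 h) (c l) x) (lem₂ (τ l) x (d l))) le))

    constant : ∀ {l} x x′ → d l ≡ 0ℚ → 0ℚ ≤ c l - x * d l → 0ℚ ≤ c l - x′ * d l
    constant {l} x x′ e = subst (0ℚ ≤_) (cong (λ q → c l - q)
      (trans (cong (x *_) e) (trans (*-zeroʳ x) (sym (trans (cong (x′ *_) e) (*-zeroʳ x′))))))

    -- Rows with `d l` positive bound the parameter from above, those with `d l` negative from
    -- below, and the others do not depend on it. Only the least upper bound `U` and the greatest
    -- lower bound `L` can be feasible; each is feasible exactly when the interval is nonempty, and
    -- their signs are opposite. Distinctness excludes a second row with the same endpoint.
    balanced : (Σ _ λ l → 0ℚ < d l) → (Σ _ λ l → d l < 0ℚ) →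
      (∀ l l′ → l ≢ l′ → d l ≢ 0ℚ → d l′ ≢ 0ℚ → τ l ≢ τ l′) →
      Σℚ (λ l → sgn (d l) * 𝟙 (hit? l)) ≡ 0ℚ
    balanced (p₀ , 0<p₀) (n₀ , n₀<0) distinct with argmin (λ l → 0ℚ <? d l) τ | argmin (λ l → d l <? 0ℚ) (λ l → - τ l)
    ... | inj₁ none | _ = ⊥-elim (none p₀ 0<p₀)
    ... | inj₂ _ | inj₁ none = ⊥-elim (none n₀ n₀<0)
    ... | inj₂ (U , 0<U , minU) | inj₂ (L , L<0 , minL) = begin
      Σℚ (λ l → sgn (d l) * 𝟙 (hit? l)) ≡⟨ Σ-cong pointwise ⟩
      Σℚ (λ l → δ U l * h - δ L l * h) ≡⟨ Σ-- (λ l → δ U l * h) (λ l → δ L l * h) ⟩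
      Σℚ (λ l → δ U l * h) - Σℚ (λ l → δ L l * h) ≡⟨ cong₂ _-_ (Σ-δ (λ _ → h) U) (Σ-δ (λ _ → h) L) ⟩
      h - h ≡⟨ p-p≡0 h ⟩
      0ℚ ∎
      where
      open ≡-Reasoning
      h = 𝟙 (hit? U)
      U≢L : U ≢ L
      U≢L refl = <-asym 0<U L<0
      maxL : ∀ {l} → d l < 0ℚ → τ l ≤ τ L
      maxL {l} lt = subst₂ _≤_ (lem-- (τ l)) (lem-- (τ L)) (neg-antimono-≤ (minL l lt))
        where
        lem-- : ∀ a → - (- a) ≡ a
        lem-- = solve-∀ ℚ-ring
      transfer : ∀ x x′ → (∀ {l} → 0ℚ < d l → x′ ≤ τ l) → (∀ {l} → d l < 0ℚ → τ l ≤ x′) → Feas x → Feas x′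
      transfer x x′ up low f l with <-cmp (d l) 0ℚ
      ... | tri< a _ _ = τ≤⇒ a (low a)
      ... | tri≈ _ b _ = constant x x′ b (f l)
      ... | tri> _ _ c = ≤τ⇒ c (up c)
      U⇒L : Hit U → Hit L
      U⇒L (_ , f) = <0⇒≢0 L<0 , transfer (τ U) (τ L) (λ {l} p → ≤-trans (⇒τ≤ L<0 (f L)) (minU l p)) maxL f
      L⇒U : Hit L → Hit U
      L⇒U (_ , f) = 0<⇒≢0 0<U , transfer (τ L) (τ U) (λ {l} p → minU l p) (λ lt → ≤-trans (maxL lt) (⇒≤τ 0<U (f U))) f
      isU : ∀ {l} → 0ℚ < d l → l ≢ U → ¬ Hit l
      isU {l} 0<l l≢U (_ , f) = distinct l U l≢U (0<⇒≢0 0<l) (0<⇒≢0 0<U) (≤-antisym (⇒≤τ 0<U (f U)) (minU l 0<l))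
      isL : ∀ {l} → d l < 0ℚ → l ≢ L → ¬ Hit l
      isL {l} l<0 l≢L (_ , f) = distinct l L l≢L (<0⇒≢0 l<0) (<0⇒≢0 L<0) (≤-antisym (maxL l<0) (⇒τ≤ L<0 (f L)))
      zero-row : ∀ {l} → l ≢ U → l ≢ L → 0ℚ ≡ δ U l * h - δ L l * h
      zero-row ne ne′ = sym (trans (cong₂ (λ a b → a * h - b * h) (δ-≢ (ne ∘ sym)) (δ-≢ (ne′ ∘ sym))) (lem₃ h))
        where
        lem₃ : ∀ h → 0ℚ * h - 0ℚ * h ≡ 0ℚ
        lem₃ = solve-∀ ℚ-ring
      pointwise : ∀ l → sgn (d l) * 𝟙 (hit? l) ≡ δ U l * h - δ L l * h
      pointwise l with l Fin.≟ U | l Fin.≟ L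
      ... | yes refl | _ = trans (cong (_* h) (sgn-pos 0<U))
        (sym (trans (cong₂ (λ a b → a * h - b * h) (δ-refl U) (δ-≢ (U≢L ∘ sym))) (lem₃ h)))
        where
        lem₃ : ∀ h → 1ℚ * h - 0ℚ * h ≡ 1ℚ * h
        lem₃ = solve-∀ ℚ-ring
      ... | no _ | yes refl = trans (cong₂ _*_ (sgn-neg L<0) (𝟙-⇔ (hit? L) (hit? U) L⇒U U⇒L))
        (sym (trans (cong₂ (λ a b → a * h - b * h) (δ-≢ U≢L) (δ-refl L)) (lem₃ h)))
        where
        lem₃ : ∀ h → 0ℚ * h - 1ℚ * h ≡ - 1ℚ * h
        lem₃ = solve-∀ ℚ-ring
      ... | no l≢U | no l≢L = trans (go (<-cmp (d l) 0ℚ)) (zero-row l≢U l≢L)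
        where
        go : _ → sgn (d l) * 𝟙 (hit? l) ≡ 0ℚ
        go (tri< a _ _) = trans (cong (sgn (d l) *_) (𝟙-no (hit? l) (isL a l≢L))) (*-zeroʳ (sgn (d l)))
        go (tri≈ _ b _) = trans (cong (_* 𝟙 (hit? l)) (sgn-0 b)) (*-zeroˡ (𝟙 (hit? l)))
        go (tri> _ _ c) = trans (cong (sgn (d l) *_) (𝟙-no (hit? l) (isU c l≢U))) (*-zeroʳ (sgn (d l)))

  Σᵐ : ∀ {m} → (Mask m → ℚ) → ℚ
  Σᵐ {zero} f = f []
  Σᵐ {suc m} f = Σᵐ (λ t → f (true ∷ t)) + Σᵐ (λ t → f (false ∷ t))

  Σᵐ-cong : ∀ {m} {f h : Mask m → ℚ} → (∀ t → f t ≡ h t) → Σᵐ f ≡ Σᵐ h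
  Σᵐ-cong {zero} e = e []
  Σᵐ-cong {suc m} e = cong₂ _+_ (Σᵐ-cong (λ t → e (true ∷ t))) (Σᵐ-cong (λ t → e (false ∷ t)))

  Σᵐ-0 : ∀ {m} {f : Mask m → ℚ} → (∀ t → f t ≡ 0ℚ) → Σᵐ f ≡ 0ℚ
  Σᵐ-0 {zero} e = e []
  Σᵐ-0 {suc m} e = trans (cong₂ _+_ (Σᵐ-0 (λ t → e (true ∷ t))) (Σᵐ-0 (λ t → e (false ∷ t)))) (+-identityˡ 0ℚ)

  Σᵐ-single : ∀ {m} (f : Mask m → ℚ) t₀ → (∀ t → t ≢ t₀ → f t ≡ 0ℚ) → Σᵐ f ≡ f t₀
  Σᵐ-single f [] e = refl
  Σᵐ-single f (true ∷ t₀) e = trans (cong₂ _+_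
    (Σᵐ-single (λ t → f (true ∷ t)) t₀ (λ t ne → e (true ∷ t) (ne ∘ Vecₚ.∷-injectiveʳ)))
    (Σᵐ-0 (λ t → e (false ∷ t) (λ ())))) (+-identityʳ (f (true ∷ t₀)))
  Σᵐ-single f (false ∷ t₀) e = trans (cong₂ _+_
    (Σᵐ-0 (λ t → e (true ∷ t) (λ ())))
    (Σᵐ-single (λ t → f (false ∷ t)) t₀ (λ t ne → e (false ∷ t) (ne ∘ Vecₚ.∷-injectiveʳ)))) (+-identityˡ (f (false ∷ t₀)))

  Σᵐ-swap : ∀ {m n} (f : Mask m → Fin n → ℚ) → Σᵐ (λ t → Σℚ (f t)) ≡ Σℚ (λ i → Σᵐ (λ t → f t i))
  Σᵐ-swap {zero} f = refl
  Σᵐ-swap {suc m} f = trans (cong₂ _+_ (Σᵐ-swap (λ t → f (true ∷ t))) (Σᵐ-swap (λ t → f (false ∷ t))))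
    (sym (Σ-+ (λ i → Σᵐ (λ t → f (true ∷ t) i)) (λ i → Σᵐ (λ t → f (false ∷ t) i))))

  onᵐ offᵐ : ∀ {m} → Mask m → Fin m → ℚ → ℚ
  onᵐ t i q with lookup t i
  ... | true = q
  ... | false = 0ℚ
  offᵐ t i q with lookup t i
  ... | true = 0ℚ
  ... | false = q

  offᵐ-on : ∀ {m} (t : Mask m) i q → lookup t i ≡ true → offᵐ t i q ≡ 0ℚ
  offᵐ-on t i q h with lookup t i
  ... | true = refl
  offᵐ-on t i q () | false

  offᵐ-off : ∀ {m} (t : Mask m) i q → lookup t i ≡ false → offᵐ t i q ≡ q
  offᵐ-off t i q h with lookup t i
  ... | false = refl
  offᵐ-off t i q () | true

  offᵐ-≢0 : ∀ {m} (t : Mask m) i q → offᵐ t i q ≢ 0ℚ → lookup t i ≡ false × q ≢ 0ℚ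
  offᵐ-≢0 t i q h with lookup t i
  ... | true = ⊥-elim (h refl)
  ... | false = refl , h

  onᵐ-vanishing : ∀ {m} (t : Mask m) i q → (lookup t i ≡ false → q ≡ 0ℚ) → q ≡ onᵐ t i q
  onᵐ-vanishing t i q h with lookup t i
  ... | true = refl
  ... | false = h refl

  -- Adding `i` is a bijection from masks without `i` to masks with `i`. It regroups pairs of a
  -- basis and one of its columns by the facet that remains when the column is removed.
  Σᵐ-insert : ∀ {m} (f : Mask m → ℚ) i → Σᵐ (λ t → onᵐ t i (f t)) ≡ Σᵐ (λ F → offᵐ F i (f (F [ i ]≔ true)))
  Σᵐ-insert {suc m} f zero = +-comm (Σᵐ (λ t → f (true ∷ t))) (Σᵐ {m} (λ _ → 0ℚ))
  Σᵐ-insert {suc m} f (suc i) = cong₂ _+_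
    (trans (Σᵐ-cong (λ t → on t true)) (trans (Σᵐ-insert (λ t → f (true ∷ t)) i) (Σᵐ-cong (λ t → off t true))))
    (trans (Σᵐ-cong (λ t → on t false)) (trans (Σᵐ-insert (λ t → f (false ∷ t)) i) (Σᵐ-cong (λ t → off t false))))
    where
    on : ∀ t b → onᵐ (b ∷ t) (suc i) (f (b ∷ t)) ≡ onᵐ t i (f (b ∷ t))
    on t b with lookup t i
    ... | true = refl
    ... | false = refl
    off : ∀ t b → offᵐ t i (f (b ∷ (t [ i ]≔ true))) ≡ offᵐ (b ∷ t) (suc i) (f (b ∷ (t [ i ]≔ true)))
    off t b with lookup t i
    ... | true = refl
    ... | false = refl

  -- The vertex identity

  Π-cong : ∀ {n} {f h : Fin n → ℚ} → (∀ i → f i ≡ h i) → Πℚ f ≡ Πℚ h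
  Π-cong {zero} e = refl
  Π-cong {suc n} e = cong₂ _*_ (e zero) (Π-cong (e ∘ suc))

  Π-1 : ∀ {n} {f : Fin n → ℚ} → (∀ i → f i ≡ 1ℚ) → Πℚ f ≡ 1ℚ
  Π-1 {zero} e = refl
  Π-1 {suc n} e = trans (cong₂ _*_ (e zero) (Π-1 (e ∘ suc))) (*-identityˡ 1ℚ)

  off1 : ∀ {m} → Mask m → (Fin m → ℚ) → Fin m → ℚ
  off1 t σ j with lookup t j
  ... | true = 1ℚ
  ... | false = σ j

  -- The orientation sign of a polarised cone: the product of the signs over the nonbasic columns.
  ρ : ∀ {m} → (Fin m → ℚ) → Mask m → ℚ
  ρ σ t = Πℚ (off1 t σ)

  ρ-insert : ∀ {m} (σ : Fin m → ℚ) (F : Mask m) i → lookup F i ≡ false → ρ σ F ≡ σ i * ρ σ (F [ i ]≔ true)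
  ρ-insert σ (false ∷ F) zero h = cong (σ zero *_) (trans (Π-cong off-tail) (sym (trans (cong (1ℚ *_) (Π-cong on-tail)) (*-identityˡ (ρ (σ ∘ suc) F)))))
    where
    off-tail : ∀ j → off1 (false ∷ F) σ (suc j) ≡ off1 F (σ ∘ suc) j
    off-tail j with lookup F j
    ... | true = refl
    ... | false = refl
    on-tail : ∀ j → off1 (true ∷ F) σ (suc j) ≡ off1 F (σ ∘ suc) j
    on-tail j with lookup F j
    ... | true = refl
    ... | false = refl
  ρ-insert σ (b ∷ F) (suc i) h = begin
    off1 (b ∷ F) σ zero * Πℚ (off1 (b ∷ F) σ ∘ suc) ≡⟨ cong (h₀ *_) (Π-cong (tail F)) ⟩
    h₀ * ρ (σ ∘ suc) F ≡⟨ cong (h₀ *_) (ρ-insert (σ ∘ suc) F i h) ⟩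
    h₀ * (σ (suc i) * ρ (σ ∘ suc) (F [ i ]≔ true)) ≡⟨ lem h₀ (σ (suc i)) (ρ (σ ∘ suc) (F [ i ]≔ true)) ⟩
    σ (suc i) * (h₀ * ρ (σ ∘ suc) (F [ i ]≔ true)) ≡⟨ cong (σ (suc i) *_) (cong₂ _*_ (head b) (sym (Π-cong (tail (F [ i ]≔ true))))) ⟩
    σ (suc i) * ρ σ (b ∷ (F [ i ]≔ true)) ∎
    where
    open ≡-Reasoning
    h₀ = off1 (b ∷ F) σ zero
    head : ∀ b → off1 (b ∷ F) σ zero ≡ off1 (b ∷ (F [ i ]≔ true)) σ zero
    head true = refl
    head false = refl
    tail : ∀ F′ j → off1 (b ∷ F′) σ (suc j) ≡ off1 F′ (σ ∘ suc) j
    tail F′ j with lookup F′ j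
    ... | true = refl
    ... | false = refl
    lem : ∀ a b c → a * (b * c) ≡ b * (a * c)
    lem = solve-∀ ℚ-ring

  ρ-1 : ∀ {m} (σ : Fin m → ℚ) t → (∀ j → σ j ≡ 1ℚ) → ρ σ t ≡ 1ℚ
  ρ-1 σ t h = Π-1 λ j → go j
    where
    go : ∀ j → off1 t σ j ≡ 1ℚ
    go j with lookup t j
    ... | true = refl
    ... | false = h j

  module Identity {m k} (g : Fin m → Vecℚ k) (e : Fin m → ℚ) where
    open Chambers g

    -- The dual point of a basis lies on the hyperplanes `u · g j = e j` of its own columns and on
    -- no others: the arrangement is simple at all its vertices.
    NonDegenerate : Set
    NonDegenerate = ∀ {t} (β : Basis t) j → lookup t j ≡ false → dualPoint β e · g j ≢ e j

    -- The negated reduced cost. For a solution `x`, the cost `e · x` is the value of the dual point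
    -- minus the sum of all `x j * slack β j`.
    slack : ∀ {t} → Basis t → Fin m → ℚ
    slack β j = dualPoint β e · g j - e j

    -- Two readings carry the proof. In the dual space, the point of `β` is a vertex of the closed
    -- cell of the arrangement on the side `σ`. In the primal space, with `σ` the signs of `x`, the
    -- nonbasic coordinates of `x` have the signs of the slacks, so `x` is in the polarised cone.
    Vertex : (Fin m → ℚ) → ∀ {t} → Basis t → Set
    Vertex σ β = ∀ j → 0ℚ ≤ σ j * slack β j

    vertex? : ∀ σ {t} (β : Basis t) → Dec (Vertex σ β)
    vertex? σ β = Finₚ.all? (λ j → 0ℚ ≤? σ j * slack β j)

    onBasis : ∀ t → (Basis t → ℚ) → ℚ
    onBasis t f with basis? t
    ... | yes β = f β
    ... | no _ = 0ℚ

    onBasis-cong : ∀ t {f h : Basis t → ℚ} → (∀ β → f β ≡ h β) → onBasis t f ≡ onBasis t h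
    onBasis-cong t e with basis? t
    ... | yes β = e β
    ... | no _ = refl

    onBasis-0 : ∀ t {f : Basis t → ℚ} → (∀ β → f β ≡ 0ℚ) → onBasis t f ≡ 0ℚ
    onBasis-0 t e with basis? t
    ... | yes β = e β
    ... | no _ = refl

    onBasis-yes : ∀ t {f : Basis t → ℚ} {q} → Basis t → (∀ β → f β ≡ q) → onBasis t f ≡ q
    onBasis-yes t β₀ e with basis? t
    ... | yes β = e β
    ... | no ¬β = ⊥-elim (¬β β₀)

    onBasis-Σ : ∀ {n} t (f : Basis t → Fin n → ℚ) → onBasis t (λ β → Σℚ (f β)) ≡ Σℚ (λ i → onBasis t (λ β → f β i))
    onBasis-Σ {n} t f with basis? t
    ... | yes β = refl
    ... | no _ = sym (Σ-0 {n} {λ _ → 0ℚ} (λ _ → refl))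

    onBasis-≢0 : ∀ t {f : Basis t → ℚ} → onBasis t f ≢ 0ℚ → Σ (Basis t) λ β → f β ≢ 0ℚ
    onBasis-≢0 t ne with basis? t
    ... | yes β = β , ne
    ... | no _ = ⊥-elim (ne refl)

    vertexTerm : (Fin m → ℚ) → Vecℚ k → ∀ {t} → Basis t → ℚ
    vertexTerm σ y {t} β = 𝟙 (vertex? σ β) * ρ σ t * 𝟙 (feasible? β y)

    slack-on : ∀ {t} (β : Basis t) j → lookup t j ≡ true → slack β j ≡ 0ℚ
    slack-on β j h = p≡q⇒p-q≡0 (dualPoint-on β e j h)

    -- The ray y − τ g p (τ ≥ 0) leaves every cone, and the terms are regrouped by the facets F it hits.
    module Telescope (nondeg : NonDegenerate) (pointed : Pointed) {y : Vecℚ k} (gen : Generic y)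
      (x σ : Fin m → ℚ) (y≡ : ∀ r → y r ≡ lin g x r)
      (σ² : ∀ j → σ j * σ j ≡ 1ℚ) (0≤σx : ∀ j → 0ℚ ≤ σ j * x j) (p : Fin m) (σₚ : σ p ≡ - 1ℚ) where

      -- Coordinates of `y` and of `g p`, preceded by the row 0, -1, which encodes that the ray
      -- parameter is nonnegative.
      rayC rayD : ∀ {t} → Basis t → Fin (suc m) → ℚ
      rayC β zero = 0ℚ
      rayC β (suc l) = W β l · y
      rayD β zero = - 1ℚ
      rayD β (suc l) = W β l · g p

      module Ray {t} (β : Basis t) = Interval (rayC β) (rayD β)

      facetTerm : ∀ {t} → Basis t → Fin m → ℚ
      facetTerm β i = sgn (W β i · g p) * 𝟙 (Ray.hit? β (suc i))

      W≢0 : ∀ {t} (β : Basis t) {l y′} → W β l · y′ ≢ 0ℚ → W β l · y ≢ 0ℚ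
      W≢0 β {l} ne = gen β l (on⇐W≢0 β ne)

      -- If two walls were crossed at the same parameter, exchanging one of the two columns for `p`
      -- would give a basis in which `y` has a zero coordinate. When `p` is itself basic, only its
      -- own row is nonconstant.
      ray-distinct : ∀ {t} (β : Basis t) l l′ → l ≢ l′ → rayD β l ≢ 0ℚ → rayD β l′ ≢ 0ℚ → Ray.τ β l ≢ Ray.τ β l′
      ray-distinct β zero zero ne _ _ = ⊥-elim (ne refl)
      ray-distinct β zero (suc l) ne _ dₗ≢0 eq = W≢0 β dₗ≢0 (trans (sym (div-* dₗ≢0))
        (trans (cong (_* rayD β (suc l)) (trans (sym eq) (*-zeroˡ (inv (- 1ℚ))))) (*-zeroˡ (rayD β (suc l)))))
      ray-distinct β (suc l) zero ne dₗ≢0 d₀≢0 eq = ray-distinct β zero (suc l) (ne ∘ sym) d₀≢0 dₗ≢0 (sym eq)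
      ray-distinct {t} β (suc l) (suc l′) ne dₗ≢0 d′≢0 eq with true∨false (lookup t p)
      ... | inj₁ tₚ = ne (cong suc (trans (is l dₗ≢0) (sym (is l′ d′≢0))))
        where
        is : ∀ i → W β i · g p ≢ 0ℚ → i ≡ p
        is i ne with i Fin.≟ p
        ... | yes e = e
        ... | no i≢p = ⊥-elim (ne (trans (dual β i p tₚ) (δ-≢ i≢p)))
      ... | inj₂ tₚ = gen β′ l′ l′∈ (begin
          W β′ l′ · y ≡⟨ proj₂ ex l′ y ⟩
          W β l′ · y + (δ l′ p - W β l′ · g p) * Ray.τ β (suc l)
            ≡⟨ cong₂ (λ a b → W β l′ · y + (a - W β l′ · g p) * b) (δ-≢ l′≢p) eq ⟩
          W β l′ · y + (0ℚ - W β l′ · g p) * Ray.τ β (suc l′) ≡⟨ lem (W β l′ · y) (W β l′ · g p) (Ray.τ β (suc l′)) ⟩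
          W β l′ · y - Ray.τ β (suc l′) * (W β l′ · g p) ≡⟨ p≡q⇒p-q≡0 (sym (div-* {W β l′ · y} d′≢0)) ⟩
          0ℚ ∎)
        where
        open ≡-Reasoning
        lem : ∀ a b c → a + (0ℚ - b) * c ≡ a - c * b
        lem = solve-∀ ℚ-ring
        tₗ = on⇐W≢0 β dₗ≢0
        tₗ′ = on⇐W≢0 β d′≢0
        l≢p : l ≢ p
        l≢p refl = true≢false tₗ tₚ
        l′≢p : l′ ≢ p
        l′≢p refl = true≢false tₗ′ tₚ
        l′≢l : l′ ≢ l
        l′≢l e = ne (cong suc (sym e))
        ex = exchange {t′ = swap t l p} (swap-exchange t l≢p) β tₗ dₗ≢0
        β′ = proj₁ ex
        l′∈ : lookup (swap t l p) l′ ≡ true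
        l′∈ = trans (Vecₚ.lookup∘update′ l′≢p (t [ l ]≔ false) true) (trans (Vecₚ.lookup∘update′ l′≢l t false) tₗ′)

      -- If no coordinate of `g p` were positive, `g p` minus its expansion would be a nonnegative
      -- relation. By pointedness it is trivial, and then the coordinate of `g p` at `p` is one.
      ray-exits : ∀ {t} (β : Basis t) → Σ (Fin (suc m)) λ l → 0ℚ < rayD β l
      ray-exits β with Finₚ.any? (λ l → 0ℚ <? W β l · g p)
      ... | yes (l , h) = suc l , h
      ... | no none = ⊥-elim (<⇒≱ (subst (0ℚ <_) (sym Wₚ≡1) 0<1) (le p))
        where
        le : ∀ l → W β l · g p ≤ 0ℚ
        le l = ≮⇒≥ (λ h → none (l , h))
        θ≡0 : ∀ j → δ j p - W β j · g p ≡ 0ℚ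
        θ≡0 = pointed (λ l → δ l p - W β l · g p) (λ l → 0≤p+q (0≤δ l p) (0≤-p (le l))) (lin-θ β p)
        Wₚ≡1 : W β p · g p ≡ 1ℚ
        Wₚ≡1 = trans (sym (p-q≡0⇒p≡q (θ≡0 p))) (δ-refl p)

      -- The ray meets the cone in an interval. Its start counts exactly when `y` is in the cone,
      -- with sign minus one, and the balance of endpoints moves this count to the walls.
      feasible-facets : ∀ {t} (β : Basis t) → 𝟙 (feasible? β y) ≡ Σℚ (facetTerm β)
      feasible-facets β = trans (𝟙-⇔ (feasible? β y) (Ray.hit? β zero) to from) (flip (Ray.balanced β (ray-exits β) (zero , neg<0) (ray-distinct β)))
        where
        neg<0 : - 1ℚ < 0ℚ
        neg<0 = neg-antimono-< 0<1
        τ₀≡0 : Ray.τ β zero ≡ 0ℚ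
        τ₀≡0 = *-zeroˡ (inv (- 1ℚ))
        row : ∀ a b → a - Ray.τ β zero * b ≡ a
        row a b = trans (cong (λ q → a - q * b) τ₀≡0) (lem a b)
          where
          lem : ∀ a b → a - 0ℚ * b ≡ a
          lem = solve-∀ ℚ-ring
        to : Feasible β y → Ray.Hit β zero
        to f = <0⇒≢0 neg<0 , λ { zero → ≤-reflexive (sym (row 0ℚ (- 1ℚ)))
                               ; (suc l) → subst (0ℚ ≤_) (sym (row (W β l · y) (W β l · g p))) (f l) }
        from : Ray.Hit β zero → Feasible β y
        from (_ , f) l = subst (0ℚ ≤_) (row (W β l · y) (W β l · g p)) (f (suc l))
        flip : ∀ {h s} → - 1ℚ * h + s ≡ 0ℚ → h ≡ s
        flip {h} {s} e = p-q≡0⇒p≡q (trans (lem h s) (cong -_ e))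
          where
          lem : ∀ h s → h - s ≡ - (- 1ℚ * h + s)
          lem = solve-∀ ℚ-ring

      term : ∀ t → Fin m → ℚ
      term t i = onBasis t (λ β → 𝟙 (vertex? σ β) * ρ σ t * facetTerm β i)

      term-off : ∀ t i → lookup t i ≡ false → term t i ≡ 0ℚ
      term-off t i h = onBasis-0 t λ β → trans (cong (λ s → 𝟙 (vertex? σ β) * ρ σ t * (s * 𝟙 (Ray.hit? β (suc i))))
          (sgn-0 (W-off· β h (g p)))) (lem (𝟙 (vertex? σ β) * ρ σ t) (𝟙 (Ray.hit? β (suc i))))
        where
        lem : ∀ a b → a * (0ℚ * b) ≡ 0ℚ
        lem = solve-∀ ℚ-ring

      module Facet (F : Mask m) (i₀ : Fin m) (F₀ : lookup F i₀ ≡ false) (β₀ : Basis (F [ i₀ ]≔ true))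
        (hit₀ : Ray.Hit β₀ (suc i₀)) where

        -- `w` spans the functionals vanishing on `F`. The functionals with value `e j` on all of
        -- `F` thus form the line through `u₀` with direction `w`, and every basis over `F` has its
        -- dual point there.
        w = W β₀ i₀
        u₀ = dualPoint β₀ e
        τ₀ = Ray.τ β₀ (suc i₀)

        in-F₀ : ∀ {i j} → lookup F j ≡ true → lookup (F [ i ]≔ true) j ≡ true
        in-F₀ {i} {j} h with j Fin.≟ i
        ... | yes refl = Vecₚ.lookup∘update j F true
        ... | no ne = trans (Vecₚ.lookup∘update′ ne F true) h

        in-F⁻ : ∀ {i j} → j ≢ i → lookup (F [ i ]≔ true) j ≡ lookup F j
        in-F⁻ ne = Vecₚ.lookup∘update′ ne F true

        w-F : ∀ {j} → lookup F j ≡ true → w · g j ≡ 0ℚ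
        w-F {j} h = trans (dual β₀ i₀ j (in-F₀ h)) (δ-≢ {i = i₀} {j} (λ { refl → true≢false h F₀ }))

        u₀-F : ∀ {j} → lookup F j ≡ true → u₀ · g j ≡ e j
        u₀-F {j} h = dualPoint-on β₀ e j (in-F₀ h)

        -- In the basis obtained by adding `i` to `F`, only the coordinate at `i` can see the
        -- difference of two functionals that agree on `F`.
        at-i : ∀ {i} (β : Basis (F [ i ]≔ true)) v v′ → (∀ {j} → lookup F j ≡ true → v · g j ≡ v′ · g j) →
          ∀ y′ → v · y′ - v′ · y′ ≡ (W β i · y′) * (v · g i - v′ · g i)
        at-i {i} β v v′ agree y′ = trans (cong₂ _-_ (expand· β v y′) (expand· β v′ y′))
          (trans (sym (Σ-- (λ j → (W β j · y′) * (v · g j)) (λ j → (W β j · y′) * (v′ · g j))))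
          (trans (Σ-cong (λ j → lem (W β j · y′) (v · g j) (v′ · g j)))
            (Σ-single (λ j → (W β j · y′) * (v · g j - v′ · g j)) i zeros)))
          where
          lem : ∀ a b c → a * b - a * c ≡ a * (b - c)
          lem = solve-∀ ℚ-ring
          zeros : ∀ j → j ≢ i → (W β j · y′) * (v · g j - v′ · g j) ≡ 0ℚ
          zeros j ne with true∨false (lookup F j)
          ... | inj₁ h = trans (cong ((W β j · y′) *_) (p≡q⇒p-q≡0 (agree h))) (*-zeroʳ (W β j · y′))
          ... | inj₂ h = trans (cong (_* (v · g j - v′ · g j)) (W-off· β (trans (in-F⁻ ne) h) y′)) (*-zeroˡ (v · g j - v′ · g j))

        zeroV : Vecℚ k
        zeroV _ = 0ℚ

        zeroV-· : ∀ y′ → zeroV · y′ ≡ 0ℚ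
        zeroV-· y′ = Σ-0 (λ r → *-zeroˡ (y′ r))

        w-scaled : ∀ {i} (β : Basis (F [ i ]≔ true)) y′ → w · y′ ≡ (W β i · y′) * (w · g i)
        w-scaled {i} β y′ = trans (sym (minus0 (w · y′) (zeroV-· y′)))
          (trans (at-i β w zeroV (λ h → trans (w-F h) (sym (zeroV-· (g _)))) y′)
            (cong ((W β i · y′) *_) (minus0 (w · g i) (zeroV-· (g i)))))
          where
          minus0 : ∀ a {b} → b ≡ 0ℚ → a - b ≡ a
          minus0 a refl = +-identityʳ a

        w-i₀ : w · g i₀ ≡ 1ℚ
        w-i₀ = trans (dual β₀ i₀ i₀ (Vecₚ.lookup∘update i₀ F true)) (δ-refl i₀)

        basis⇒w≢0 : ∀ {i} → Basis (F [ i ]≔ true) → w · g i ≢ 0ℚ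
        basis⇒w≢0 {i} β h = 1≢0 (trans (sym w-i₀) (trans (w-scaled β (g i₀))
          (trans (cong ((W β i · g i₀) *_) h) (*-zeroʳ (W β i · g i₀)))))

        w≢0⇒off : ∀ {i} → w · g i ≢ 0ℚ → lookup F i ≡ false
        w≢0⇒off {i} ne with true∨false (lookup F i)
        ... | inj₁ h = ⊥-elim (ne (w-F h))
        ... | inj₂ h = h

        w≢0⇒basis : ∀ {i} → w · g i ≢ 0ℚ → Basis (F [ i ]≔ true)
        w≢0⇒basis {i} ne with i Fin.≟ i₀
        ... | yes refl = β₀
        ... | no i≢i₀ = proj₁ (exchange {t′ = F [ i ]≔ true} (Vecₚ.lookup∘update i F true , on , off) β₀ (Vecₚ.lookup∘update i₀ F true) ne)
          where
          on : ∀ l → lookup (F [ i ]≔ true) l ≡ true → l ≢ i → l ≢ i₀ × lookup (F [ i₀ ]≔ true) l ≡ true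
          on l h l≢i = (λ { refl → true≢false (trans (sym (in-F⁻ l≢i)) h) F₀ }) , in-F₀ (trans (sym (in-F⁻ l≢i)) h)
          off : ∀ l → lookup (F [ i ]≔ true) l ≡ false → l ≢ i × (l ≢ i₀ → lookup (F [ i₀ ]≔ true) l ≡ false)
          off l h = l≢i , λ l≢i₀ → trans (in-F⁻ l≢i₀) (trans (sym (in-F⁻ l≢i)) h)
            where
            l≢i : l ≢ i
            l≢i refl = true≢false (Vecₚ.lookup∘update i F true) h

        w·gp≢0 : w · g p ≢ 0ℚ
        w·gp≢0 = proj₁ hit₀

        w·y≢0 : w · y ≢ 0ℚ
        w·y≢0 = gen β₀ i₀ (Vecₚ.lookup∘update i₀ F true)

        w·y≡ : w · y ≡ τ₀ * (w · g p)
        w·y≡ = sym (div-* w·gp≢0)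

        0≤τ₀ : 0ℚ ≤ τ₀
        0≤τ₀ = subst (0ℚ ≤_) (lem τ₀) (proj₂ hit₀ zero)
          where
          lem : ∀ a → 0ℚ - a * - 1ℚ ≡ a
          lem = solve-∀ ℚ-ring

        -- y − τ₀ g p is a nonnegative combination of F, so every cone over F is hit at the same τ₀.
        hit-all : ∀ {i} (β : Basis (F [ i ]≔ true)) → Ray.Hit β (suc i)
        hit-all {i} β = Wgp≢0 , λ { zero → subst (0ℚ ≤_) (trans (sym τ≡) (lem (Ray.τ β (suc i)))) 0≤τ₀ ; (suc l) → row l }
          where
          lem : ∀ a → a ≡ 0ℚ - a * - 1ℚ
          lem = solve-∀ ℚ-ring
          Wgp≢0 : W β i · g p ≢ 0ℚ
          Wgp≢0 h = w·gp≢0 (trans (w-scaled β (g p)) (trans (cong (_* (w · g i)) h) (*-zeroˡ (w · g i))))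
          τ≡ : Ray.τ β (suc i) ≡ τ₀
          τ≡ = div-unique {a = W β i · y} Wgp≢0 (*-cancel (basis⇒w≢0 β) (trans (*-assoc τ₀ (W β i · g p) (w · g i))
            (trans (cong (τ₀ *_) (sym (w-scaled β (g p)))) (trans (sym w·y≡) (w-scaled β y)))))
            where
            *-cancel : ∀ {a b c} → c ≢ 0ℚ → a * c ≡ b * c → a ≡ b
            *-cancel {a} {b} {c} h e = p-q≡0⇒p≡q (*-cancelʳ-0 h (trans (lem₁ a b c) (p≡q⇒p-q≡0 e)))
              where
              lem₁ : ∀ a b c → (a - b) * c ≡ a * c - b * c
              lem₁ = solve-∀ ℚ-ring
          c : Fin m → ℚ
          c l = W β₀ l · y - τ₀ * (W β₀ l · g p)
          v : Vecℚ k
          v r = y r - τ₀ * g p r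
          sub· : ∀ a → a · v ≡ a · y - τ₀ * (a · g p)
          sub· a = trans (Σ-cong (λ r → lem₁ (a r) (y r) τ₀ (g p r)))
            (trans (Σ-- (λ r → a r * y r) (λ r → τ₀ * (a r * g p r))) (cong (λ q → a · y - q) (Σ-*ˡ τ₀ (λ r → a r * g p r))))
            where
            lem₁ : ∀ a y t q → a * (y - t * q) ≡ a * y - t * (a * q)
            lem₁ = solve-∀ ℚ-ring
          c-supp : ∀ j → lookup (F [ i ]≔ true) j ≡ false → c j ≡ 0ℚ
          c-supp j h with j Fin.≟ i₀ | j Fin.≟ i
          ... | yes refl | _ = p≡q⇒p-q≡0 w·y≡
          ... | no _ | yes refl = ⊥-elim (true≢false (Vecₚ.lookup∘update i F true) h)
          ... | no j≢i₀ | no j≢i = trans (cong₂ (λ a b → a - τ₀ * b) (W-off· β₀ off y) (W-off· β₀ off (g p))) (lem₁ τ₀)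
            where
            off = trans (in-F⁻ j≢i₀) (trans (sym (in-F⁻ j≢i)) h)
            lem₁ : ∀ a → 0ℚ - a * 0ℚ ≡ 0ℚ
            lem₁ = solve-∀ ℚ-ring
          row : ∀ l → 0ℚ ≤ W β l · y - Ray.τ β (suc i) * (W β l · g p)
          row l = subst (0ℚ ≤_) (trans (sym (coord β v c c-supp (λ r → trans (expand β₀ v r) (lin-cong g (λ j → sub· (W β₀ j)) r)) l))
            (trans (sub· (W β l)) (cong (λ q → W β l · y - q * (W β l · g p)) (sym τ≡)))) (proj₂ hit₀ (suc l))

        -- The inequalities of the cell `σ` restricted to the dual line: at parameter `x` the row
        -- `j` reads `σ j` times the slack of the functional `u₀ + x w`.
        edgeC edgeD : Fin m → ℚ
        edgeC j = σ j * (u₀ · g j - e j)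
        edgeD j = - (σ j * (w · g j))

        module Edge = Interval edgeC edgeD

        σ≢0 : ∀ j → σ j ≢ 0ℚ
        σ≢0 j h = 1≢0 (trans (sym (σ² j)) (trans (cong (_* σ j) h) (*-zeroˡ (σ j))))

        edgeD≢0⇒ : ∀ {j} → edgeD j ≢ 0ℚ → w · g j ≢ 0ℚ
        edgeD≢0⇒ {j} ne h = ne (cong -_ (trans (cong (σ j *_) h) (*-zeroʳ (σ j))))

        edgeD≢0 : ∀ {j} → w · g j ≢ 0ℚ → edgeD j ≢ 0ℚ
        edgeD≢0 {j} ne h = ne (*-cancelˡ-0 (σ≢0 j) (neg-injective h))

        -- `Edge.τ i` is the parameter at which the line meets the hyperplane of `g i`, and the
        -- point there is the dual point of the basis over `F` containing `i`. Hence endpoints of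
        -- the edge are vertices of the cell.
        edge-slack : ∀ {i} (β : Basis (F [ i ]≔ true)) j → edgeC j - Edge.τ i * edgeD j ≡ σ j * slack β j
        edge-slack {i} β j = begin
          σ j * (u₀ · g j - e j) - Edge.τ i * - (σ j * (w · g j))
            ≡⟨ cong (λ q → σ j * (u₀ · g j - e j) - q * - (σ j * (w · g j))) τ≡λ ⟩
          σ j * (u₀ · g j - e j) - λ′ * - (σ j * (w · g j))
            ≡⟨ lem₁ (σ j) (u₀ · g j) (e j) λ′ (w · g j) ⟩
          σ j * (u₀ · g j + λ′ * (w · g j) - e j)
            ≡⟨ cong (λ q → σ j * (q - e j)) u≡ ⟩
          σ j * (dualPoint β e · g j - e j) ∎
          where
          open ≡-Reasoning
          α≢0 = basis⇒w≢0 β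
          λ′ = (e i - u₀ · g i) * inv (w · g i)
          lem₁ : ∀ s u e l w → s * (u - e) - l * - (s * w) ≡ s * (u + l * w - e)
          lem₁ = solve-∀ ℚ-ring
          τ≡λ : Edge.τ i ≡ λ′
          τ≡λ = div-unique (edgeD≢0 α≢0) (trans (lem₂ (e i - u₀ · g i) (inv (w · g i)) (σ i) (w · g i))
            (trans (cong (λ q → - ((e i - u₀ · g i) * q * σ i)) (inv-* α≢0)) (lem₃ (e i) (u₀ · g i) (σ i))))
            where
            lem₂ : ∀ a κ s w → a * κ * - (s * w) ≡ - (a * (κ * w) * s)
            lem₂ = solve-∀ ℚ-ring
            lem₃ : ∀ e u s → - ((e - u) * 1ℚ * s) ≡ s * (u - e)
            lem₃ = solve-∀ ℚ-ring
          u≡ : u₀ · g j + λ′ * (w · g j) ≡ dualPoint β e · g j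
          u≡ = sym (trans (move (at-i β (dualPoint β e) u₀ (λ {l} h → trans (dualPoint-on β e l (in-F₀ h)) (sym (u₀-F h))) (g j)))
            (cong (u₀ · g j +_) (begin
              (W β i · g j) * (dualPoint β e · g i - u₀ · g i)
                ≡⟨ cong (λ q → (W β i · g j) * (q - u₀ · g i)) (dualPoint-on β e i (Vecₚ.lookup∘update i F true)) ⟩
              (W β i · g j) * (e i - u₀ · g i) ≡⟨ sym (*-identityʳ ((W β i · g j) * (e i - u₀ · g i))) ⟩
              (W β i · g j) * (e i - u₀ · g i) * 1ℚ ≡⟨ cong ((W β i · g j) * (e i - u₀ · g i) *_) (sym (inv-* α≢0)) ⟩
              (W β i · g j) * (e i - u₀ · g i) * (inv (w · g i) * (w · g i))
                ≡⟨ lem₄ (W β i · g j) (e i - u₀ · g i) (inv (w · g i)) (w · g i) ⟩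
              λ′ * ((W β i · g j) * (w · g i)) ≡⟨ cong (λ′ *_) (sym (w-scaled β (g j))) ⟩
              λ′ * (w · g j) ∎)))
            where
            lem₄ : ∀ a b c d → a * b * (c * d) ≡ b * c * (a * d)
            lem₄ = solve-∀ ℚ-ring
            move : ∀ {a b c} → a - b ≡ c → a ≡ b + c
            move {a} {b} refl = lem₅ a b
              where
              lem₅ : ∀ a b → a ≡ b + (a - b)
              lem₅ = solve-∀ ℚ-ring

        -- Two hyperplanes meeting the line in one point would put the dual point of a basis on the
        -- hyperplane of a nonbasic column, against nondegeneracy.
        edge-distinct : ∀ l l′ → l ≢ l′ → edgeD l ≢ 0ℚ → edgeD l′ ≢ 0ℚ → Edge.τ l ≢ Edge.τ l′
        edge-distinct l l′ ne d≢0 d′≢0 eq = nondeg β l′ (trans (in-F⁻ (ne ∘ sym)) (w≢0⇒off (edgeD≢0⇒ d′≢0)))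
          (p-q≡0⇒p≡q (*-cancelˡ-0 (σ≢0 l′) (trans (sym (edge-slack β l′))
            (trans (cong (λ q → edgeC l′ - q * edgeD l′) eq) (p≡q⇒p-q≡0 (sym (div-* {edgeC l′} d′≢0)))))))
          where
          β = w≢0⇒basis (edgeD≢0⇒ d≢0)

        -- This makes the edge bounded. Since every `σ j * x j` is nonnegative, one-sidedness gives
        -- `s * (w · y)` the sign plus. But `w · y` is `τ₀ * (w · g p)`, and `σ p` is -1, which
        -- gives the sign minus; so `w · y` is zero and `y` is not generic.
        not-one-sided : ∀ s → s ≢ 0ℚ → ¬ (∀ j → 0ℚ ≤ s * (σ j * (w · g j)))
        not-one-sided s s≢0 h = w·y≢0 (*-cancelˡ-0 s≢0 (≤-antisym upper lower))
          where
          lem : ∀ s x v σ → s * (x * v) * (σ * σ) ≡ (σ * x) * (s * (σ * v))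
          lem = solve-∀ ℚ-ring
          lower : 0ℚ ≤ s * (w · y)
          lower = subst (0ℚ ≤_) (sym (trans (cong (s *_) (trans (·-congʳ w y≡) (·-lin w g x)))
              (trans (sym (Σ-*ˡ s (λ j → x j * (w · g j))))
                (Σ-cong (λ j → trans (sym (*-identityʳ (s * (x j * (w · g j)))))
                  (trans (cong (s * (x j * (w · g j)) *_) (sym (σ² j))) (lem s (x j) (w · g j) (σ j))))))))
            (Σ-0≤ (λ j → 0≤p*q (0≤σx j) (h j)))
          lem₂ : ∀ t s v → t * (s * (- 1ℚ * v)) ≡ - (s * (t * v))
          lem₂ = solve-∀ ℚ-ring
          upper : s * (w · y) ≤ 0ℚ
          upper = subst (_≤ 0ℚ) (trans (cong -_ (trans (cong (λ q → τ₀ * (s * (q * (w · g p)))) σₚ) (lem₂ τ₀ s (w · g p))))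
              (trans (lem₃ (s * (τ₀ * (w · g p)))) (cong (s *_) (sym w·y≡))))
            (-p≤0 (0≤p*q 0≤τ₀ (h p)))
            where
            lem₃ : ∀ a → - (- a) ≡ a
            lem₃ = solve-∀ ℚ-ring

        edge-up : Σ (Fin m) λ l → 0ℚ < edgeD l
        edge-up with Finₚ.any? (λ l → 0ℚ <? edgeD l)
        ... | yes p = p
        ... | no none = ⊥-elim (not-one-sided 1ℚ 1≢0 (λ j → subst (0ℚ ≤_) (lem (σ j * (w · g j))) (0≤-p (≮⇒≥ (λ h → none (j , h))))))
          where
          lem : ∀ a → - (- a) ≡ 1ℚ * a
          lem = solve-∀ ℚ-ring

        edge-down : Σ (Fin m) λ l → edgeD l < 0ℚ
        edge-down with Finₚ.any? (λ l → edgeD l <? 0ℚ)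
        ... | yes p = p
        ... | no none = ⊥-elim (not-one-sided (- 1ℚ) (<0⇒≢0 (neg-antimono-< 0<1))
            (λ j → subst (0ℚ ≤_) (lem (σ j * (w · g j))) (≮⇒≥ (λ h → none (j , h)))))
          where
          lem : ∀ a → - a ≡ - 1ℚ * a
          lem = solve-∀ ℚ-ring

        sgn-σ : ∀ j → sgn (σ j) ≡ σ j
        sgn-σ j with <-cmp (σ j) 0ℚ
        ... | tri≈ _ b _ = ⊥-elim (σ≢0 j b)
        ... | tri> _ _ c = p-q≡0⇒p≡q (*-cancelʳ-0 (0<⇒≢0 (0<p+q 0<1 (<⇒≤ c))) (trans (lem (σ j)) (p≡q⇒p-q≡0 (sym (σ² j)))))
          where
          lem : ∀ s → (1ℚ - s) * (1ℚ + s) ≡ 1ℚ - s * s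
          lem = solve-∀ ℚ-ring
        ... | tri< a _ _ = p-q≡0⇒p≡q (*-cancelʳ-0 (0<⇒≢0 (0<p+q 0<1 (<⇒≤ (0<-p a)))) (trans (lem (σ j)) (p≡q⇒p-q≡0 (σ² j))))
          where
          lem : ∀ s → (- 1ℚ - s) * (1ℚ - s) ≡ s * s - 1ℚ
          lem = solve-∀ ℚ-ring

        κ = - (ρ σ F * sgn (w · g p))

        -- The exit sign splits as `sgn (w · g p) * sgn (w · g i)`, and inserting `i` changes `ρ` by
        -- the factor `σ i`. Up to the common `κ`, what depends on `i` is the sign of `edgeD i`, so
        -- the facet contributes a multiple of a signed endpoint count.
        factor : ∀ i → offᵐ F i (term (F [ i ]≔ true) i) ≡ κ * (sgn (edgeD i) * 𝟙 (Edge.hit? i))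
        factor i with true∨false (lookup F i)
        ... | inj₁ h = trans (offᵐ-on F i (term (F [ i ]≔ true) i) h) (sym (trans (cong (λ s → κ * (s * 𝟙 (Edge.hit? i)))
              (sgn-0 (cong -_ (trans (cong (σ i *_) (w-F h)) (*-zeroʳ (σ i)))))) (lem κ (𝟙 (Edge.hit? i)))))
          where
          lem : ∀ a b → a * (0ℚ * b) ≡ 0ℚ
          lem = solve-∀ ℚ-ring
        ... | inj₂ h = trans (offᵐ-off F i (term (F [ i ]≔ true) i) h) (go (w · g i ≟ 0ℚ))
          where
          lem : ∀ a b → a * (0ℚ * b) ≡ 0ℚ
          lem = solve-∀ ℚ-ring
          go : Dec (w · g i ≡ 0ℚ) → term (F [ i ]≔ true) i ≡ κ * (sgn (edgeD i) * 𝟙 (Edge.hit? i))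
          go (yes w≡0) = trans (onBasis-0 (F [ i ]≔ true) (λ β → ⊥-elim (basis⇒w≢0 β w≡0)))
            (sym (trans (cong (λ s → κ * (s * 𝟙 (Edge.hit? i)))
              (sgn-0 (cong -_ (trans (cong (σ i *_) w≡0) (*-zeroʳ (σ i)))))) (lem κ (𝟙 (Edge.hit? i)))))
          go (no w≢0) = onBasis-yes (F [ i ]≔ true) (w≢0⇒basis w≢0) λ β → begin
            𝟙 (vertex? σ β) * ρ σ (F [ i ]≔ true) * (sgn (W β i · g p) * 𝟙 (Ray.hit? β (suc i)))
              ≡⟨ cong₂ (λ a b → a * ρ σ (F [ i ]≔ true) * (sgn (W β i · g p) * b))
                   (𝟙-⇔ (vertex? σ β) (Edge.hit? i) (to β) (from β)) (𝟙-yes (Ray.hit? β (suc i)) (hit-all β)) ⟩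
            hE * ρ σ (F [ i ]≔ true) * (sgn (W β i · g p) * 1ℚ)
              ≡⟨ cong₂ (λ a b → hE * a * (b * 1ℚ)) ρ≡ (sgn≡ β) ⟩
            hE * (σ i * ρ σ F) * (sgn (w · g p) * sgn (w · g i) * 1ℚ)
              ≡⟨ lem₁ hE (σ i) (ρ σ F) (sgn (w · g p)) (sgn (w · g i)) ⟩
            κ * (- (σ i * sgn (w · g i)) * hE)
              ≡⟨ cong (λ q → κ * (q * hE)) (sym (trans (sgn-- (σ i * (w · g i)))
                   (cong -_ (trans (sgn-* (σ i) (w · g i)) (cong (_* sgn (w · g i)) (sgn-σ i)))))) ⟩
            κ * (sgn (edgeD i) * hE) ∎
            where
            open ≡-Reasoning
            hE = 𝟙 (Edge.hit? i)
            to : (β : Basis (F [ i ]≔ true)) → Vertex σ β → Edge.Hit i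
            to β V = edgeD≢0 w≢0 , λ j → subst (0ℚ ≤_) (sym (edge-slack β j)) (V j)
            from : (β : Basis (F [ i ]≔ true)) → Edge.Hit i → Vertex σ β
            from β (_ , f) j = subst (0ℚ ≤_) (edge-slack β j) (f j)
            ρ≡ : ρ σ (F [ i ]≔ true) ≡ σ i * ρ σ F
            ρ≡ = sym (trans (cong (σ i *_) (ρ-insert σ F i h)) (trans (sym (*-assoc (σ i) (σ i) (ρ σ (F [ i ]≔ true))))
              (trans (cong (_* ρ σ (F [ i ]≔ true)) (σ² i)) (*-identityˡ (ρ σ (F [ i ]≔ true))))))
            sgn≡ : (β : Basis (F [ i ]≔ true)) → sgn (W β i · g p) ≡ sgn (w · g p) * sgn (w · g i)
            sgn≡ β = sym (trans (cong (_* sgn (w · g i)) (trans (cong sgn (w-scaled β (g p))) (sgn-* (W β i · g p) (w · g i))))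
              (trans (*-assoc (sgn (W β i · g p)) (sgn (w · g i)) (sgn (w · g i)))
                (trans (cong (sgn (W β i · g p) *_) (sgn-sq w≢0)) (*-identityʳ (sgn (W β i · g p))))))
            lem₁ : ∀ h s r a b → h * (s * r) * (a * b * 1ℚ) ≡ - (r * a) * (- (s * b) * h)
            lem₁ = solve-∀ ℚ-ring

        facet-sum : Σℚ (λ i → offᵐ F i (term (F [ i ]≔ true) i)) ≡ 0ℚ
        facet-sum = trans (Σ-cong factor) (trans (Σ-*ˡ κ (λ i → sgn (edgeD i) * 𝟙 (Edge.hit? i)))
          (trans (cong (κ *_) (Edge.balanced edge-up edge-down edge-distinct)) (*-zeroʳ κ)))

      -- A nonzero term supplies the basis and the hit on which the facet argument is built; with no
      -- such term there is nothing to cancel.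
      facet-sum≡0 : ∀ F → Σℚ (λ i → offᵐ F i (term (F [ i ]≔ true) i)) ≡ 0ℚ
      facet-sum≡0 F with Finₚ.any? (λ i → ¬? (offᵐ F i (term (F [ i ]≔ true) i) ≟ 0ℚ))
      ... | no none = Σ-0 (λ i → decidable-stable (_ ≟ 0ℚ) (λ h → none (i , h)))
      ... | yes (i₀ , ne) = Facet.facet-sum F i₀ F₀ β₀ hit₀
        where
        off = offᵐ-≢0 F i₀ (term (F [ i₀ ]≔ true) i₀) ne
        F₀ = proj₁ off
        b = onBasis-≢0 (F [ i₀ ]≔ true) (proj₂ off)
        β₀ = proj₁ b
        hit₀ : Ray.Hit β₀ (suc i₀)
        hit₀ = 𝟙-≢0 (Ray.hit? β₀ (suc i₀)) λ h → proj₂ b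
          (trans (cong (λ q → 𝟙 (vertex? σ β₀) * ρ σ (F [ i₀ ]≔ true) * (sgn (W β₀ i₀ · g p) * q)) h)
            (lem (𝟙 (vertex? σ β₀) * ρ σ (F [ i₀ ]≔ true)) (sgn (W β₀ i₀ · g p))))
          where
          lem : ∀ a b → a * (b * 0ℚ) ≡ 0ℚ
          lem = solve-∀ ℚ-ring

      vanishes : Σᵐ (λ t → onBasis t (vertexTerm σ y)) ≡ 0ℚ
      vanishes = begin
        Σᵐ (λ t → onBasis t (vertexTerm σ y))
          ≡⟨ Σᵐ-cong (λ t → trans (onBasis-cong t (λ β → trans (cong (𝟙 (vertex? σ β) * ρ σ t *_) (feasible-facets β))
               (sym (Σ-*ˡ (𝟙 (vertex? σ β) * ρ σ t) (facetTerm β)))))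
               (onBasis-Σ t (λ β i → 𝟙 (vertex? σ β) * ρ σ t * facetTerm β i))) ⟩
        Σᵐ (λ t → Σℚ (term t)) ≡⟨ Σᵐ-swap term ⟩
        Σℚ (λ i → Σᵐ (λ t → term t i)) ≡⟨ Σ-cong (λ i → Σᵐ-cong (λ t → on t i)) ⟩
        Σℚ (λ i → Σᵐ (λ t → onᵐ t i (term t i))) ≡⟨ Σ-cong (λ i → Σᵐ-insert (λ t → term t i) i) ⟩
        Σℚ (λ i → Σᵐ (λ F → offᵐ F i (term (F [ i ]≔ true) i)))
          ≡⟨ sym (Σᵐ-swap (λ F i → offᵐ F i (term (F [ i ]≔ true) i))) ⟩
        Σᵐ (λ F → Σℚ (λ i → offᵐ F i (term (F [ i ]≔ true) i))) ≡⟨ Σᵐ-0 facet-sum≡0 ⟩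
        0ℚ ∎
        where
        open ≡-Reasoning
        on : ∀ t i → term t i ≡ onᵐ t i (term t i)
        on t i = onᵐ-vanishing t i (term t i) (term-off t i)

  -- From generic points to the closed chamber

  abstract
    -- Zero counts as positive, so that nonnegative vectors are exactly those with all signs one.
    signs : ∀ {m} → (Fin m → ℚ) → Fin m → ℚ
    signs x j with 0ℚ ≤? x j
    ... | yes _ = 1ℚ
    ... | no _ = - 1ℚ

    signs-nonNeg : ∀ {m} (x : Fin m → ℚ) j → 0ℚ ≤ x j → signs x j ≡ 1ℚ
    signs-nonNeg x j h with 0ℚ ≤? x j
    ... | yes _ = refl
    ... | no ¬h = ⊥-elim (¬h h)

    signs-neg : ∀ {m} (x : Fin m → ℚ) j → x j < 0ℚ → signs x j ≡ - 1ℚ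
    signs-neg x j h with 0ℚ ≤? x j
    ... | yes p = ⊥-elim (<⇒≱ h p)
    ... | no _ = refl

    signs-± : ∀ {m} (x : Fin m → ℚ) j → signs x j ≡ 1ℚ ⊎ signs x j ≡ - 1ℚ
    signs-± x j with 0ℚ ≤? x j
    ... | yes _ = inj₁ refl
    ... | no _ = inj₂ refl

  nonNeg? : ∀ {m} (x : Fin m → ℚ) → Dec (∀ j → 0ℚ ≤ x j)
  nonNeg? x = Finₚ.all? (λ j → 0ℚ ≤? x j)

  module Lawrence {m k} (g : Fin m → Vecℚ k) where
    open Chambers g

    -- The functional `φ β j` sends a cost to its reduced cost at `j`. Its value on the unit vector
    -- `δ j` is one when `j` is nonbasic, so perturbing the all-ones vector along the unit vectors
    -- makes every such reduced cost nonzero and keeps the entries positive.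
    nonDegenerate-cost : Σ (Fin m → ℚ) λ e → (∀ j → 0ℚ < e j) × Identity.NonDegenerate g e
    nonDegenerate-cost with perturb (functionals φ) (λ _ → 1ℚ) δ
      where
      φ : ∀ {t} → Basis t → Fin m → Vecℚ m
      φ β j r = δ j r - W β r · g j
    ... | e , c , 0<c , eq , h = e , 0<e , nondeg
      where
      φ : ∀ {t} → Basis t → Fin m → Vecℚ m
      φ β j r = δ j r - W β r · g j
      0<e : ∀ j → 0ℚ < e j
      0<e j = subst (0ℚ <_) (sym (eq j)) (0<p+q 0<1 (Σ-0≤ (λ i → 0≤p*q (<⇒≤ (0<c i)) (0≤δ i j))))
      φ· : ∀ {t} (β : Basis t) j y → φ β j · y ≡ y j - dualPoint β y · g j
      φ· β j y = trans (Σ-cong (λ r → lem (δ j r) (W β r · g j) (y r)))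
        (trans (Σ-- (λ r → δ j r * y r) (λ r → y r * (W β r · g j)))
          (cong₂ _-_ (Σ-δ y j) (sym (dualPoint-· β y (g j)))))
        where
        lem : ∀ a b c → (a - b) * c ≡ a * c - c * b
        lem = solve-∀ ℚ-ring
      nondeg : Identity.NonDegenerate g e
      nondeg {t} β j tⱼ eqⱼ with ∈-functionals φ β j
      ... | β′ , φ∈ = 1≢0 (trans (sym φδ) (proj₂ (h (φ β′ j) φ∈) φe j))
        where
        φe : φ β′ j · e ≡ 0ℚ
        φe = trans (φ· β′ j e) (p≡q⇒p-q≡0 (sym (trans (trans (dualPoint-· β′ e (g j))
          (trans (Σ-cong (λ l → cong (e l *_) (W-unique β′ β l (g j)))) (sym (dualPoint-· β e (g j))))) eqⱼ)))
        φδ : φ β′ j · δ j ≡ 1ℚ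
        φδ = trans (Σ-cong (λ r → *-comm (φ β′ j r) (δ j r))) (trans (Σ-δ (φ β′ j) j) (θ-self β′ j tⱼ))

    module Optimum (e : Fin m → ℚ) (nondeg : Identity.NonDegenerate g e) (pointed : Pointed)
      {t₀} (β₀ : Basis t₀) where
      open Identity g e

      dualPoint-neg : ∀ {t} (β : Basis t) y → dualPoint β (λ j → - e j) · y ≡ - (dualPoint β e · y)
      dualPoint-neg β y = trans (dualPoint-· β (λ j → - e j) y) (trans
        (Σ-cong (λ l → sym (neg-distribˡ-* (e l) (W β l · y))))
        (trans (Σ-neg (λ l → e l * (W β l · y))) (cong -_ (sym (dualPoint-· β e y)))))

      compare : ∀ {t t′} (β : Basis t) (β′ : Basis t′) y →
        Σℚ (λ j → (W β′ j · y) * slack β j) ≡ dualPoint β e · y - dualPoint β′ e · y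
      compare β β′ y = trans (Σ-cong (λ j → lem (W β′ j · y) (dualPoint β e · g j) (e j)))
        (trans (Σ-- (λ j → (W β′ j · y) * (dualPoint β e · g j)) (λ j → e j * (W β′ j · y)))
          (cong₂ _-_ (sym (expand· β′ (dualPoint β e) y)) (sym (dualPoint-· β′ e y))))
        where
        lem : ∀ a b c → a * (b - c) ≡ a * b - c * a
        lem = solve-∀ ℚ-ring

      Optimal : Vecℚ k → ∀ {t} → Basis t → Set
      Optimal y β = (∀ j → 0ℚ ≤ slack β j) × Feasible β y

      -- The two dual values at `y` differ by a sum of slacks weighted by coordinates, and weak
      -- duality applies in both directions; so all products vanish. Coordinates of a generic `y`
      -- are nonzero, hence so is no slack, and nondegeneracy places the column in both bases.
      optimal-⊆ : ∀ {y} → Generic y → ∀ {t t′} (β : Basis t) (β′ : Basis t′) → Optimal y β → Optimal y β′ →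
        ∀ j → lookup t′ j ≡ true → lookup t j ≡ true
      optimal-⊆ {y} gen {t} β β′ (s , f) (s′ , f′) j h with true∨false (lookup t j)
      ... | inj₁ p = p
      ... | inj₂ p = ⊥-elim (nondeg β j p (p-q≡0⇒p≡q (*-cancelˡ-0 (gen β′ j h) (Σ-0≤≡0 terms sum≡0 j))))
        where
        terms : ∀ i → 0ℚ ≤ (W β′ i · y) * slack β i
        terms i = 0≤p*q (f′ i) (s i)
        lem : ∀ a b → a - b ≡ - (b - a)
        lem = solve-∀ ℚ-ring
        sum≡0 : Σℚ (λ i → (W β′ i · y) * slack β i) ≡ 0ℚ
        sum≡0 = ≤-antisym
          (subst (_≤ 0ℚ) (trans (cong -_ (compare β′ β y))
              (trans (sym (lem (dualPoint β e · y) (dualPoint β′ e · y))) (sym (compare β β′ y))))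
            (-p≤0 (Σ-0≤ (λ i → 0≤p*q (f i) (s′ i)))))
          (Σ-0≤ terms)

      -- With all signs positive, the nonzero terms belong to the optimal bases for maximising `e`,
      -- which is why the linear programme is run with `- e j`. There is exactly one such basis and
      -- its sign is one.
      unique-optimum : ∀ {y} → Generic y → InPos g y → ∀ σ → (∀ j → σ j ≡ 1ℚ) →
        Σᵐ (λ t → onBasis t (vertexTerm σ y)) ≡ 1ℚ
      unique-optimum {y} gen y∈ σ σ≡1 with lp-optimum pointed gen β₀ y∈ (λ j → - e j)
      ... | t* , β* , f* , opt = trans
          (Σᵐ-single (λ t → onBasis t (vertexTerm σ y)) t* (λ t ne → onBasis-0 t (λ β → others β ne)))
          (onBasis-yes t* β* at*)
        where
        s* : ∀ j → 0ℚ ≤ slack β* j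
        s* j = p≤q⇒0≤q-p (subst₂ _≤_ (lem-- (e j)) (lem-- (dualPoint β* e · g j))
          (neg-antimono-≤ (subst (_≤ - e j) (dualPoint-neg β* (g j)) (opt j))))
          where
          lem-- : ∀ a → - (- a) ≡ a
          lem-- = solve-∀ ℚ-ring
        σ-slack : ∀ {t} (β : Basis t) j → σ j * slack β j ≡ slack β j
        σ-slack β j = trans (cong (_* slack β j) (σ≡1 j)) (*-identityˡ (slack β j))
        at* : ∀ β → vertexTerm σ y β ≡ 1ℚ
        at* β = cong₂ _*_ (cong₂ _*_ (𝟙-yes (vertex? σ β) V) (ρ-1 σ t* σ≡1)) (𝟙-yes (feasible? β y) F)
          where
          F : Feasible β y
          F j = subst (0ℚ ≤_) (W-unique β* β j y) (f* j)
          V : Vertex σ β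
          V j = subst (0ℚ ≤_) (sym (trans (σ-slack β j) (cong (_- e j) (trans (dualPoint-· β e (g j))
            (trans (Σ-cong (λ l → cong (e l *_) (W-unique β β* l (g j)))) (sym (dualPoint-· β* e (g j)))))))) (s* j)
        others : ∀ {t} (β : Basis t) → t ≢ t* → vertexTerm σ y β ≡ 0ℚ
        others {t} β ne with vertex? σ β | feasible? β y
        ... | no _ | d = trans (cong (_* 𝟙 d) (*-zeroˡ (ρ σ t))) (*-zeroˡ (𝟙 d))
        ... | yes _ | no _ = *-zeroʳ (1ℚ * ρ σ t)
        ... | yes V | yes F = ⊥-elim (ne (lookup-ext λ j → iff (optimal-⊆ gen β* β (s* , f*) (s , F) j) (optimal-⊆ gen β β* (s , F) (s* , f*) j)))
          where
          s : ∀ j → 0ℚ ≤ slack β j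
          s j = subst (0ℚ ≤_) (σ-slack β j) (V j)
          iff : ∀ {a b : Bool} → (a ≡ true → b ≡ true) → (b ≡ true → a ≡ true) → a ≡ b
          iff {true} f _ = sym (f refl)
          iff {false} {true} _ f = f refl
          iff {false} {false} _ _ = refl

      generic-identity : ∀ {y} → Generic y → (x : Fin m → ℚ) (σ : Fin m → ℚ) → (∀ r → y r ≡ lin g x r) →
        (∀ j → (σ j ≡ 1ℚ × 0ℚ ≤ x j) ⊎ (σ j ≡ - 1ℚ × x j ≤ 0ℚ)) →
        (d : Dec (∀ j → σ j ≡ 1ℚ)) → Σᵐ (λ t → onBasis t (vertexTerm σ y)) ≡ 𝟙 d
      generic-identity {y} gen x σ y≡ sg (yes h) = unique-optimum gen (x , 0≤x , y≡) σ h
        where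
        0≤x : ∀ j → 0ℚ ≤ x j
        0≤x j with sg j
        ... | inj₁ (_ , p) = p
        ... | inj₂ (q , _) = ⊥-elim (1≢-1 (trans (sym (h j)) q))
      generic-identity {y} gen x σ y≡ sg (no ¬h) with Finₚ.any? (λ j → ¬? (σ j ≟ 1ℚ))
      ... | no none = ⊥-elim (¬h (λ j → decidable-stable (σ j ≟ 1ℚ) (λ ne → none (j , ne))))
      ... | yes (p , ne) = Telescope.vanishes nondeg pointed gen x σ y≡ σ² 0≤σx p σₚ
        where
        σ² : ∀ j → σ j * σ j ≡ 1ℚ
        σ² j with sg j
        ... | inj₁ (q , _) = cong₂ _*_ q q
        ... | inj₂ (q , _) = cong₂ _*_ q q
        0≤σx : ∀ j → 0ℚ ≤ σ j * x j
        0≤σx j with sg j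
        ... | inj₁ (q , h) = subst (0ℚ ≤_) (sym (trans (cong (_* x j) q) (*-identityˡ (x j)))) h
        ... | inj₂ (q , h) = subst (0ℚ ≤_) (trans (lem (x j)) (cong (_* x j) (sym q))) (0≤-p h)
          where
          lem : ∀ a → - a ≡ - 1ℚ * a
          lem = solve-∀ ℚ-ring
        σₚ : σ p ≡ - 1ℚ
        σₚ with sg p
        ... | inj₁ (q , _) = ⊥-elim (ne q)
        ... | inj₂ (q , _) = q

      module _ {z} (gen : Generic z) (z∈ : InPos g z) where

        x₀ = proj₁ z∈

        -- The right-hand side is moved to `lin g x + ε * z`, represented by `x + ε * x₀`. The list
        -- fed to `perturb-list` makes `ε` small enough for two purposes: no coordinate in a basis
        -- is cancelled, so the new point is generic, and negative entries of `x` stay negative. By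
        -- `fan`, the new point lies in the same cones as `z`.
        identity : ∀ x → MaskCell z (lin g x) →
          Σᵐ (λ t → onBasis t (vertexTerm (signs x) z)) ≡ 𝟙 (nonNeg? x)
        identity x cell with perturb-list {A = ℚ × ℚ} proj₁ proj₂ (pairs ++ List.map (λ j → x j , x₀ j) (allFin m))
          where
          pairs = functionals (λ β j → (W β j · lin g x) , (W β j · z))
        ... | ε , 0<ε , keep = begin
          Σᵐ (λ t → onBasis t (vertexTerm σ z))
            ≡⟨ Σᵐ-cong (λ t → onBasis-cong t (λ β → cong (𝟙 (vertex? σ β) * ρ σ t *_)
                 (𝟙-⇔ (feasible? β z) (feasible? β y) (z⇒y β) (fan pointed gen β₀ z∈ gen-y (λ β′ f → z⇒y β′ f) β)))) ⟩
          Σᵐ (λ t → onBasis t (vertexTerm σ y))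
            ≡⟨ generic-identity gen-y xε σ y≡ sg (Finₚ.all? (λ j → σ j ≟ 1ℚ)) ⟩
          𝟙 (Finₚ.all? (λ j → σ j ≟ 1ℚ))
            ≡⟨ 𝟙-⇔ (Finₚ.all? (λ j → σ j ≟ 1ℚ)) (nonNeg? x) (λ h j → nn j (h j)) (λ h j → signs-nonNeg x j (h j)) ⟩
          𝟙 (nonNeg? x) ∎
          where
          open ≡-Reasoning
          pairs = functionals (λ β j → (W β j · lin g x) , (W β j · z))
          σ = signs x
          y : Vecℚ k
          y r = lin g x r + ε * z r
          xε : Fin m → ℚ
          xε j = x j + ε * x₀ j
          y≡ : ∀ r → y r ≡ lin g xε r
          y≡ r = sym (trans (lin-+ g x (λ j → ε * x₀ j) r) (cong (lin g x r +_)
            (trans (lin-* g ε x₀ r) (cong (ε *_) (sym (proj₂ (proj₂ z∈) r))))))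
          W·y : ∀ {t} (β : Basis t) j → W β j · y ≡ W β j · lin g x + ε * (W β j · z)
          W·y β j = trans (·-+ʳ (W β j) (lin g x) (λ r → ε * z r)) (cong (W β j · lin g x +_) (·-*ʳ ε (W β j) z))
          z⇒y : ∀ {t} (β : Basis t) → Feasible β z → Feasible β y
          z⇒y β f j = subst (0ℚ ≤_) (sym (W·y β j)) (0≤p+q (cell β f j) (0≤p*q (<⇒≤ 0<ε) (f j)))
          gen-y : Generic y
          gen-y {t} β j tⱼ Wy≡0 with ∈-functionals (λ β j → (W β j · lin g x) , (W β j · z)) β j
          ... | β′ , p∈ = gen β′ j tⱼ (*-cancelˡ-0 (0<⇒≢0 0<ε) (trans (sym (trans (cong (_+ ε * (W β′ j · z)) a≡0)
                (+-identityˡ (ε * (W β′ j · z))))) sum≡0))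
            where
            sum≡0 : W β′ j · lin g x + ε * (W β′ j · z) ≡ 0ℚ
            sum≡0 = trans (sym (W·y β′ j)) (trans (W-unique β′ β j y) Wy≡0)
            a≡0 : W β′ j · lin g x ≡ 0ℚ
            a≡0 = keepsSign⇒≢0 (keep ε 0<ε ≤-refl _ (∈-++⁺ˡ p∈)) sum≡0
          stays-neg : ∀ j → x j < 0ℚ → xε j < 0ℚ
          stays-neg j = proj₁ (keep ε 0<ε ≤-refl (x j , x₀ j) (∈-++⁺ʳ pairs (∈-map⁺ (λ j → x j , x₀ j) (∈-allFin j))))
          sg : ∀ j → (σ j ≡ 1ℚ × 0ℚ ≤ xε j) ⊎ (σ j ≡ - 1ℚ × xε j ≤ 0ℚ)
          sg j = go (0ℚ ≤? x j)
            where
            go : Dec (0ℚ ≤ x j) → _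
            go (yes h) = inj₁ (signs-nonNeg x j h , 0≤p+q h (0≤p*q (<⇒≤ 0<ε) (proj₁ (proj₂ z∈) j)))
            go (no ¬h) = inj₂ (signs-neg x j (≰⇒> ¬h) , <⇒≤ (stays-neg j (≰⇒> ¬h)))
          nn : ∀ j → σ j ≡ 1ℚ → 0ℚ ≤ x j
          nn j h = go (0ℚ ≤? x j)
            where
            go : Dec (0ℚ ≤ x j) → 0ℚ ≤ x j
            go (yes p) = p
            go (no ¬p) = ⊥-elim (1≢-1 (trans (sym h) (signs-neg x j (≰⇒> ¬p))))

  -- Integers, binomials and finite lists

  private
    toℚ-ᵘ : ∀ a → toℚᵘ (toℚ a) ℚᵘ.≃ ℚᵘ.mkℚᵘ a 0
    toℚ-ᵘ a = toℚᵘ-fromℚᵘ (ℚᵘ.mkℚᵘ a 0)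

  toℚ-+ : ∀ a b → toℚ (a ℤ.+ b) ≡ toℚ a + toℚ b
  toℚ-+ a b = toℚᵘ-injective (ℚᵘₚ.≃-trans (toℚ-ᵘ (a ℤ.+ b)) (ℚᵘₚ.≃-trans
    (ℚᵘ.*≡* (cong (ℤ._* ℤ.+ 1) (sym (cong₂ ℤ._+_ (ℤₚ.*-identityʳ a) (ℤₚ.*-identityʳ b)))))
    (ℚᵘₚ.≃-sym (ℚᵘₚ.≃-trans (toℚᵘ-homo-+ (toℚ a) (toℚ b)) (ℚᵘₚ.+-cong (toℚ-ᵘ a) (toℚ-ᵘ b))))))

  toℚ-* : ∀ a b → toℚ (a ℤ.* b) ≡ toℚ a * toℚ b
  toℚ-* a b = toℚᵘ-injective (ℚᵘₚ.≃-trans (toℚ-ᵘ (a ℤ.* b))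
    (ℚᵘₚ.≃-sym (ℚᵘₚ.≃-trans (toℚᵘ-homo-* (toℚ a) (toℚ b)) (ℚᵘₚ.*-cong (toℚ-ᵘ a) (toℚ-ᵘ b)))))

  toℚ-neg : ∀ a → toℚ (ℤ.- a) ≡ - toℚ a
  toℚ-neg a = p+q≡0⇒p≡-q (trans (sym (toℚ-+ (ℤ.- a) a)) (cong toℚ (ℤₚ.+-inverseˡ a)))

  toℚ-- : ∀ a b → toℚ (a ℤ.- b) ≡ toℚ a - toℚ b
  toℚ-- a b = trans (toℚ-+ a (ℤ.- b)) (cong (toℚ a +_) (toℚ-neg b))

  toℚ-mono : ∀ {a b} → a ℤ.≤ b → toℚ a ≤ toℚ b
  toℚ-mono {a} {b} h = toℚᵘ-cancel-≤ (ℚᵘₚ.≤-respˡ-≃ (ℚᵘₚ.≃-sym (toℚ-ᵘ a)) (ℚᵘₚ.≤-respʳ-≃ (ℚᵘₚ.≃-sym (toℚ-ᵘ b))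
    (ℚᵘ.*≤* (subst₂ ℤ._≤_ (sym (ℤₚ.*-identityʳ a)) (sym (ℤₚ.*-identityʳ b)) h))))

  toℚ-cancel : ∀ {a b} → toℚ a ≤ toℚ b → a ℤ.≤ b
  toℚ-cancel {a} {b} h = subst₂ ℤ._≤_ (ℤₚ.*-identityʳ a) (ℤₚ.*-identityʳ b)
    (ℚᵘₚ.drop-*≤* (ℚᵘₚ.≤-respˡ-≃ (toℚ-ᵘ a) (ℚᵘₚ.≤-respʳ-≃ (toℚ-ᵘ b) (toℚᵘ-mono-≤ h))))

  toℚ-injective : ∀ {a b} → toℚ a ≡ toℚ b → a ≡ b
  toℚ-injective e = ℤₚ.≤-antisym (toℚ-cancel (≤-reflexive e)) (toℚ-cancel (≤-reflexive (sym e)))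

  toℚ-cancel-< : ∀ {a b} → toℚ a < toℚ b → a ℤ.< b
  toℚ-cancel-< h = ℤₚ.≰⇒> (λ le → <⇒≱ h (toℚ-mono le))

  toℚ-mono-< : ∀ {a b} → a ℤ.< b → toℚ a < toℚ b
  toℚ-mono-< h = ≤∧≢⇒< (toℚ-mono (ℤₚ.<⇒≤ h)) (λ e → ℤₚ.<-irrefl (toℚ-injective e) h)

  toℚ-suc : ∀ n → toℚ (ℤ.+ suc n) ≡ 1ℚ + toℚ (ℤ.+ n)
  toℚ-suc n = toℚ-+ (ℤ.+ 1) (ℤ.+ n)

  0≤toℚ : ∀ n → 0ℚ ≤ toℚ (ℤ.+ n)
  0≤toℚ n = toℚ-mono {ℤ.+ 0} {ℤ.+ n} (ℤ.+≤+ ℕ.z≤n)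

  0<toℚ-suc : ∀ n → 0ℚ < toℚ (ℤ.+ suc n)
  0<toℚ-suc n = toℚ-mono-< {ℤ.+ 0} {ℤ.+ suc n} (ℤ.+<+ (ℕ.s≤s ℕ.z≤n))

  toℚ-Σ : ∀ {n} (f : Fin n → ℤ) → toℚ (Σℤ f) ≡ Σℚ (λ i → toℚ (f i))
  toℚ-Σ {zero} f = refl
  toℚ-Σ {suc n} f = trans (toℚ-+ (f zero) (Σℤ (f ∘ suc))) (cong (toℚ (f zero) +_) (toℚ-Σ (f ∘ suc)))

  fraction : ∀ q → q * toℚ (↧ q) ≡ toℚ (↥ q)
  fraction q = toℚᵘ-injective (ℚᵘₚ.≃-trans (toℚᵘ-homo-* q (toℚ (↧ q))) (ℚᵘₚ.≃-trans
    (ℚᵘₚ.*-congˡ {toℚᵘ q} (toℚ-ᵘ (↧ q))) (ℚᵘₚ.≃-trans (cancel q) (ℚᵘₚ.≃-sym (toℚ-ᵘ (↥ q))))))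
    where
    cancel : ∀ q → toℚᵘ q ℚᵘ.* ℚᵘ.mkℚᵘ (↧ q) 0 ℚᵘ.≃ ℚᵘ.mkℚᵘ (↥ q) 0
    cancel (mkℚ n d-1 _) = ℚᵘ.*≡* (trans (ℤₚ.*-identityʳ (n ℤ.* ℤ.+ suc d-1)) (cong (n ℤ.*_) (sym (ℤₚ.*-identityʳ (ℤ.+ suc d-1)))))

  abstract
    floor : ℚ → ℤ
    floor q = ↥ q ℤDM./ ↧ q

    floor-eq : ∀ q → (q - toℚ (floor q)) * toℚ (↧ q) ≡ toℚ (ℤ.+ (↥ q ℤDM.% ↧ q))
    floor-eq q = trans (lem q (toℚ (floor q)) (toℚ (↧ q))) (trans
      (cong (_- toℚ (floor q) * toℚ (↧ q)) (trans (fraction q) (trans (cong toℚ (ℤDM.a≡a%n+[a/n]*n (↥ q) (↧ q)))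
        (trans (toℚ-+ (ℤ.+ (↥ q ℤDM.% ↧ q)) (floor q ℤ.* ↧ q)) (cong (toℚ (ℤ.+ (↥ q ℤDM.% ↧ q)) +_) (toℚ-* (floor q) (↧ q)))))))
      (lem₂ (toℚ (ℤ.+ (↥ q ℤDM.% ↧ q))) (toℚ (floor q) * toℚ (↧ q))))
      where
      lem : ∀ q f d → (q - f) * d ≡ q * d - f * d
      lem = solve-∀ ℚ-ring
      lem₂ : ∀ r x → r + x - x ≡ r
      lem₂ = solve-∀ ℚ-ring
    0<↧ : ∀ q → 0ℚ < toℚ (↧ q)
    0<↧ (mkℚ n d-1 _) = 0<toℚ-suc d-1

    floor≤ : ∀ q → toℚ (floor q) ≤ q
    floor≤ q = 0≤q-p⇒p≤q (*-cancel-0≤ʳ (0<↧ q) (subst (0ℚ ≤_) (sym (floor-eq q)) (0≤toℚ (↥ q ℤDM.% ↧ q))))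

    <1+floor : ∀ q → q < 1ℚ + toℚ (floor q)
    <1+floor q = 0<q-p⇒p<q (*-cancel-0<ʳ (0<↧ q) (subst (0ℚ <_)
      (trans (sym (cong (λ x → toℚ (↧ q) - x) (floor-eq q))) (lem q (toℚ (floor q)) (toℚ (↧ q))))
      (p<q⇒0<q-p (toℚ-mono-< {ℤ.+ (↥ q ℤDM.% ↧ q)} {↧ q} (r<d q)))))
      where
      lem : ∀ q f d → d - (q - f) * d ≡ (1ℚ + f - q) * d
      lem = solve-∀ ℚ-ring
      r<d : ∀ q → ℤ.+ (↥ q ℤDM.% ↧ q) ℤ.< ↧ q
      r<d (mkℚ n d-1 _) = ℤ.+<+ (ℤDM.n%d<d n (ℤ.+ suc d-1))

  <suc⇒≤ : ∀ {a b} → a ℤ.< ℤ.suc b → a ℤ.≤ b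
  <suc⇒≤ {a} {b} lt = subst (a ℤ.≤_) (ℤₚ.pred-suc b) (ℤₚ.i<j⇒i≤pred[j] lt)

  ≤floor : ∀ {n q} → toℚ n ≤ q → n ℤ.≤ floor q
  ≤floor {n} {q} h = <suc⇒≤ (toℚ-cancel-< (subst (toℚ n <_) (sym (toℚ-+ (ℤ.+ 1) (floor q))) (≤-<-trans h (<1+floor q))))

  floor-unique : ∀ {n q} → toℚ n ≤ q → q < 1ℚ + toℚ n → floor q ≡ n
  floor-unique {n} {q} h h′ = ℤₚ.≤-antisym
    (<suc⇒≤ (toℚ-cancel-< (subst (toℚ (floor q) <_) (sym (toℚ-+ (ℤ.+ 1) n)) (≤-<-trans (floor≤ q) h′))))
    (≤floor h)

  Integral : ℚ → Set
  Integral q = Σ ℤ λ n → q ≡ toℚ n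

  floor-toℚ : ∀ n → floor (toℚ n) ≡ n
  floor-toℚ n = floor-unique ≤-refl (subst (_< 1ℚ + toℚ n) (+-identityˡ (toℚ n)) (+-monoˡ-< (toℚ n) 0<1))

  integral⇒floor : ∀ {q} → Integral q → toℚ (floor q) ≡ q
  integral⇒floor (n , e) = trans (cong (toℚ ∘ floor) e) (trans (cong toℚ (floor-toℚ n)) (sym e))

  abstract
    integral? : ∀ q → Dec (Integral q)
    integral? q with toℚ (floor q) ≟ q
    ... | yes e = yes (floor q , sym e)
    ... | no ne = no (ne ∘ integral⇒floor)

  integral-+ : ∀ {p q} → Integral p → Integral q → Integral (p + q)
  integral-+ (a , refl) (b , refl) = a ℤ.+ b , sym (toℚ-+ a b)

  integral-* : ∀ {p q} → Integral p → Integral q → Integral (p * q)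
  integral-* (a , refl) (b , refl) = a ℤ.* b , sym (toℚ-* a b)

  integral-neg : ∀ {p} → Integral p → Integral (- p)
  integral-neg (a , refl) = ℤ.- a , sym (toℚ-neg a)

  integral-Σ : ∀ {n} {f : Fin n → ℚ} → (∀ i → Integral (f i)) → Integral (Σℚ f)
  integral-Σ {zero} h = ℤ.+ 0 , refl
  integral-Σ {suc n} h = integral-+ (h zero) (integral-Σ (h ∘ suc))

  floor-shift : ∀ q n → floor (q + toℚ n) ≡ floor q ℤ.+ n
  floor-shift q n = floor-unique
    (subst (_≤ q + toℚ n) (sym (toℚ-+ (floor q) n)) (+-monoˡ-≤ (toℚ n) (floor≤ q)))
    (subst (q + toℚ n <_) (trans (+-assoc 1ℚ (toℚ (floor q)) (toℚ n)) (cong (1ℚ +_) (sym (toℚ-+ (floor q) n))))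
      (+-monoˡ-< (toℚ n) (<1+floor q)))

  clearDenominators : (qs : List ℚ) → Σ ℕ λ N → ∀ q → q ∈ qs → Integral (toℚ (ℤ.+ suc N) * q)
  clearDenominators [] = 0 , λ q ()
  clearDenominators (q ∷ qs) with clearDenominators qs
  ... | N , h = ℕ.pred (d ℕ.* suc N) , λ
        { p (here refl) → subst Integral (sym (eq p)) (integral-* ((ℤ.+ suc N) , refl) (subst Integral (sym (trans (*-comm (toℚ (ℤ.+ d)) q) (fraction q))) (↥ q , refl)))
        ; p (there p∈) → subst Integral (sym (eq′ p)) (integral-* ((ℤ.+ d) , refl) (h p p∈)) }
    where
    d = ↧ₙ q
    dN : toℚ (ℤ.+ suc (ℕ.pred (d ℕ.* suc N))) ≡ toℚ (ℤ.+ d) * toℚ (ℤ.+ suc N)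
    dN = trans (cong toℚ (ℤₚ.pos-* d (suc N))) (toℚ-* (ℤ.+ d) (ℤ.+ suc N))
    lem : ∀ a b q → a * b * q ≡ b * (a * q)
    lem = solve-∀ ℚ-ring
    eq : ∀ p → toℚ (ℤ.+ suc (ℕ.pred (d ℕ.* suc N))) * p ≡ toℚ (ℤ.+ suc N) * (toℚ (ℤ.+ d) * p)
    eq p = trans (cong (_* p) dN) (lem (toℚ (ℤ.+ d)) (toℚ (ℤ.+ suc N)) p)
    eq′ : ∀ p → toℚ (ℤ.+ suc (ℕ.pred (d ℕ.* suc N))) * p ≡ toℚ (ℤ.+ d) * (toℚ (ℤ.+ suc N) * p)
    eq′ p = trans (cong (_* p) dN) (*-assoc (toℚ (ℤ.+ d)) (toℚ (ℤ.+ suc N)) p)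

  abstract
    commonDenominator : (qs : List ℚ) → Σ ℕ λ N → ∀ q → q ∈ qs → Integral (toℚ (ℤ.+ suc N) * q)
    commonDenominator = clearDenominators

  -- The polynomial C(q + p , p) in q.
  binom : ℕ → ℚ → ℚ
  binom zero q = 1ℚ
  binom (suc p) q = binom p q * (q + toℚ (ℤ.+ suc p)) * inv (toℚ (ℤ.+ suc p))

  binom-shift : ∀ p q → binom (suc p) (q - 1ℚ) ≡ binom p q * q * inv (toℚ (ℤ.+ suc p))
  binom-shift zero q = cong (_* inv 1ℚ) (lem q)
    where
    lem : ∀ q → 1ℚ * (q - 1ℚ + 1ℚ) ≡ 1ℚ * q
    lem = solve-∀ ℚ-ring
  binom-shift (suc p) q = cong (_* inv (toℚ (ℤ.+ suc (suc p)))) (begin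
    binom (suc p) (q - 1ℚ) * (q - 1ℚ + toℚ (ℤ.+ suc (suc p)))
      ≡⟨ cong₂ (λ a b → a * (q - 1ℚ + b)) (binom-shift p q) (toℚ-suc (suc p)) ⟩
    binom p q * q * κ * (q - 1ℚ + (1ℚ + s)) ≡⟨ lem (binom p q) q κ s ⟩
    binom p q * (q + s) * κ * q ∎)
    where
    open ≡-Reasoning
    s = toℚ (ℤ.+ suc p)
    κ = inv s
    lem : ∀ b q κ s → b * q * κ * (q - 1ℚ + (1ℚ + s)) ≡ b * (q + s) * κ * q
    lem = solve-∀ ℚ-ring

  binom-pascal : ∀ p q → binom (suc p) q ≡ binom p q + binom (suc p) (q - 1ℚ)
  binom-pascal p q = sym (begin
    b + binom (suc p) (q - 1ℚ) ≡⟨ cong₂ _+_ (trans (sym (*-identityʳ b)) (cong (b *_) (sym (*-inv (0<⇒≢0 (0<toℚ-suc p)))))) (binom-shift p q) ⟩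
    b * (s * κ) + b * q * κ ≡⟨ lem b q κ s ⟩
    b * (q + s) * κ ∎)
    where
    open ≡-Reasoning
    b = binom p q
    s = toℚ (ℤ.+ suc p)
    κ = inv s
    lem : ∀ b q κ s → b * (s * κ) + b * q * κ ≡ b * (q + s) * κ
    lem = solve-∀ ℚ-ring

  binom-zero : ∀ p → binom p 0ℚ ≡ 1ℚ
  binom-zero zero = refl
  binom-zero (suc p) = trans (cong₂ (λ a b → a * b * inv s) (binom-zero p) (+-identityˡ s))
    (trans (cong (_* inv s) (*-identityˡ s)) (*-inv (0<⇒≢0 (0<toℚ-suc p))))
    where s = toℚ (ℤ.+ suc p)

  -- These zeros let the polynomial agree with the count of an empty simplex for slightly negative
  -- sizes.
  binom-neg : ∀ p n → n ℕ.< p → binom p (toℚ -[1+ n ]) ≡ 0ℚ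
  binom-neg (suc p) n n<1+p with n ℕ.≟ p
  ... | yes refl = trans (cong (λ a → binom p (toℚ -[1+ p ]) * a * inv (toℚ (ℤ.+ suc p)))
        (trans (cong (_+ toℚ (ℤ.+ suc p)) (toℚ-neg (ℤ.+ suc p))) (+-inverseˡ (toℚ (ℤ.+ suc p)))))
      (lem (binom p (toℚ -[1+ p ])) (inv (toℚ (ℤ.+ suc p))))
    where
    lem : ∀ a b → a * 0ℚ * b ≡ 0ℚ
    lem = solve-∀ ℚ-ring
  ... | no ne = trans (cong (λ a → a * (toℚ -[1+ n ] + toℚ (ℤ.+ suc p)) * inv (toℚ (ℤ.+ suc p)))
        (binom-neg p n (ℕₚ.≤∧≢⇒< (ℕₚ.≤-pred n<1+p) ne)))
      (lem (toℚ -[1+ n ] + toℚ (ℤ.+ suc p)) (inv (toℚ (ℤ.+ suc p))))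
    where
    lem : ∀ a b → 0ℚ * a * b ≡ 0ℚ
    lem = solve-∀ ℚ-ring

  incHead : ∀ {m} → Vec ℕ (suc m) → Vec ℕ (suc m)
  incHead (n ∷ v) = suc n ∷ v

  -- Vectors supported off the mask with entry sum at most `n`. The recursion, by whether the first
  -- free entry is zero, is the one behind Pascal's rule, so the length follows by induction.
  simplex : ∀ {m} → Mask m → ℕ → List (Vec ℕ m)
  simplex [] n = [] ∷ []
  simplex (true ∷ t) n = List.map (0 ∷_) (simplex t n)
  simplex (false ∷ t) zero = List.map (0 ∷_) (simplex t zero)
  simplex (false ∷ t) (suc n) = List.map (0 ∷_) (simplex t (suc n)) ++ List.map incHead (simplex (false ∷ t) n)

  codim : ∀ {m} → Mask m → ℕ
  codim [] = 0
  codim (true ∷ t) = codim t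
  codim (false ∷ t) = suc (codim t)

  ∈-simplex⁺ : ∀ {m} (t : Mask m) n q → (∀ j → lookup t j ≡ true → lookup q j ≡ 0) → Vec.sum q ℕ.≤ n → q ∈ simplex t n
  ∈-simplex⁺ [] n [] off le = here refl
  ∈-simplex⁺ (true ∷ t) n (a ∷ q) off le with off zero refl
  ... | refl = ∈-map⁺ (0 ∷_) (∈-simplex⁺ t n q (off ∘ suc) le)
  ∈-simplex⁺ (false ∷ t) zero (zero ∷ q) off le = ∈-map⁺ (0 ∷_) (∈-simplex⁺ t zero q (off ∘ suc) le)
  ∈-simplex⁺ (false ∷ t) (suc n) (zero ∷ q) off le = ∈-++⁺ˡ (∈-map⁺ (0 ∷_) (∈-simplex⁺ t (suc n) q (off ∘ suc) le))
  ∈-simplex⁺ (false ∷ t) (suc n) (suc a ∷ q) off le = ∈-++⁺ʳ (List.map (0 ∷_) (simplex t (suc n)))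
    (∈-map⁺ incHead (∈-simplex⁺ (false ∷ t) n (a ∷ q) (λ { zero () ; (suc j) → off (suc j) }) (ℕₚ.≤-pred le)))

  ∈-simplex⁻ : ∀ {m} (t : Mask m) n q → q ∈ simplex t n → (∀ j → lookup t j ≡ true → lookup q j ≡ 0) × Vec.sum q ℕ.≤ n
  ∈-simplex⁻ [] n [] _ = (λ ()) , ℕ.z≤n
  ∈-simplex⁻ (true ∷ t) n q q∈ with ∈-map⁻ (0 ∷_) q∈
  ... | q′ , q′∈ , refl = let (off , le) = ∈-simplex⁻ t n q′ q′∈ in (λ { zero _ → refl ; (suc j) → off j }) , le
  ∈-simplex⁻ {suc m} (false ∷ t) n q q∈ = step n q q∈
    where
    Spec : ℕ → Vec ℕ (suc m) → Set
    Spec n q = (∀ j → lookup (false ∷ t) j ≡ true → lookup q j ≡ 0) × Vec.sum q ℕ.≤ n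
    head0 : ∀ n q → q ∈ List.map (0 ∷_) (simplex t n) → Spec n q
    head0 n q q∈ with ∈-map⁻ (0 ∷_) q∈
    ... | q′ , q′∈ , refl = let (off , le) = ∈-simplex⁻ t n q′ q′∈ in (λ { zero () ; (suc j) → off j }) , le
    step : ∀ n q → q ∈ simplex (false ∷ t) n → Spec n q
    step zero q q∈ = head0 zero q q∈
    step (suc n) q q∈ with ∈-++⁻ (List.map (0 ∷_) (simplex t (suc n))) q∈
    ... | inj₁ q∈ˡ = head0 (suc n) q q∈ˡ
    ... | inj₂ q∈ʳ with ∈-map⁻ incHead q∈ʳ
    ...   | (a ∷ q′) , q′∈ , refl = let (off , le) = step n (a ∷ q′) q′∈ in
            (λ { zero () ; (suc j) → off (suc j) }) , ℕ.s≤s le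

  simplex-unique : ∀ {m} (t : Mask m) n → Unique (simplex t n)
  simplex-unique [] n = [] ∷ []
  simplex-unique (true ∷ t) n = Uniqueₚ.map⁺ Vecₚ.∷-injectiveʳ (simplex-unique t n)
  simplex-unique (false ∷ t) zero = Uniqueₚ.map⁺ Vecₚ.∷-injectiveʳ (simplex-unique t zero)
  simplex-unique (false ∷ t) (suc n) = Uniqueₚ.++⁺ (Uniqueₚ.map⁺ Vecₚ.∷-injectiveʳ (simplex-unique t (suc n)))
    (Uniqueₚ.map⁺ inc-injective (simplex-unique (false ∷ t) n)) disjoint
    where
    inc-injective : ∀ {v v′ : Vec ℕ _} → incHead v ≡ incHead v′ → v ≡ v′
    inc-injective {a ∷ v} {.a ∷ .v} refl = refl
    disjoint : ∀ {v} → ¬ (v ∈ List.map (0 ∷_) (simplex t (suc n)) × v ∈ List.map incHead (simplex (false ∷ t) n))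
    disjoint (p , q) with ∈-map⁻ (0 ∷_) p | ∈-map⁻ incHead q
    ... | _ , _ , refl | (a ∷ v) , _ , ()

  simplex-length : ∀ {m} (t : Mask m) n → toℚ (ℤ.+ length (simplex t n)) ≡ binom (codim t) (toℚ (ℤ.+ n))
  simplex-length [] n = refl
  simplex-length (true ∷ t) n = trans (cong (λ l → toℚ (ℤ.+ l)) (Listₚ.length-map (0 ∷_) (simplex t n))) (simplex-length t n)
  simplex-length (false ∷ t) zero = trans (cong (λ l → toℚ (ℤ.+ l)) (Listₚ.length-map (0 ∷_) (simplex t zero)))
    (trans (simplex-length t zero) (trans (binom-zero (codim t)) (sym (binom-zero (suc (codim t))))))
  simplex-length (false ∷ t) (suc n) = begin
    toℚ (ℤ.+ length (xs ++ ys)) ≡⟨ cong (λ l → toℚ (ℤ.+ l)) (Listₚ.length-++ xs) ⟩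
    toℚ (ℤ.+ (length xs ℕ.+ length ys)) ≡⟨ toℚ-+ (ℤ.+ length xs) (ℤ.+ length ys) ⟩
    toℚ (ℤ.+ length xs) + toℚ (ℤ.+ length ys)
      ≡⟨ cong₂ (λ a b → toℚ (ℤ.+ a) + toℚ (ℤ.+ b)) (Listₚ.length-map (0 ∷_) (simplex t (suc n))) (Listₚ.length-map incHead (simplex (false ∷ t) n)) ⟩
    toℚ (ℤ.+ length (simplex t (suc n))) + toℚ (ℤ.+ length (simplex (false ∷ t) n))
      ≡⟨ cong₂ _+_ (simplex-length t (suc n)) (simplex-length (false ∷ t) n) ⟩
    binom p (toℚ (ℤ.+ suc n)) + binom (suc p) (toℚ (ℤ.+ n))
      ≡⟨ cong (λ q → binom p (toℚ (ℤ.+ suc n)) + binom (suc p) q) (trans (lem (toℚ (ℤ.+ n))) (cong (_- 1ℚ) (sym (toℚ-suc n)))) ⟩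
    binom p (toℚ (ℤ.+ suc n)) + binom (suc p) (toℚ (ℤ.+ suc n) - 1ℚ) ≡⟨ sym (binom-pascal p (toℚ (ℤ.+ suc n))) ⟩
    binom (suc p) (toℚ (ℤ.+ suc n)) ∎
    where
    open ≡-Reasoning
    p = codim t
    xs = List.map (0 ∷_) (simplex t (suc n))
    ys = List.map incHead (simplex (false ∷ t) n)
    lem : ∀ a → a ≡ 1ℚ + a - 1ℚ
    lem = solve-∀ ℚ-ring

  simplexℤ : ∀ {m} → Mask m → ℤ → List (Vec ℕ m)
  simplexℤ t (ℤ.+ n) = simplex t n
  simplexℤ t -[1+ n ] = []

  simplexℤ-length : ∀ {m} (t : Mask m) n → - toℚ (ℤ.+ codim t) ≤ toℚ n → toℚ (ℤ.+ length (simplexℤ t n)) ≡ binom (codim t) (toℚ n)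
  simplexℤ-length t (ℤ.+ n) _ = simplex-length t n
  simplexℤ-length t -[1+ n ] h = sym (binom-neg (codim t) n (ℤₚ.drop‿+≤+ (toℚ-cancel {ℤ.+ suc n} {ℤ.+ codim t}
    (subst₂ _≤_ (trans (cong -_ (toℚ-neg (ℤ.+ suc n))) (lem (toℚ (ℤ.+ suc n)))) (lem (toℚ (ℤ.+ codim t))) (neg-antimono-≤ h)))))
    where
    lem : ∀ a → - (- a) ≡ a
    lem = solve-∀ ℚ-ring

  box : ∀ {m} → (Fin m → ℕ) → List (Vec ℕ m)
  box {zero} D = [] ∷ []
  box {suc m} D = List.cartesianProductWith _∷_ (List.upTo (D zero)) (box (D ∘ suc))

  ∈-box⁺ : ∀ {m} (D : Fin m → ℕ) s → (∀ j → lookup s j ℕ.< D j) → s ∈ box D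
  ∈-box⁺ D [] h = here refl
  ∈-box⁺ D (a ∷ s) h = ∈-cartesianProductWith⁺ _∷_ (∈-upTo⁺ (h zero)) (∈-box⁺ (D ∘ suc) s (h ∘ suc))

  ∈-box⁻ : ∀ {m} (D : Fin m → ℕ) s → s ∈ box D → ∀ j → lookup s j ℕ.< D j
  ∈-box⁻ {suc m} D s s∈ j with ∈-cartesianProductWith⁻ _∷_ (List.upTo (D zero)) (box (D ∘ suc)) s∈
  ∈-box⁻ {suc m} D s s∈ zero | a , s′ , a∈ , s′∈ , refl = ∈-upTo⁻ a∈
  ∈-box⁻ {suc m} D s s∈ (suc j) | a , s′ , a∈ , s′∈ , refl = ∈-box⁻ (D ∘ suc) s′ s′∈ j

  box-unique : ∀ {m} (D : Fin m → ℕ) → Unique (box D)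
  box-unique {zero} D = [] ∷ []
  box-unique {suc m} D = Uniqueₚ.cartesianProductWith⁺ _∷_ (λ { refl → refl , refl }) (Uniqueₚ.upTo⁺ (D zero)) (box-unique (D ∘ suc))

  sumL : ∀ {A : Set} → (A → ℚ) → List A → ℚ
  sumL f [] = 0ℚ
  sumL f (x ∷ xs) = f x + sumL f xs

  sumL-cong : ∀ {A : Set} {f h : A → ℚ} (xs : List A) → (∀ x → x ∈ xs → f x ≡ h x) → sumL f xs ≡ sumL h xs
  sumL-cong [] e = refl
  sumL-cong (x ∷ xs) e = cong₂ _+_ (e x (here refl)) (sumL-cong xs (λ y y∈ → e y (there y∈)))

  sumL-*ˡ : ∀ {A : Set} a (f : A → ℚ) xs → sumL (λ x → a * f x) xs ≡ a * sumL f xs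
  sumL-*ˡ a f [] = sym (*-zeroʳ a)
  sumL-*ˡ a f (x ∷ xs) = trans (cong (a * f x +_) (sumL-*ˡ a f xs)) (sym (*-distribˡ-+ a (f x) (sumL f xs)))

  sumL-Σᵐ : ∀ {A : Set} {m} (f : A → Mask m → ℚ) xs → sumL (λ x → Σᵐ (f x)) xs ≡ Σᵐ (λ t → sumL (λ x → f x t) xs)
  sumL-Σᵐ {m = m} f [] = sym (Σᵐ-0 {m} {λ _ → 0ℚ} (λ _ → refl))
  sumL-Σᵐ f (x ∷ xs) = trans (cong (Σᵐ (f x) +_) (sumL-Σᵐ f xs)) (add (f x) (λ t → sumL (λ x → f x t) xs))
    where
    add : ∀ {m} (f h : Mask m → ℚ) → Σᵐ f + Σᵐ h ≡ Σᵐ (λ t → f t + h t)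
    add {zero} f h = refl
    add {suc m} f h = trans (lem (Σᵐ (f ∘ (true ∷_))) (Σᵐ (f ∘ (false ∷_))) (Σᵐ (h ∘ (true ∷_))) (Σᵐ (h ∘ (false ∷_))))
      (cong₂ _+_ (add (f ∘ (true ∷_)) (h ∘ (true ∷_))) (add (f ∘ (false ∷_)) (h ∘ (false ∷_))))
      where
      lem : ∀ a b c d → a + b + (c + d) ≡ a + c + (b + d)
      lem = solve-∀ ℚ-ring

  sumL-𝟙 : ∀ {A : Set} {P : A → Set} (P? : ∀ x → Dec (P x)) xs → sumL (λ x → 𝟙 (P? x)) xs ≡ toℚ (ℤ.+ length (filter P? xs))
  sumL-𝟙 P? [] = refl
  sumL-𝟙 P? (x ∷ xs) with P? x
  ... | yes _ = trans (cong (1ℚ +_) (sumL-𝟙 P? xs)) (sym (toℚ-suc (length (filter P? xs))))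
  ... | no _ = trans (+-identityˡ (sumL (λ x → 𝟙 (P? x)) xs)) (sumL-𝟙 P? xs)

  length-⊆ : ∀ {A : Set} {xs ys : List A} → Unique xs → (∀ x → x ∈ xs → x ∈ ys) → length xs ℕ.≤ length ys
  length-⊆ [] h = ℕ.z≤n
  length-⊆ {xs = x ∷ xs} (x∉ ∷ u) h with ∈-∃++ (h x (here refl))
  ... | us , vs , refl = subst (suc (length xs) ℕ.≤_)
      (sym (trans (Listₚ.length-++ us) (trans (ℕₚ.+-suc (length us) (length vs)) (cong suc (sym (Listₚ.length-++ us))))))
      (ℕ.s≤s (length-⊆ u h′))
    where
    h′ : ∀ y → y ∈ xs → y ∈ us ++ vs
    h′ y y∈ with ∈-++⁻ us (h y (there y∈))
    ... | inj₁ y∈us = ∈-++⁺ˡ y∈us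
    ... | inj₂ (here refl) = ⊥-elim (All.lookup x∉ y∈ refl)
    ... | inj₂ (there y∈vs) = ∈-++⁺ʳ us y∈vs

  length-≡ : ∀ {A : Set} {xs ys : List A} → Unique xs → Unique ys → (∀ x → x ∈ xs → x ∈ ys) → (∀ x → x ∈ ys → x ∈ xs) →
    length xs ≡ length ys
  length-≡ u u′ h h′ = ℕₚ.≤-antisym (length-⊆ u h) (length-⊆ u′ h′)

  map-unique : ∀ {A B : Set} (f : A → B) {xs} → (∀ x x′ → x ∈ xs → x′ ∈ xs → f x ≡ f x′ → x ≡ x′) → Unique xs → Unique (List.map f xs)
  map-unique f inj [] = []
  map-unique f {x ∷ xs} inj (x∉ ∷ u) = Allₚ.map⁺ (All.tabulate (λ {y} y∈ e → All.lookup x∉ y∈ (inj x y (here refl) (there y∈) e)))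
    ∷ map-unique f (λ y y′ y∈ y′∈ → inj y y′ (there y∈) (there y′∈)) u

  pairs : ∀ {A B : Set} → (A → List B) → List A → List (A × B)
  pairs f = concatMap (λ a → List.map (a ,_) (f a))

  ∈-pairs⁺ : ∀ {A B : Set} (f : A → List B) {as a b} → a ∈ as → b ∈ f a → (a , b) ∈ pairs f as
  ∈-pairs⁺ f {as} a∈ b∈ = ∈-concatMap⁺ (λ a → List.map (a ,_) (f a)) {xs = as} (Any.map (λ { refl → ∈-map⁺ _ b∈ }) a∈)

  ∈-pairs⁻ : ∀ {A B : Set} (f : A → List B) as {a b} → (a , b) ∈ pairs f as → a ∈ as × b ∈ f a
  ∈-pairs⁻ f (a′ ∷ as) p with ∈-++⁻ (List.map (a′ ,_) (f a′)) p
  ... | inj₂ p′ = let (a∈ , b∈) = ∈-pairs⁻ f as p′ in there a∈ , b∈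
  ... | inj₁ p′ with ∈-map⁻ (a′ ,_) p′
  ...   | _ , b∈ , refl = here refl , b∈

  pairs-unique : ∀ {A B : Set} (f : A → List B) {as} → Unique as → (∀ a → Unique (f a)) → Unique (pairs f as)
  pairs-unique f [] uf = []
  pairs-unique f {a ∷ as} (a∉ ∷ u) uf = Uniqueₚ.++⁺ (Uniqueₚ.map⁺ (λ { refl → refl }) (uf a)) (pairs-unique f u uf) disjoint
    where
    disjoint : ∀ {v} → ¬ (v ∈ List.map (a ,_) (f a) × v ∈ pairs f as)
    disjoint {a′ , b} (p , q) with ∈-map⁻ (a ,_) p
    ... | _ , _ , refl = All.lookup a∉ (proj₁ (∈-pairs⁻ f as q)) refl

  pairs-length : ∀ {A B : Set} (f : A → List B) as → toℚ (ℤ.+ length (pairs f as)) ≡ sumL (λ a → toℚ (ℤ.+ length (f a))) as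
  pairs-length f [] = refl
  pairs-length f (a ∷ as) = trans (cong (λ l → toℚ (ℤ.+ l)) (Listₚ.length-++ (List.map (a ,_) (f a))))
    (trans (toℚ-+ (ℤ.+ length (List.map (a ,_) (f a))) (ℤ.+ length (pairs f as)))
      (cong₂ (λ l q → toℚ (ℤ.+ l) + q) (Listₚ.length-map (a ,_) (f a)) (pairs-length f as)))

  -- Quasi-polynomials

  Π-* : ∀ {n} (f h : Fin n → ℚ) → Πℚ (λ i → f i * h i) ≡ Πℚ f * Πℚ h
  Π-* {zero} f h = refl
  Π-* {suc n} f h = trans (cong (f zero * h zero *_) (Π-* (f ∘ suc) (h ∘ suc)))
    (lem (f zero) (h zero) (Πℚ (f ∘ suc)) (Πℚ (h ∘ suc)))
    where
    lem : ∀ a b c d → a * b * (c * d) ≡ a * c * (b * d)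
    lem = solve-∀ ℚ-ring

  powℚ-+ : ∀ q a b → powℚ q (a ℕ.+ b) ≡ powℚ q a * powℚ q b
  powℚ-+ q zero b = sym (*-identityˡ (powℚ q b))
  powℚ-+ q (suc a) b = trans (cong (q *_) (powℚ-+ q a b)) (sym (*-assoc q (powℚ q a) (powℚ q b)))

  module _ {k : ℕ} where

    monomial : ℚ → Vec ℕ k → Vecℤ k → ℚ
    monomial c e x = c * Πℚ (λ i → powℚ (toℚ (x i)) (lookup e i))

    mulMonomial : ℚ → Vec ℕ k → Poly k → Poly k
    mulMonomial c e = List.map (λ { (c′ , e′) → c * c′ , zipWith ℕ._+_ e e′ })

    mulPoly : Poly k → Poly k → Poly k
    mulPoly [] Q = []
    mulPoly ((c , e) ∷ P) Q = mulMonomial c e Q ++ mulPoly P Q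

    evalPoly-++ : ∀ P Q x → evalPoly (P ++ Q) x ≡ evalPoly P x + evalPoly Q x
    evalPoly-++ [] Q x = sym (+-identityˡ (evalPoly Q x))
    evalPoly-++ ((c , e) ∷ P) Q x = trans (cong (monomial c e x +_) (evalPoly-++ P Q x))
      (sym (+-assoc (monomial c e x) (evalPoly P x) (evalPoly Q x)))

    eval-mulMonomial : ∀ c e P x → evalPoly (mulMonomial c e P) x ≡ monomial c e x * evalPoly P x
    eval-mulMonomial c e [] x = sym (*-zeroʳ (monomial c e x))
    eval-mulMonomial c e ((c′ , e′) ∷ P) x = trans (cong₂ _+_ one (eval-mulMonomial c e P x))
        (sym (*-distribˡ-+ (monomial c e x) (monomial c′ e′ x) (evalPoly P x)))
      where
      π = λ (e : Vec ℕ k) → Πℚ (λ i → powℚ (toℚ (x i)) (lookup e i))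
      lem : ∀ a b c d → a * b * (c * d) ≡ a * c * (b * d)
      lem = solve-∀ ℚ-ring
      one : monomial (c * c′) (zipWith ℕ._+_ e e′) x ≡ monomial c e x * monomial c′ e′ x
      one = trans (cong (c * c′ *_) (trans (Π-cong (λ i → trans (cong (powℚ (toℚ (x i))) (Vecₚ.lookup-zipWith ℕ._+_ i e e′))
          (powℚ-+ (toℚ (x i)) (lookup e i) (lookup e′ i))))
          (Π-* (λ i → powℚ (toℚ (x i)) (lookup e i)) (λ i → powℚ (toℚ (x i)) (lookup e′ i)))))
        (lem c c′ (π e) (π e′))

    evalPoly-* : ∀ P Q x → evalPoly (mulPoly P Q) x ≡ evalPoly P x * evalPoly Q x
    evalPoly-* [] Q x = sym (*-zeroˡ (evalPoly Q x))
    evalPoly-* ((c , e) ∷ P) Q x = trans (evalPoly-++ (mulMonomial c e Q) (mulPoly P Q) x)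
      (trans (cong₂ _+_ (eval-mulMonomial c e Q x) (evalPoly-* P Q x))
        (sym (*-distribʳ-+ (evalPoly Q x) (monomial c e x) (evalPoly P x))))

    constPoly : ℚ → Poly k
    constPoly c = (c , replicate k 0) ∷ []

    eval-const : ∀ c x → evalPoly (constPoly c) x ≡ c
    eval-const c x = trans (+-identityʳ (monomial c (replicate k 0) x))
      (trans (cong (c *_) (Π-1 (λ i → cong (powℚ (toℚ (x i))) (Vecₚ.lookup-replicate i 0)))) (*-identityʳ c))

    Congruent : ℕ → Vecℤ k → Vecℤ k → Set
    Congruent N x r = ∀ i → (ℤ.+ suc N) ℤD.∣ (x i ℤ.- r i)

    qp-cong : {f h : Vecℤ k → ℚ} → (∀ x → f x ≡ h x) → IsQuasiPoly f → IsQuasiPoly h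
    qp-cong e (N , q) = N , λ r → let (P , eq) = q r in P , λ x c → trans (sym (e x)) (eq x c)

    qp-periodic : {f : Vecℤ k → ℚ} (N : ℕ) → (∀ x r → Congruent N x r → f x ≡ f r) → IsQuasiPoly f
    qp-periodic {f} N h = N , λ r → constPoly (f r) , λ x c → trans (h x r c) (sym (eval-const (f r) x))

    qp-const : ∀ c → IsQuasiPoly (λ _ → c)
    qp-const c = qp-periodic 0 (λ _ _ _ → refl)

    private
      combine : ℕ → ℕ → ℕ
      -- A modulus is stored by its predecessor; this makes the combined modulus exactly the
      -- product.
      combine N N′ = ℕ.pred (suc N ℕ.* suc N′)

      congˡ : ∀ N N′ {x r} → Congruent (combine N N′) x r → Congruent N x r
      congˡ N N′ c i = ℕD.∣-trans (ℕD.m∣m*n (suc N′)) (c i)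

      congʳ : ∀ N N′ {x r} → Congruent (combine N N′) x r → Congruent N′ x r
      congʳ N N′ c i = ℕD.∣-trans (ℕD.n∣m*n (suc N)) (c i)

    qp-+ : {f h : Vecℤ k → ℚ} → IsQuasiPoly f → IsQuasiPoly h → IsQuasiPoly (λ x → f x + h x)
    qp-+ (N , q) (N′ , q′) = combine N N′ , λ r → let (P , eq) = q r ; (P′ , eq′) = q′ r in
      P ++ P′ , λ x c → trans (cong₂ _+_ (eq x (congˡ N N′ {x} {r} c)) (eq′ x (congʳ N N′ {x} {r} c))) (sym (evalPoly-++ P P′ x))

    qp-* : {f h : Vecℤ k → ℚ} → IsQuasiPoly f → IsQuasiPoly h → IsQuasiPoly (λ x → f x * h x)
    qp-* (N , q) (N′ , q′) = combine N N′ , λ r → let (P , eq) = q r ; (P′ , eq′) = q′ r in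
      mulPoly P P′ , λ x c → trans (cong₂ _*_ (eq x (congˡ N N′ {x} {r} c)) (eq′ x (congʳ N N′ {x} {r} c))) (sym (evalPoly-* P P′ x))

    qp-Σ : ∀ {n} {f : Fin n → Vecℤ k → ℚ} → (∀ i → IsQuasiPoly (f i)) → IsQuasiPoly (λ x → Σℚ (λ i → f i x))
    qp-Σ {zero} h = qp-const 0ℚ
    qp-Σ {suc n} h = qp-+ (h zero) (qp-Σ (h ∘ suc))

    qp-Π : ∀ {n} {f : Fin n → Vecℤ k → ℚ} → (∀ i → IsQuasiPoly (f i)) → IsQuasiPoly (λ x → Πℚ (λ i → f i x))
    qp-Π {zero} h = qp-const 1ℚ
    qp-Π {suc n} h = qp-* (h zero) (qp-Π (h ∘ suc))

    qp-sumL : ∀ {A : Set} {f : A → Vecℤ k → ℚ} (as : List A) → (∀ a → IsQuasiPoly (f a)) → IsQuasiPoly (λ x → sumL (λ a → f a x) as)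
    qp-sumL [] h = qp-const 0ℚ
    qp-sumL (a ∷ as) h = qp-+ (h a) (qp-sumL as h)

    qp-Σᵐ : ∀ {m} {f : Mask m → Vecℤ k → ℚ} → (∀ t → IsQuasiPoly (f t)) → IsQuasiPoly (λ x → Σᵐ (λ t → f t x))
    qp-Σᵐ {zero} h = h []
    qp-Σᵐ {suc m} h = qp-+ (qp-Σᵐ (λ t → h (true ∷ t))) (qp-Σᵐ (λ t → h (false ∷ t)))

    vecℚ : Vecℤ k → Vecℚ k
    vecℚ x r = toℚ (x r)

    qp-coordinate : ∀ i → IsQuasiPoly (λ (x : Vecℤ k) → toℚ (x i))
    qp-coordinate i = 0 , λ r → ((1ℚ , replicate k 0 [ i ]≔ 1) ∷ []) , λ x _ → sym
        (trans (+-identityʳ (monomial 1ℚ (replicate k 0 [ i ]≔ 1) x)) (trans (*-identityˡ (Πℚ (power x))) (Π-single (power x) i (at x) (others x))))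
      where
      power : Vecℤ k → Fin k → ℚ
      power x j = powℚ (toℚ (x j)) (lookup (replicate k 0 [ i ]≔ 1) j)
      at : ∀ x → power x i ≡ toℚ (x i)
      at x = trans (cong (powℚ (toℚ (x i))) (Vecₚ.lookup∘update i (replicate k 0) 1)) (*-identityʳ (toℚ (x i)))
      others : ∀ x j → j ≢ i → power x j ≡ 1ℚ
      others x j ne = cong (powℚ (toℚ (x j))) (trans (Vecₚ.lookup∘update′ ne (replicate k 0) 1) (Vecₚ.lookup-replicate j 0))
      Π-single : ∀ {n} (f : Fin n → ℚ) i {q} → f i ≡ q → (∀ j → j ≢ i → f j ≡ 1ℚ) → Πℚ f ≡ q
      Π-single f zero e o = trans (cong₂ _*_ e (Π-1 (λ j → o (suc j) (λ ())))) (*-identityʳ _)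
      Π-single f (suc i) {q} e o = trans (cong₂ _*_ (o zero (λ ())) (Π-single (f ∘ suc) i e (λ j ne → o (suc j) (λ { refl → ne refl })))) (*-identityˡ q)

    qp-affine : ∀ (a : Vecℚ k) c → IsQuasiPoly (λ x → a · vecℚ x + c)
    qp-affine a c = qp-+ (qp-Σ (λ i → qp-* (qp-const (a i)) (qp-coordinate i))) (qp-const c)

    -- A common denominator of the coefficients serves as the modulus.
    affine-period : ∀ (a : Vecℚ k) → Σ ℕ λ N → ∀ x r → Congruent N x r → Integral (a · vecℚ x - a · vecℚ r)
    affine-period a with commonDenominator (List.tabulate a)
    ... | N , h = N , λ x r c → subst Integral
        (trans (Σ-cong (λ i → lem (a i) (toℚ (x i)) (toℚ (r i)))) (Σ-- (λ i → a i * toℚ (x i)) (λ i → a i * toℚ (r i))))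
        (integral-Σ (λ i → one i (x i) (r i) (c i)))
      where
      lem : ∀ a x r → a * (x - r) ≡ a * x - a * r
      lem = solve-∀ ℚ-ring
      one : ∀ i x r → (ℤ.+ suc N) ℤD.∣ (x ℤ.- r) → Integral (a i * (toℚ x - toℚ r))
      one i x r d = step (ℤDS.∣ᵤ⇒∣ d)
        where
        lem₂ : ∀ a q n → a * (q * n) ≡ q * (n * a)
        lem₂ = solve-∀ ℚ-ring
        step : (ℤ.+ suc N) ℤDS.∣ (x ℤ.- r) → Integral (a i * (toℚ x - toℚ r))
        step (ℤDS.divides q e) = subst Integral
          (sym (trans (cong (a i *_) (trans (sym (toℚ-- x r)) (trans (cong toℚ e) (toℚ-* q (ℤ.+ suc N)))))
            (lem₂ (a i) (toℚ q) (toℚ (ℤ.+ suc N)))))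
          (integral-* (q , refl) (h (a i) (∈-tabulate⁺ i)))

    private
      shift : ∀ (a : Vecℚ k) c x r → a · vecℚ x + c ≡ (a · vecℚ r + c) + (a · vecℚ x - a · vecℚ r)
      shift a c x r = lem (a · vecℚ x) (a · vecℚ r) c
        where
        lem : ∀ x r c → x + c ≡ (r + c) + (x - r)
        lem = solve-∀ ℚ-ring

    -- The floor differs from its argument by a quantity that is unchanged under integral shifts, so
    -- it is an affine function plus a periodic one.
    qp-floor : ∀ (a : Vecℚ k) c → IsQuasiPoly (λ x → toℚ (floor (a · vecℚ x + c)))
    qp-floor a c = qp-cong (λ x → lem (a · vecℚ x + c) (toℚ (floor (a · vecℚ x + c))))
        (qp-+ (qp-affine a c) (qp-periodic (proj₁ per) periodic))
      where
      per = affine-period a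
      lem : ∀ v f → v + (f - v) ≡ f
      lem = solve-∀ ℚ-ring
      lem₂ : ∀ f n v → f + n - (v + n) ≡ f - v
      lem₂ = solve-∀ ℚ-ring
      periodic : ∀ x r → Congruent (proj₁ per) x r →
        toℚ (floor (a · vecℚ x + c)) - (a · vecℚ x + c) ≡ toℚ (floor (a · vecℚ r + c)) - (a · vecℚ r + c)
      periodic x r cong-xr = step (proj₂ per x r cong-xr)
       where
       step : Integral (a · vecℚ x - a · vecℚ r) →
         toℚ (floor (a · vecℚ x + c)) - (a · vecℚ x + c) ≡ toℚ (floor (a · vecℚ r + c)) - (a · vecℚ r + c)
       step (n , e) = trans (cong (λ q → toℚ (floor q) - q) (trans (shift a c x r) (cong (a · vecℚ r + c +_) e)))
        (trans (cong (_- (a · vecℚ r + c + toℚ n)) (trans (cong toℚ (floor-shift (a · vecℚ r + c) n)) (toℚ-+ (floor (a · vecℚ r + c)) n)))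
          (lem₂ (toℚ (floor (a · vecℚ r + c))) (toℚ n) (a · vecℚ r + c)))

    qp-integral : ∀ (a : Vecℚ k) c → IsQuasiPoly (λ x → 𝟙 (integral? (a · vecℚ x + c)))
    qp-integral a c = qp-periodic (proj₁ per) λ x r cong-xr →
        𝟙-⇔ (integral? (a · vecℚ x + c)) (integral? (a · vecℚ r + c))
          (λ h → subst Integral (sym (back x r)) (integral-+ h (integral-neg (proj₂ per x r cong-xr))))
          (λ h → subst Integral (sym (shift a c x r)) (integral-+ h (proj₂ per x r cong-xr)))
      where
      per = affine-period a
      back : ∀ x r → a · vecℚ r + c ≡ (a · vecℚ x + c) + - (a · vecℚ x - a · vecℚ r)
      back x r = lem (a · vecℚ x) (a · vecℚ r) c
        where
        lem : ∀ x r c → r + c ≡ (x + c) + - (x - r)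
        lem = solve-∀ ℚ-ring

    qp-binom : ∀ p {f : Vecℤ k → ℚ} → IsQuasiPoly f → IsQuasiPoly (λ x → binom p (f x))
    qp-binom zero q = qp-const 1ℚ
    qp-binom (suc p) q = qp-* (qp-* (qp-binom p q) (qp-+ q (qp-const (toℚ (ℤ.+ suc p))))) (qp-const (inv (toℚ (ℤ.+ suc p))))

  -- Counting in one polarised cone

  Σ-offᵐ : ∀ {m} (t : Mask m) q → Σℚ (λ j → offᵐ t j q) ≡ toℚ (ℤ.+ codim t) * q
  Σ-offᵐ [] q = sym (*-zeroˡ q)
  Σ-offᵐ (b ∷ t) q = go b
    where
    tail : ∀ b → Σℚ (λ j → offᵐ (b ∷ t) (suc j) q) ≡ toℚ (ℤ.+ codim t) * q
    tail b = trans (Σ-cong eq) (Σ-offᵐ t q)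
      where
      eq : ∀ j → offᵐ (b ∷ t) (suc j) q ≡ offᵐ t j q
      eq j with lookup t j
      ... | true = refl
      ... | false = refl
    go : ∀ b → Σℚ (λ j → offᵐ (b ∷ t) j q) ≡ toℚ (ℤ.+ codim (b ∷ t)) * q
    go true = trans (cong (0ℚ +_) (tail true)) (+-identityˡ (toℚ (ℤ.+ codim t) * q))
    go false = trans (cong (q +_) (tail false)) (trans (lem q (toℚ (ℤ.+ codim t))) (cong (_* q) (sym (toℚ-suc (codim t)))))
      where
      lem : ∀ q c → q + c * q ≡ (1ℚ + c) * q
      lem = solve-∀ ℚ-ring

  toℚ-sum : ∀ {m} (q : Vec ℕ m) → toℚ (ℤ.+ Vec.sum q) ≡ Σℚ (λ j → toℚ (ℤ.+ lookup q j))
  toℚ-sum [] = refl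
  toℚ-sum (a ∷ q) = trans (toℚ-+ (ℤ.+ a) (ℤ.+ Vec.sum q)) (cong (toℚ (ℤ.+ a) +_) (toℚ-sum q))

  ∈-simplexℤ⁺ : ∀ {m} (t : Mask m) n q → (∀ j → lookup t j ≡ true → lookup q j ≡ 0) → ℤ.+ Vec.sum q ℤ.≤ n → q ∈ simplexℤ t n
  ∈-simplexℤ⁺ t (ℤ.+ n) q off (ℤ.+≤+ le) = ∈-simplex⁺ t n q off le

  ∈-simplexℤ⁻ : ∀ {m} (t : Mask m) n q → q ∈ simplexℤ t n → (∀ j → lookup t j ≡ true → lookup q j ≡ 0) × ℤ.+ Vec.sum q ℤ.≤ n
  ∈-simplexℤ⁻ t (ℤ.+ n) q q∈ = let (off , le) = ∈-simplex⁻ t n q q∈ in off , ℤ.+≤+ le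

  simplexℤ-unique : ∀ {m} (t : Mask m) n → Unique (simplexℤ t n)
  simplexℤ-unique t (ℤ.+ n) = simplex-unique t n
  simplexℤ-unique t -[1+ n ] = []

  0≤toℚ⇒ : ∀ z → 0ℚ ≤ toℚ z → ∃ λ n → z ≡ ℤ.+ n
  0≤toℚ⇒ (ℤ.+ n) _ = n , refl
  0≤toℚ⇒ -[1+ n ] h = ⊥-elim (<⇒≱ (subst (_< 0ℚ) (sym (toℚ-neg (ℤ.+ suc n))) (neg-antimono-< (0<toℚ-suc n))) h)

  toℚ<0⇒ : ∀ z → toℚ z < 0ℚ → ∃ λ n → z ≡ -[1+ n ]
  toℚ<0⇒ (ℤ.+ n) h = ⊥-elim (<⇒≱ h (0≤toℚ n))
  toℚ<0⇒ -[1+ n ] _ = n , refl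

  digits-unique : ∀ D s q s′ q′ → s ℕ.< D → s′ ℕ.< D → s ℕ.+ D ℕ.* q ≡ s′ ℕ.+ D ℕ.* q′ → s ≡ s′ × q ≡ q′
  digits-unique (suc D) s q s′ q′ h h′ e = s≡ , ℕₚ.*-cancelˡ-≡ q q′ (suc D)
      (ℕₚ.+-cancelˡ-≡ s (suc D ℕ.* q) (suc D ℕ.* q′) (trans e (cong (ℕ._+ suc D ℕ.* q′) (sym s≡))))
    where
    rem : ∀ s q → s ℕ.< suc D → (s ℕ.+ suc D ℕ.* q) ℕ.% suc D ≡ s
    rem s q h = trans (cong (λ x → (s ℕ.+ x) ℕ.% suc D) (ℕₚ.*-comm (suc D) q)) (trans (ℕDM.[m+kn]%n≡m%n s q (suc D)) (ℕDM.m<n⇒m%n≡m h))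
    s≡ : s ≡ s′
    s≡ = trans (sym (rem s q h)) (trans (cong (ℕ._% suc D) e) (rem s′ q′ h′))

  Π-zero : ∀ {n} (f : Fin n → ℚ) i → f i ≡ 0ℚ → Πℚ f ≡ 0ℚ
  Π-zero f zero e = trans (cong (_* Πℚ (f ∘ suc)) e) (*-zeroˡ (Πℚ (f ∘ suc)))
  Π-zero f (suc i) e = trans (cong (f zero *_) (Π-zero (f ∘ suc) i e)) (*-zeroʳ (f zero))

  -- Integer points x with B x = y in the polarised cone of the basis β, truncated by e · x ≥ 0.
  module Count {m k} (g : Fin m → Vecℚ k) (e : Fin m → ℚ) (0<e : ∀ j → 0ℚ < e j)
    (nondeg : Identity.NonDegenerate g e) {t : Mask m} (β : Bases.Basis g t) where

    open Chambers g
    open Identity g e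

    -- The direction of the polarised cone in each nonbasic coordinate, and the absolute value of
    -- the slack.
    η a : Fin m → ℚ
    η j = sgn (slack β j)
    a j = η j * slack β j

    -- The polarised cone is half-open: a reversed coordinate must be strictly negative, so for
    -- integers it starts at -1, whereas the others start at 0.
    o : Fin m → ℕ
    o j with slack β j <? 0ℚ
    ... | yes _ = 1
    ... | no _ = 0

    o-neg : ∀ {j} → slack β j < 0ℚ → o j ≡ 1
    o-neg {j} h with slack β j <? 0ℚ
    ... | yes _ = refl
    ... | no ¬h = ⊥-elim (¬h h)

    o-nonNeg : ∀ {j} → ¬ slack β j < 0ℚ → o j ≡ 0
    o-nonNeg {j} h with slack β j <? 0ℚ
    ... | yes p = ⊥-elim (h p)
    ... | no _ = refl

    o≤1 : ∀ j → o j ℕ.≤ 1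
    o≤1 j with slack β j <? 0ℚ
    ... | yes _ = ℕₚ.≤-refl
    ... | no _ = ℕ.z≤n

    slack≢0 : ∀ {j} → lookup t j ≡ false → slack β j ≢ 0ℚ
    slack≢0 h e = nondeg β _ h (p-q≡0⇒p≡q e)

    η-on : ∀ {j} → lookup t j ≡ true → η j ≡ 0ℚ
    η-on {j} h = sgn-0 (slack-on β j h)

    a-on : ∀ {j} → lookup t j ≡ true → a j ≡ 0ℚ
    a-on {j} h = trans (cong (_* slack β j) (η-on h)) (*-zeroˡ (slack β j))

    a-off : ∀ {j} → lookup t j ≡ false → 0ℚ < a j
    a-off {j} h = go (<-cmp (slack β j) 0ℚ)
      where
      lem : ∀ q → - q ≡ - 1ℚ * q
      lem = solve-∀ ℚ-ring
      go : _ → 0ℚ < a j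
      go (tri< p _ _) = subst (0ℚ <_) (trans (lem (slack β j)) (cong (_* slack β j) (sym (sgn-neg p)))) (0<-p p)
      go (tri≈ _ p _) = ⊥-elim (slack≢0 h p)
      go (tri> _ _ p) = subst (0ℚ <_) (trans (sym (*-identityˡ (slack β j))) (cong (_* slack β j) (sym (sgn-pos p)))) p

    0≤a : ∀ j → 0ℚ ≤ a j
    0≤a j = by-mask (lookup t j) (λ h → ≤-reflexive (sym (a-on h))) (λ h → <⇒≤ (a-off h))

    η-integral : ∀ j → Integral (η j)
    η-integral j with <-cmp (slack β j) 0ℚ
    ... | tri< _ _ _ = -[1+ 0 ] , refl
    ... | tri≈ _ _ _ = ℤ.+ 0 , refl
    ... | tri> _ _ _ = ℤ.+ 1 , refl

    private
      den₁ = commonDenominator (List.tabulate (λ j → inv (a j)))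
      den₂ = commonDenominator (List.concat (List.tabulate (λ l → List.tabulate (λ j → W β l · g j))))
      M₁ = toℚ (ℤ.+ suc (proj₁ den₁))
      M₂ = toℚ (ℤ.+ suc (proj₁ den₂))

    -- The moduli `D j` are chosen with `a j * D j` equal to `Ω` for all nonbasic `j`. One full step
    -- in any nonbasic direction then costs the same, and truncation by the cost cuts out a standard
    -- simplex in the quotients. The factor `M₂` makes such a step change all coordinates by
    -- integers.
    Ω : ℚ
    Ω = M₁ * M₂

    0<Ω : 0ℚ < Ω
    0<Ω = 0<p*q (0<toℚ-suc (proj₁ den₁)) (0<toℚ-suc (proj₁ den₂))

    private
      Modulus : Fin m → ℕ → Set
      Modulus j D = 0 ℕ.< D × (lookup t j ≡ true → D ≡ 1)
        × (lookup t j ≡ false → a j * toℚ (ℤ.+ D) ≡ Ω × (∀ l → Integral (toℚ (ℤ.+ D) * (W β l · g j))))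

      modulus : ∀ j → Σ ℕ (Modulus j)
      modulus j = pick (true∨false (lookup t j))
       where
       modulus-off : lookup t j ≡ false → Σ ℕ (Modulus j)
       modulus-off h = go (proj₂ den₁ (inv (a j)) (∈-tabulate⁺ j))
        where
        aⱼ≢0 = 0<⇒≢0 (a-off h)
        go : Integral (M₁ * inv (a j)) → Σ ℕ (Modulus j)
        go (ℤ.+ zero , eq) = ⊥-elim (0<⇒≢0 (0<p*q (0<toℚ-suc (proj₁ den₁)) (0<inv (a-off h))) eq)
        go (-[1+ n ] , eq) = ⊥-elim (<-asym (0<p*q (0<toℚ-suc (proj₁ den₁)) (0<inv (a-off h)))
          (subst (_< 0ℚ) (sym (trans eq (toℚ-neg (ℤ.+ suc n)))) (neg-antimono-< (0<toℚ-suc n))))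
        go (ℤ.+ suc n , eq) = suc n ℕ.* suc (proj₁ den₂) , ℕ.s≤s ℕ.z≤n , (λ h′ → ⊥-elim (true≢false h′ h)) , λ _ → scaled , int
          where
          D≡ : toℚ (ℤ.+ (suc n ℕ.* suc (proj₁ den₂))) ≡ toℚ (ℤ.+ suc n) * M₂
          D≡ = trans (cong toℚ (ℤₚ.pos-* (suc n) (suc (proj₁ den₂)))) (toℚ-* (ℤ.+ suc n) (ℤ.+ suc (proj₁ den₂)))
          lem : ∀ a m i p → a * (m * i * p) ≡ a * i * (m * p)
          lem = solve-∀ ℚ-ring
          scaled : a j * toℚ (ℤ.+ (suc n ℕ.* suc (proj₁ den₂))) ≡ Ω
          scaled = trans (cong (a j *_) (trans D≡ (cong (_* M₂) (sym eq)))) (trans (lem (a j) M₁ (inv (a j)) M₂)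
            (trans (cong (_* (M₁ * M₂)) (*-inv aⱼ≢0)) (*-identityˡ (M₁ * M₂))))
          int : ∀ l → Integral (toℚ (ℤ.+ (suc n ℕ.* suc (proj₁ den₂))) * (W β l · g j))
          int l = subst Integral (sym (trans (cong (_* (W β l · g j)) D≡) (*-assoc (toℚ (ℤ.+ suc n)) M₂ (W β l · g j))))
            (integral-* (ℤ.+ suc n , refl) (proj₂ den₂ (W β l · g j)
              (∈-concat⁺′ (∈-tabulate⁺ j) (∈-tabulate⁺ {f = λ l → List.tabulate (λ j → W β l · g j)} l))))

       pick : lookup t j ≡ true ⊎ lookup t j ≡ false → Σ ℕ (Modulus j)
       pick (inj₁ h) = 1 , ℕ.s≤s ℕ.z≤n , (λ _ → refl) , λ h′ → ⊥-elim (true≢false h h′)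
       pick (inj₂ h) = modulus-off h

    abstract
      D : Fin m → ℕ
      D j = proj₁ (modulus j)

      D-pos : ∀ j → 0 ℕ.< D j
      D-pos j = proj₁ (proj₂ (modulus j))

      D-on : ∀ {j} → lookup t j ≡ true → D j ≡ 1
      D-on {j} = proj₁ (proj₂ (proj₂ (modulus j)))

      D-off : ∀ {j} → lookup t j ≡ false → a j * toℚ (ℤ.+ D j) ≡ Ω
      D-off {j} h = proj₁ (proj₂ (proj₂ (proj₂ (modulus j))) h)

      D-integral : ∀ {j} → lookup t j ≡ false → ∀ l → Integral (toℚ (ℤ.+ D j) * (W β l · g j))
      D-integral {j} h = proj₂ (proj₂ (proj₂ (proj₂ (modulus j))) h)

    nonBasic : (Fin m → ℕ) → Fin m → ℚ
    nonBasic n j = η j * toℚ (ℤ.+ (n j ℕ.+ o j))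

    -- The nonbasic coordinates are prescribed, and the basis absorbs what remains of `y`.
    full : Vecℚ k → (Fin m → ℕ) → Fin m → ℚ
    full y n l = nonBasic n l + W β l · (λ r → y r - lin g (nonBasic n) r)

    full-lin : ∀ y n r → lin g (full y n) r ≡ y r
    full-lin y n r = trans (lin-+ g (nonBasic n) (λ l → W β l · v) r)
        (trans (cong (lin g (nonBasic n) r +_) (sym (expand β v r))) (lem (lin g (nonBasic n) r) (y r)))
      where
      v : Vecℚ k
      v r = y r - lin g (nonBasic n) r
      lem : ∀ a b → a + (b - a) ≡ b
      lem = solve-∀ ℚ-ring

    full-off : ∀ y n {l} → lookup t l ≡ false → full y n l ≡ nonBasic n l
    full-off y n {l} h = trans (cong (nonBasic n l +_) (W-off· β h (λ r → y r - lin g (nonBasic n) r))) (+-identityʳ (nonBasic n l))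

    full-unique : ∀ y n x → (∀ r → lin g x r ≡ y r) → (∀ {j} → lookup t j ≡ false → x j ≡ nonBasic n j) → ∀ l → x l ≡ full y n l
    full-unique y n x x-lin off l = sym (trans (cong (nonBasic n l +_)
        (coord β (λ r → y r - lin g (nonBasic n) r) (λ j → x j - nonBasic n j) (λ j h → p≡q⇒p-q≡0 (off h))
          (λ r → sym (trans (lin-- g x (nonBasic n) r) (cong (_- lin g (nonBasic n) r) (x-lin r)))) l))
        (lem (nonBasic n l) (x l)))
      where
      lem : ∀ a b → a + (b - a) ≡ b
      lem = solve-∀ ℚ-ring

    nonBasic-pos : ∀ n {j} → 0ℚ < slack β j → nonBasic n j ≡ toℚ (ℤ.+ n j)
    nonBasic-pos n {j} h = trans (cong₂ (λ s c → s * toℚ (ℤ.+ (n j ℕ.+ c))) (sgn-pos h) (o-nonNeg (<-asym h)))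
      (trans (*-identityˡ (toℚ (ℤ.+ (n j ℕ.+ 0)))) (cong (λ c → toℚ (ℤ.+ c)) (ℕₚ.+-identityʳ (n j))))

    nonBasic-neg : ∀ n {j} → slack β j < 0ℚ → nonBasic n j ≡ toℚ -[1+ n j ]
    nonBasic-neg n {j} h = trans (cong₂ (λ s c → s * toℚ (ℤ.+ (n j ℕ.+ c))) (sgn-neg h) (o-neg h))
      (trans (lem (toℚ (ℤ.+ (n j ℕ.+ 1)))) (trans (cong (λ c → - toℚ (ℤ.+ c)) (ℕₚ.+-comm (n j) 1)) (sym (toℚ-neg (ℤ.+ suc (n j))))))
      where
      lem : ∀ a → - 1ℚ * a ≡ - a
      lem = solve-∀ ℚ-ring

    vertex-signs : ∀ σ → (∀ j → σ j ≡ 1ℚ ⊎ σ j ≡ - 1ℚ) → Vertex σ β → ∀ {j} → lookup t j ≡ false → σ j ≡ η j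
    vertex-signs σ ± V {j} h = go (± j) (<-cmp (slack β j) 0ℚ)
      where
      lem : ∀ a → - 1ℚ * a ≡ - a
      lem = solve-∀ ℚ-ring
      go : σ j ≡ 1ℚ ⊎ σ j ≡ - 1ℚ → _ → σ j ≡ η j
      go _ (tri≈ _ p _) = ⊥-elim (slack≢0 h p)
      go (inj₁ s) (tri< p _ _) = ⊥-elim (<⇒≱ p (subst (0ℚ ≤_) (trans (cong (_* slack β j) s) (*-identityˡ (slack β j))) (V j)))
      go (inj₂ s) (tri< p _ _) = trans s (sym (sgn-neg p))
      go (inj₁ s) (tri> _ _ p) = trans s (sym (sgn-pos p))
      go (inj₂ s) (tri> _ _ p) = ⊥-elim (<⇒≱ (neg-antimono-< p)
        (subst (0ℚ ≤_) (trans (cong (_* slack β j) s) (lem (slack β j))) (V j)))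

    full-vertex : ∀ y n → Vertex (signs (full y n)) β
    full-vertex y n j = by-mask (lookup t j)
        (λ h → ≤-reflexive (sym (trans (cong (signs (full y n) j *_) (slack-on β j h)) (*-zeroʳ (signs (full y n) j)))))
        (λ h → off h (<-cmp (slack β j) 0ℚ))
      where
      lem : ∀ a → - a ≡ - 1ℚ * a
      lem = solve-∀ ℚ-ring
      off : lookup t j ≡ false → _ → 0ℚ ≤ signs (full y n) j * slack β j
      off h (tri≈ _ p _) = ⊥-elim (slack≢0 h p)
      off h (tri> _ _ p) = subst (0ℚ ≤_) (trans (sym (*-identityˡ (slack β j)))
        (cong (_* slack β j) (sym (signs-nonNeg (full y n) j
          (subst (0ℚ ≤_) (sym (trans (full-off y n h) (nonBasic-pos n p))) (0≤toℚ (n j))))))) (<⇒≤ p)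
      off h (tri< p _ _) = subst (0ℚ ≤_) (trans (lem (slack β j))
        (cong (_* slack β j) (sym (signs-neg (full y n) j
          (subst (_< 0ℚ) (sym (trans (full-off y n h) (trans (nonBasic-neg n p) (toℚ-neg (ℤ.+ suc (n j))))))
            (neg-antimono-< (0<toℚ-suc (n j)))))))) (<⇒≤ (0<-p p))

    offset : (Fin m → ℤ) → Fin m → ℕ
    offset x j with lookup t j
    ... | true = 0
    ... | false = ℤ.∣ x j ∣ ℕ.∸ o j

    offset-on : ∀ x {j} → lookup t j ≡ true → offset x j ≡ 0
    offset-on x {j} h with lookup t j
    ... | true = refl
    offset-on x () | false

    offset-off : ∀ x {j} → lookup t j ≡ false → offset x j ≡ ℤ.∣ x j ∣ ℕ.∸ o j
    offset-off x {j} h with lookup t j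
    ... | false = refl
    offset-off x () | true

    vertex⇒full : ∀ y (x : Fin m → ℤ) → (∀ r → lin g (toℚ ∘ x) r ≡ y r) → Vertex (signs (toℚ ∘ x)) β →
      ∀ l → toℚ (x l) ≡ full y (offset x) l
    vertex⇒full y x x-lin V = full-unique y (offset x) (toℚ ∘ x) x-lin off
      where
      σ = signs (toℚ ∘ x)
      off : ∀ {j} → lookup t j ≡ false → toℚ (x j) ≡ nonBasic (offset x) j
      off {j} h = go (<-cmp (slack β j) 0ℚ)
        where
        s≡η = vertex-signs σ (signs-± (toℚ ∘ x)) V h
        nonneg : σ j ≡ 1ℚ → ∃ λ n → x j ≡ ℤ.+ n
        nonneg s = 0≤toℚ⇒ (x j) (≮⇒≥ (λ lt → 1≢-1 (trans (sym s) (signs-neg (toℚ ∘ x) j lt))))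
        negative′ : σ j ≡ - 1ℚ → ∃ λ n → x j ≡ -[1+ n ]
        negative′ s = toℚ<0⇒ (x j) (≰⇒> (λ le → 1≢-1 (trans (sym (signs-nonNeg (toℚ ∘ x) j le)) s)))
        go : _ → toℚ (x j) ≡ nonBasic (offset x) j
        go (tri≈ _ p _) = ⊥-elim (slack≢0 h p)
        go (tri> _ _ p) = let (n , e) = nonneg (trans s≡η (sgn-pos p)) in
          trans (cong toℚ e) (sym (trans (nonBasic-pos (offset x) p)
            (cong (λ c → toℚ (ℤ.+ c)) (trans (offset-off x h) (cong₂ (λ z c → ℤ.∣ z ∣ ℕ.∸ c) e (o-nonNeg (<-asym p)))))))
        go (tri< p _ _) = let (n , e) = negative′ (trans s≡η (sgn-neg p)) in
          trans (cong toℚ e) (sym (trans (nonBasic-neg (offset x) p)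
            (cong (λ c → toℚ -[1+ c ]) (trans (offset-off x h) (cong₂ (λ z c → ℤ.∣ z ∣ ℕ.∸ c) e (o-neg p))))))

    u : Vecℚ k
    u = dualPoint β e

    weight : (Fin m → ℕ) → ℚ
    weight n = Σℚ (λ j → a j * toℚ (ℤ.+ (n j ℕ.+ o j)))

    -- Polarisation makes each product of a coordinate with its slack equal to `a j` times a natural
    -- number. Thus the cost is at most `u · y` on the polarised cone, and only finitely many points
    -- have nonnegative cost.
    cost-full : ∀ y n → Σℚ (λ j → e j * full y n j) ≡ u · y - weight n
    cost-full y n = begin
      Σℚ (λ j → e j * full y n j) ≡⟨ Σ-cong (λ j → lem (e j) (full y n j) (u · g j)) ⟩
      Σℚ (λ j → full y n j * (u · g j) - full y n j * slack β j)
        ≡⟨ Σ-- (λ j → full y n j * (u · g j)) (λ j → full y n j * slack β j) ⟩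
      Σℚ (λ j → full y n j * (u · g j)) - Σℚ (λ j → full y n j * slack β j)
        ≡⟨ cong₂ _-_ (trans (sym (·-lin u g (full y n))) (·-congʳ u (full-lin y n))) (Σ-cong row) ⟩
      u · y - weight n ∎
      where
      open ≡-Reasoning
      lem : ∀ e x u → e * x ≡ x * u - x * (u - e)
      lem = solve-∀ ℚ-ring
      lem₂ : ∀ η n s → η * n * s ≡ η * s * n
      lem₂ = solve-∀ ℚ-ring
      row : ∀ j → full y n j * slack β j ≡ a j * toℚ (ℤ.+ (n j ℕ.+ o j))
      row j = by-mask (lookup t j)
        (λ h → trans (cong (full y n j *_) (slack-on β j h)) (trans (*-zeroʳ (full y n j))
          (sym (trans (cong (_* toℚ (ℤ.+ (n j ℕ.+ o j))) (a-on h)) (*-zeroˡ (toℚ (ℤ.+ (n j ℕ.+ o j))))))))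
        (λ h → trans (cong (_* slack β j) (full-off y n h)) (lem₂ (η j) (toℚ (ℤ.+ (n j ℕ.+ o j))) (slack β j)))

    compose : Vec ℕ m → Vec ℕ m → Fin m → ℕ
    compose s q j = lookup s j ℕ.+ D j ℕ.* lookup q j

    private
      toℚ-compose : ∀ s q j → toℚ (ℤ.+ (compose s q j ℕ.+ o j)) ≡ toℚ (ℤ.+ (lookup s j ℕ.+ o j)) + toℚ (ℤ.+ D j) * toℚ (ℤ.+ lookup q j)
      toℚ-compose s q j = begin
        toℚ (ℤ.+ (compose s q j ℕ.+ o j)) ≡⟨ toℚ-+ (ℤ.+ compose s q j) (ℤ.+ o j) ⟩
        toℚ (ℤ.+ compose s q j) + O ≡⟨ cong (_+ O) (toℚ-+ (ℤ.+ lookup s j) (ℤ.+ (D j ℕ.* lookup q j))) ⟩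
        S + toℚ (ℤ.+ (D j ℕ.* lookup q j)) + O
          ≡⟨ cong (λ z → S + z + O) (trans (cong toℚ (ℤₚ.pos-* (D j) (lookup q j))) (toℚ-* (ℤ.+ D j) (ℤ.+ lookup q j))) ⟩
        S + DQ + O ≡⟨ lem S DQ O ⟩
        S + O + DQ ≡⟨ cong (_+ DQ) (sym (toℚ-+ (ℤ.+ lookup s j) (ℤ.+ o j))) ⟩
        toℚ (ℤ.+ (lookup s j ℕ.+ o j)) + DQ ∎
        where
        open ≡-Reasoning
        S = toℚ (ℤ.+ lookup s j)
        O = toℚ (ℤ.+ o j)
        DQ = toℚ (ℤ.+ D j) * toℚ (ℤ.+ lookup q j)
        lem : ∀ a b c → a + b + c ≡ a + c + b
        lem = solve-∀ ℚ-ring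

    weight-compose : ∀ s q → (∀ j → lookup t j ≡ true → lookup q j ≡ 0) →
      weight (compose s q) ≡ weight (lookup s) + Ω * toℚ (ℤ.+ Vec.sum q)
    weight-compose s q q-on = begin
      weight (compose s q)
        ≡⟨ Σ-cong (λ j → trans (cong (a j *_) (toℚ-compose s q j)) (lem (a j) (toℚ (ℤ.+ (lookup s j ℕ.+ o j))) (toℚ (ℤ.+ D j)) (toℚ (ℤ.+ lookup q j)))) ⟩
      Σℚ (λ j → a j * toℚ (ℤ.+ (lookup s j ℕ.+ o j)) + a j * toℚ (ℤ.+ D j) * toℚ (ℤ.+ lookup q j))
        ≡⟨ Σ-+ (λ j → a j * toℚ (ℤ.+ (lookup s j ℕ.+ o j))) (λ j → a j * toℚ (ℤ.+ D j) * toℚ (ℤ.+ lookup q j)) ⟩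
      weight (lookup s) + Σℚ (λ j → a j * toℚ (ℤ.+ D j) * toℚ (ℤ.+ lookup q j))
        ≡⟨ cong (weight (lookup s) +_) (trans (Σ-cong row) (trans (Σ-*ˡ Ω (λ j → toℚ (ℤ.+ lookup q j))) (cong (Ω *_) (sym (toℚ-sum q))))) ⟩
      weight (lookup s) + Ω * toℚ (ℤ.+ Vec.sum q) ∎
      where
      open ≡-Reasoning
      lem : ∀ a s d q → a * (s + d * q) ≡ a * s + a * d * q
      lem = solve-∀ ℚ-ring
      row : ∀ j → a j * toℚ (ℤ.+ D j) * toℚ (ℤ.+ lookup q j) ≡ Ω * toℚ (ℤ.+ lookup q j)
      row j = by-mask (lookup t j) (λ h → trans (zeroʳ h (a j * toℚ (ℤ.+ D j))) (sym (zeroʳ h Ω)))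
          (λ h → cong (_* toℚ (ℤ.+ lookup q j)) (D-off h))
        where
        zeroʳ : lookup t j ≡ true → ∀ c → c * toℚ (ℤ.+ lookup q j) ≡ 0ℚ
        zeroʳ h c = trans (cong (λ z → c * toℚ (ℤ.+ z)) (q-on j h)) (*-zeroʳ c)

    -- A step of `D j` shifts every coordinate by an integer, so integrality of a point is decided
    -- by its residues `s` alone.
    full-difference : ∀ y s q l → Integral (full y (lookup s) l - full y (compose s q) l)
    full-difference y s q l = subst Integral (trans (lem₄ (full y (lookup s) l) Δ′) (cong (λ z → full y (lookup s) l - z) (sym split)))
        (integral-neg (integral-+ (Δ-integral l) (integral-neg (integral-Σ term))))
      where
      lem₄ : ∀ a d → - d ≡ a - (a + d)
      lem₄ = solve-∀ ℚ-ring
      open ≡-Reasoning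
      Δ : Fin m → ℚ
      Δ j = η j * (toℚ (ℤ.+ D j) * toℚ (ℤ.+ lookup q j))
      Δ-integral : ∀ j → Integral (Δ j)
      Δ-integral j = integral-* (η-integral j) (integral-* (ℤ.+ D j , refl) (ℤ.+ lookup q j , refl))
      term : ∀ j → Integral (Δ j * (W β l · g j))
      term j = by-mask (lookup t j)
          (λ h → ℤ.+ 0 , trans (cong (λ z → z * (toℚ (ℤ.+ D j) * toℚ (ℤ.+ lookup q j)) * (W β l · g j)) (η-on h))
            (lem (toℚ (ℤ.+ D j) * toℚ (ℤ.+ lookup q j)) (W β l · g j)))
          (λ h → subst Integral (lem₅ (η j) (toℚ (ℤ.+ lookup q j)) (toℚ (ℤ.+ D j)) (W β l · g j))
            (integral-* (integral-* (η-integral j) (ℤ.+ lookup q j , refl)) (D-integral h l)))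
        where
        lem : ∀ a b → 0ℚ * a * b ≡ 0ℚ
        lem = solve-∀ ℚ-ring
        lem₅ : ∀ η q d w → η * q * (d * w) ≡ η * (d * q) * w
        lem₅ = solve-∀ ℚ-ring
      Δ′ = Δ l + - Σℚ (λ j → Δ j * (W β l · g j))
      nb : ∀ j → nonBasic (compose s q) j ≡ nonBasic (lookup s) j + Δ j
      nb j = trans (cong (η j *_) (toℚ-compose s q j)) (*-distribˡ-+ (η j) (toℚ (ℤ.+ (lookup s j ℕ.+ o j))) (toℚ (ℤ.+ D j) * toℚ (ℤ.+ lookup q j)))
      v : Vecℚ k
      v r = y r - lin g (nonBasic (lookup s)) r
      inner : W β l · (λ r → y r - lin g (nonBasic (compose s q)) r) ≡ W β l · v - Σℚ (λ j → Δ j * (W β l · g j))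
      inner = begin
        W β l · (λ r → y r - lin g (nonBasic (compose s q)) r)
          ≡⟨ ·-congʳ (W β l) (λ r → trans (cong (λ z → y r - z) (trans (lin-cong g nb r) (lin-+ g (nonBasic (lookup s)) Δ r)))
               (lem₁ (y r) (lin g (nonBasic (lookup s)) r) (lin g Δ r))) ⟩
        W β l · (λ r → v r + - 1ℚ * lin g Δ r) ≡⟨ ·-+ʳ (W β l) v (λ r → - 1ℚ * lin g Δ r) ⟩
        W β l · v + W β l · (λ r → - 1ℚ * lin g Δ r)
          ≡⟨ cong (W β l · v +_) (trans (·-*ʳ (- 1ℚ) (W β l) (lin g Δ)) (trans (cong (- 1ℚ *_) (·-lin (W β l) g Δ)) (lem₂ (Σℚ (λ j → Δ j * (W β l · g j)))))) ⟩
        W β l · v - Σℚ (λ j → Δ j * (W β l · g j)) ∎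
        where
        lem₁ : ∀ y a b → y - (a + b) ≡ y - a + - 1ℚ * b
        lem₁ = solve-∀ ℚ-ring
        lem₂ : ∀ a → - 1ℚ * a ≡ - a
        lem₂ = solve-∀ ℚ-ring
      lem₃ : ∀ a b c d → a + b + (c - d) ≡ a + c + (b + - d)
      lem₃ = solve-∀ ℚ-ring
      split : full y (compose s q) l ≡ full y (lookup s) l + (Δ l + - Σℚ (λ j → Δ j * (W β l · g j)))
      split = trans (cong₂ _+_ (nb l) inner) (lem₃ (nonBasic (lookup s) l) (Δ l) (W β l · v) (Σℚ (λ j → Δ j * (W β l · g j))))

    full-compose-integral : ∀ y s q → (∀ l → Integral (full y (lookup s) l)) → ∀ l → Integral (full y (compose s q) l)
    full-compose-integral y s q int l = subst Integral (lem (full y (lookup s) l) (full y (compose s q) l))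
        (integral-+ (int l) (integral-neg (full-difference y s q l)))
      where
      lem : ∀ a b → a + - (a - b) ≡ b
      lem = solve-∀ ℚ-ring

    slope : Vecℚ k
    slope r = inv Ω * u r

    level : Vec ℕ m → ℚ
    level s = - (inv Ω * weight (lookup s))

    -- The size of the simplex: for residues `s`, nonnegative cost means that the quotients sum to
    -- at most this number.
    θ : Vec ℕ m → Vecℚ k → ℚ
    θ s y = slope · y + level s

    θ-scaled : ∀ s y → Ω * θ s y ≡ u · y - weight (lookup s)
    θ-scaled s y = trans (cong (λ z → Ω * (z + level s)) (·-*ˡ (inv Ω) u y)) (trans (lem Ω (inv Ω) (u · y) (weight (lookup s)))
        (trans (cong (_* (u · y - weight (lookup s))) (*-inv (0<⇒≢0 0<Ω))) (*-identityˡ (u · y - weight (lookup s)))))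
      where
      lem : ∀ o i a w → o * (i * a + - (i * w)) ≡ o * i * (a - w)
      lem = solve-∀ ℚ-ring

    integral-digits? : ∀ y s → Dec (∀ l → Integral (full y (lookup s) l))
    integral-digits? y s = Finₚ.all? (λ l → integral? (full y (lookup s) l))

    quotientsIf : ∀ {P : Set} → Dec P → Vec ℕ m → Vecℚ k → List (Vec ℕ m)
    quotientsIf (yes _) s y = simplexℤ t (floor (θ s y))
    quotientsIf (no _) s y = []

    quotients : Vecℚ k → Vec ℕ m → List (Vec ℕ m)
    quotients y s = quotientsIf (integral-digits? y s) s y

    ∈-quotients⁺ : ∀ y s q → (∀ l → Integral (full y (lookup s) l)) → q ∈ simplexℤ t (floor (θ s y)) → q ∈ quotients y s
    ∈-quotients⁺ y s q int q∈ = go (integral-digits? y s)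
      where
      go : (d : Dec (∀ l → Integral (full y (lookup s) l))) → q ∈ quotientsIf d s y
      go (yes _) = q∈
      go (no ¬int) = ⊥-elim (¬int int)

    ∈-quotients⁻ : ∀ y s q → q ∈ quotients y s → (∀ l → Integral (full y (lookup s) l)) × q ∈ simplexℤ t (floor (θ s y))
    ∈-quotients⁻ y s q = go (integral-digits? y s)
      where
      go : (d : Dec (∀ l → Integral (full y (lookup s) l))) → q ∈ quotientsIf d s y → (∀ l → Integral (full y (lookup s) l)) × q ∈ simplexℤ t (floor (θ s y))
      go (yes int) q∈ = int , q∈
      go (no _) ()

    quotients-unique : ∀ y s → Unique (quotients y s)
    quotients-unique y s = go (integral-digits? y s)
      where
      go : (d : Dec (∀ l → Integral (full y (lookup s) l))) → Unique (quotientsIf d s y)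
      go (yes _) = simplexℤ-unique t (floor (θ s y))
      go (no _) = []

    digitPairs : Vecℚ k → List (Vec ℕ m × Vec ℕ m)
    digitPairs y = pairs (quotients y) (box D)

    point : Vecℚ k → Vec ℕ m × Vec ℕ m → Vec ℤ m
    point y (s , q) = tabulate (λ l → floor (full y (compose s q) l))

    points : Vecℚ k → List (Vec ℤ m)
    points y = List.map (point y) (digitPairs y)

    toℚ-point : ∀ y s q → (s , q) ∈ digitPairs y → ∀ l → toℚ (lookup (point y (s , q)) l) ≡ full y (compose s q) l
    toℚ-point y s q p∈ l = trans (cong toℚ (Vecₚ.lookup∘tabulate (λ l → floor (full y (compose s q) l)) l))
      (integral⇒floor (full-compose-integral y s q (proj₁ (∈-quotients⁻ y s q (proj₂ (∈-pairs⁻ (quotients y) (box D) p∈)))) l))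

    Region : Vecℚ k → Vec ℤ m → Set
    Region y x = (∀ r → lin g (toℚ ∘ lookup x) r ≡ y r) × Vertex (signs (toℚ ∘ lookup x)) β
      × 0ℚ ≤ Σℚ (λ j → e j * toℚ (lookup x j))

    private
      vertex-cong : ∀ {x x′ : Fin m → ℚ} → (∀ j → x j ≡ x′ j) → Vertex (signs x) β → Vertex (signs x′) β
      vertex-cong {x} {x′} h V j = subst (λ s → 0ℚ ≤ s * slack β j) (eq (0ℚ ≤? x j)) (V j)
        where
        eq : Dec (0ℚ ≤ x j) → signs x j ≡ signs x′ j
        eq (yes p) = trans (signs-nonNeg x j p) (sym (signs-nonNeg x′ j (subst (0ℚ ≤_) (h j) p)))
        eq (no ¬p) = trans (signs-neg x j (≰⇒> ¬p)) (sym (signs-neg x′ j (subst (_< 0ℚ) (h j) (≰⇒> ¬p))))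

    point-region : ∀ y s q → (s , q) ∈ digitPairs y → Region y (point y (s , q))
    point-region y s q p∈ =
        (λ r → trans (lin-cong g x≡ r) (full-lin y (compose s q) r))
      , vertex-cong (λ j → sym (x≡ j)) (full-vertex y (compose s q))
      , subst (0ℚ ≤_) (sym (trans (Σ-cong (λ j → cong (e j *_) (x≡ j))) (cost-full y (compose s q)))) bound
      where
      x≡ = toℚ-point y s q p∈
      q∈ = ∈-simplexℤ⁻ t (floor (θ s y)) q (proj₂ (∈-quotients⁻ y s q (proj₂ (∈-pairs⁻ (quotients y) (box D) p∈))))
      Σq = toℚ (ℤ.+ Vec.sum q)
      lem : ∀ w o s θ → o * (θ - s) ≡ o * θ - o * s
      lem = solve-∀ ℚ-ring
      lem₂ : ∀ a w s → a - w - s ≡ a - (w + s)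
      lem₂ = solve-∀ ℚ-ring
      bound : 0ℚ ≤ u · y - weight (compose s q)
      bound = subst (0ℚ ≤_) (trans (lem 0ℚ Ω Σq (θ s y)) (trans (cong (_- Ω * Σq) (θ-scaled s y))
          (trans (lem₂ (u · y) (weight (lookup s)) (Ω * Σq)) (cong (λ z → u · y - z) (sym (weight-compose s q (proj₁ q∈)))))))
        (0≤p*q (<⇒≤ 0<Ω) (p≤q⇒0≤q-p (≤-trans (toℚ-mono (proj₂ q∈)) (floor≤ (θ s y)))))

    ∈-points⁻ : ∀ y x → x ∈ points y → Region y x
    ∈-points⁻ y x x∈ = let ((s , q) , p∈ , x≡) = ∈-map⁻ (point y) x∈ in subst (Region y) (sym x≡) (point-region y s q p∈)

    ∈-points⁺ : ∀ y x → Region y x → x ∈ points y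
    ∈-points⁺ y x (x-lin , V , 0≤ex) = subst (_∈ points y) point≡ (∈-map⁺ (point y) (∈-pairs⁺ (quotients y) s∈ q∈))
      where
      open ≡-Reasoning
      instance
        D-nonZero : ∀ {j} → ℕ.NonZero (D j)
        D-nonZero {j} = ℕ.>-nonZero (D-pos j)
      n = offset (lookup x)
      s q : Vec ℕ m
      -- Division with remainder of the offsets. On basic columns the offset is zero, so the
      -- quotient vanishes there as `simplexℤ` requires.
      s = tabulate (λ j → n j ℕ.% D j)
      q = tabulate (λ j → n j ℕ./ D j)
      compose≡ : ∀ j → compose s q j ≡ n j
      compose≡ j = trans (cong₂ (λ a b → a ℕ.+ D j ℕ.* b) (Vecₚ.lookup∘tabulate (λ j → n j ℕ.% D j) j) (Vecₚ.lookup∘tabulate (λ j → n j ℕ./ D j) j))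
        (trans (cong (n j ℕ.% D j ℕ.+_) (ℕₚ.*-comm (D j) (n j ℕ./ D j))) (sym (ℕDM.m≡m%n+[m/n]*n (n j) (D j))))
      nonBasic≡ : ∀ j → nonBasic (compose s q) j ≡ nonBasic n j
      nonBasic≡ j = cong (λ c → η j * toℚ (ℤ.+ (c ℕ.+ o j))) (compose≡ j)
      x≡ : ∀ l → toℚ (lookup x l) ≡ full y (compose s q) l
      x≡ = full-unique y (compose s q) (toℚ ∘ lookup x) x-lin λ {j} h →
        trans (vertex⇒full y (lookup x) x-lin V j) (trans (full-off y n h) (sym (nonBasic≡ j)))
      s∈ : s ∈ box D
      s∈ = ∈-box⁺ D s (λ j → subst (ℕ._< D j) (sym (Vecₚ.lookup∘tabulate (λ j → n j ℕ.% D j) j)) (ℕDM.m%n<n (n j) (D j)))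
      q-on : ∀ j → lookup t j ≡ true → lookup q j ≡ 0
      q-on j h = trans (Vecₚ.lookup∘tabulate (λ j → n j ℕ./ D j) j) (trans (cong (ℕ._/ D j) (offset-on (lookup x) h)) (ℕDM.0/n≡0 (D j)))
      int : ∀ l → Integral (full y (lookup s) l)
      int l = subst Integral (sym (split l)) (integral-+ (lookup x l , sym (x≡ l)) (full-difference y s q l))
        where
        split : ∀ l → full y (lookup s) l ≡ full y (compose s q) l + (full y (lookup s) l - full y (compose s q) l)
        split l = lem (full y (lookup s) l) (full y (compose s q) l)
          where
          lem : ∀ a b → a ≡ b + (a - b)
          lem = solve-∀ ℚ-ring
      Σq = toℚ (ℤ.+ Vec.sum q)
      lem : ∀ a w s → a - (w + s) ≡ a - w - s
      lem = solve-∀ ℚ-ring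
      lem₂ : ∀ o θ s → o * θ - o * s ≡ (θ - s) * o
      lem₂ = solve-∀ ℚ-ring
      Σq≤θ : Σq ≤ θ s y
      Σq≤θ = 0≤q-p⇒p≤q (*-cancel-0≤ʳ 0<Ω (subst (0ℚ ≤_) (begin
        Σℚ (λ j → e j * toℚ (lookup x j)) ≡⟨ Σ-cong (λ j → cong (e j *_) (x≡ j)) ⟩
        Σℚ (λ j → e j * full y (compose s q) j) ≡⟨ cost-full y (compose s q) ⟩
        u · y - weight (compose s q) ≡⟨ cong (λ z → u · y - z) (weight-compose s q q-on) ⟩
        u · y - (weight (lookup s) + Ω * Σq) ≡⟨ lem (u · y) (weight (lookup s)) (Ω * Σq) ⟩
        u · y - weight (lookup s) - Ω * Σq ≡⟨ cong (_- Ω * Σq) (sym (θ-scaled s y)) ⟩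
        Ω * θ s y - Ω * Σq ≡⟨ lem₂ Ω (θ s y) Σq ⟩
        (θ s y - Σq) * Ω ∎) 0≤ex))
      q∈ : q ∈ quotients y s
      q∈ = ∈-quotients⁺ y s q int (∈-simplexℤ⁺ t (floor (θ s y)) q q-on (≤floor Σq≤θ))
      point≡ : point y (s , q) ≡ x
      point≡ = trans (Vecₚ.tabulate-cong (λ l → trans (cong floor (sym (x≡ l))) (floor-toℚ (lookup x l)))) (Vecₚ.tabulate∘lookup x)

    points-unique : ∀ y → Unique (points y)
    points-unique y = map-unique (point y) injective (pairs-unique (quotients y) (box-unique D) (quotients-unique y))
      where
      injective : ∀ p p′ → p ∈ digitPairs y → p′ ∈ digitPairs y → point y p ≡ point y p′ → p ≡ p′
      injective (s , q) (s′ , q′) p∈ p′∈ eq = cong₂ _,_ (lookup-ext (λ j → proj₁ (both j))) (lookup-ext (λ j → proj₂ (both j)))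
        where
        mem = ∈-pairs⁻ (quotients y) (box D) p∈
        mem′ = ∈-pairs⁻ (quotients y) (box D) p′∈
        s< = ∈-box⁻ D s (proj₁ mem)
        s′< = ∈-box⁻ D s′ (proj₁ mem′)
        q-on = proj₁ (∈-simplexℤ⁻ t (floor (θ s y)) q (proj₂ (∈-quotients⁻ y s q (proj₂ mem))))
        q′-on = proj₁ (∈-simplexℤ⁻ t (floor (θ s′ y)) q′ (proj₂ (∈-quotients⁻ y s′ q′ (proj₂ mem′))))
        <1⇒0 : ∀ {n} → n ℕ.< 1 → n ≡ 0
        <1⇒0 (ℕ.s≤s ℕ.z≤n) = refl
        both : ∀ j → lookup s j ≡ lookup s′ j × lookup q j ≡ lookup q′ j
        both j = by-mask (lookup t j) on off
         where
         on : lookup t j ≡ true → lookup s j ≡ lookup s′ j × lookup q j ≡ lookup q′ j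
         on h = trans (<1⇒0 (subst (lookup s j ℕ.<_) (D-on h) (s< j))) (sym (<1⇒0 (subst (lookup s′ j ℕ.<_) (D-on h) (s′< j))))
                     , trans (q-on j h) (sym (q′-on j h))
         off : lookup t j ≡ false → lookup s j ≡ lookup s′ j × lookup q j ≡ lookup q′ j
         off h = digits-unique (D j) (lookup s j) (lookup q j) (lookup s′ j) (lookup q′ j) (s< j) (s′< j)
            (ℕₚ.+-cancelʳ-≡ (o j) (compose s q j) (compose s′ q′ j) (ℤₚ.+-injective (toℚ-injective
              (p-q≡0⇒p≡q (*-cancelˡ-0 η≢0 (trans (lem (η j) (toℚ (ℤ.+ (compose s q j ℕ.+ o j))) (toℚ (ℤ.+ (compose s′ q′ j ℕ.+ o j))))
                (p≡q⇒p-q≡0 nb≡)))))))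
          where
          lem : ∀ a b c → a * (b - c) ≡ a * b - a * c
          lem = solve-∀ ℚ-ring
          η≢0 : η j ≢ 0ℚ
          η≢0 z = 1≢0 (trans (sym (sgn-sq (slack≢0 h))) (trans (cong (_* η j) z) (*-zeroˡ (η j))))
          nb≡ : nonBasic (compose s q) j ≡ nonBasic (compose s′ q′) j
          nb≡ = trans (sym (full-off y (compose s q) h)) (trans (sym (toℚ-point y s q p∈ j))
            (trans (cong (λ v → toℚ (lookup v j)) eq) (trans (toℚ-point y s′ q′ p′∈ j) (full-off y (compose s′ q′) h))))

    constantPart : Vec ℕ m → Fin m → ℚ
    constantPart s l = nonBasic (lookup s) l - W β l · lin g (nonBasic (lookup s))

    full-affine : ∀ s y l → full y (lookup s) l ≡ W β l · y + constantPart s l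
    full-affine s y l = trans (cong (nonBasic (lookup s) l +_) (trans
        (Σ-cong (λ r → lem (W β l r) (y r) (lin g (nonBasic (lookup s)) r)))
        (Σ-- (λ r → W β l r * y r) (λ r → W β l r * lin g (nonBasic (lookup s)) r))))
      (lem₂ (nonBasic (lookup s) l) (W β l · y) (W β l · lin g (nonBasic (lookup s))))
      where
      lem : ∀ a b c → a * (b - c) ≡ a * b - a * c
      lem = solve-∀ ℚ-ring
      lem₂ : ∀ a b c → a + (b - c) ≡ b + (a - c)
      lem₂ = solve-∀ ℚ-ring

    -- The product of indicators is periodic in `y` and tests integrality for the residues `s`; the
    -- binomial counts the quotients.
    digitCount : Vec ℕ m → Vecℤ k → ℚ
    digitCount s y = Πℚ (λ l → 𝟙 (integral? (W β l · vecℚ y + constantPart s l))) * binom (codim t) (toℚ (floor (slope · vecℚ y + level s)))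

    pointCount : Vecℤ k → ℚ
    pointCount y = sumL (λ s → digitCount s y) (box D)

    pointCount-quasiPoly : IsQuasiPoly pointCount
    pointCount-quasiPoly = qp-sumL (box D) λ s → qp-* (qp-Π (λ l → qp-integral (W β l) (constantPart s l)))
      (qp-binom (codim t) (qp-floor slope (level s)))

    -- Residue plus offset is at most `D j`, so each nonbasic column contributes at most `Ω` to the
    -- weight; and `u · y` is nonnegative because `e` is positive and `y` lies in the cone of the
    -- basis. Hence the binomial is evaluated only where it equals the count.
    -codim≤θ : ∀ y s → Feasible β y → s ∈ box D → - toℚ (ℤ.+ codim t) ≤ θ s y
    -codim≤θ y s f s∈ = 0≤q-p⇒p≤q (*-cancel-0≤ʳ 0<Ω (subst (0ℚ ≤_) eq (0≤p+q 0≤u (p≤q⇒0≤q-p weight≤))))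
      where
      c = toℚ (ℤ.+ codim t)
      0≤u : 0ℚ ≤ u · y
      0≤u = subst (0ℚ ≤_) (sym (dualPoint-· β e y)) (Σ-0≤ (λ l → 0≤p*q (<⇒≤ (0<e l)) (f l)))
      weight≤ : weight (lookup s) ≤ c * Ω
      weight≤ = subst (weight (lookup s) ≤_) (Σ-offᵐ t Ω) (Σ-mono row)
        where
        row : ∀ j → a j * toℚ (ℤ.+ (lookup s j ℕ.+ o j)) ≤ offᵐ t j Ω
        row j = by-mask (lookup t j) on off
         where
         on : lookup t j ≡ true → a j * toℚ (ℤ.+ (lookup s j ℕ.+ o j)) ≤ offᵐ t j Ω
         on h = ≤-reflexive (trans (cong (_* toℚ (ℤ.+ (lookup s j ℕ.+ o j))) (a-on h))
              (trans (*-zeroˡ (toℚ (ℤ.+ (lookup s j ℕ.+ o j)))) (sym (offᵐ-on t j Ω h))))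
         off : lookup t j ≡ false → a j * toℚ (ℤ.+ (lookup s j ℕ.+ o j)) ≤ offᵐ t j Ω
         off h = subst (a j * toℚ (ℤ.+ (lookup s j ℕ.+ o j)) ≤_) (trans (D-off h) (sym (offᵐ-off t j Ω h)))
              (*-monoˡ-≤-nonNeg (a j) {{nonNegative (0≤a j)}} (toℚ-mono (ℤ.+≤+ (ℕₚ.≤-trans (ℕₚ.+-monoʳ-≤ (lookup s j) (o≤1 j))
                (subst (ℕ._≤ D j) (sym (ℕₚ.+-comm (lookup s j) 1)) (∈-box⁻ D s s∈ j))))))
      lem : ∀ o θ c → o * θ + c * o ≡ (θ - - c) * o
      lem = solve-∀ ℚ-ring
      lem₂ : ∀ a w z → a + (z - w) ≡ a - w + z
      lem₂ = solve-∀ ℚ-ring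
      eq : u · y + (c * Ω - weight (lookup s)) ≡ (θ s y - - c) * Ω
      eq = trans (lem₂ (u · y) (weight (lookup s)) (c * Ω)) (trans (cong (_+ c * Ω) (sym (θ-scaled s y))) (lem Ω (θ s y) c))

    quotients-length : ∀ y s → Feasible β (vecℚ y) → s ∈ box D → toℚ (ℤ.+ length (quotients (vecℚ y) s)) ≡ digitCount s y
    quotients-length y s f s∈ = go (integral-digits? (vecℚ y) s)
      where
      b = binom (codim t) (toℚ (floor (slope · vecℚ y + level s)))
      ind : Fin m → ℚ
      ind l = 𝟙 (integral? (W β l · vecℚ y + constantPart s l))
      go : (d : Dec (∀ l → Integral (full (vecℚ y) (lookup s) l))) → toℚ (ℤ.+ length (quotientsIf d s (vecℚ y))) ≡ Πℚ ind * b
      go (yes int) = trans (simplexℤ-length t (floor (θ s (vecℚ y))) floor-bound)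
          (sym (trans (cong (_* b) (Π-1 (λ l → 𝟙-yes (integral? (W β l · vecℚ y + constantPart s l)) (subst Integral (full-affine s (vecℚ y) l) (int l)))))
            (*-identityˡ b)))
        where
        floor-bound : - toℚ (ℤ.+ codim t) ≤ toℚ (floor (θ s (vecℚ y)))
        floor-bound = subst (_≤ toℚ (floor (θ s (vecℚ y)))) (toℚ-neg (ℤ.+ codim t)) (toℚ-mono {ℤ.- (ℤ.+ codim t)} (≤floor {ℤ.- (ℤ.+ codim t)}
          (subst (_≤ θ s (vecℚ y)) (sym (toℚ-neg (ℤ.+ codim t))) (-codim≤θ (vecℚ y) s f s∈))))
      go (no ¬int) = sym (trans (cong (_* b) (zero-factor (Finₚ.¬∀⟶∃¬ m _ (λ l → integral? (full (vecℚ y) (lookup s) l)) ¬int))) (*-zeroˡ b))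
        where
        zero-factor : (∃ λ l → ¬ Integral (full (vecℚ y) (lookup s) l)) → Πℚ ind ≡ 0ℚ
        zero-factor (l , ¬i) = Π-zero ind l (𝟙-no (integral? (W β l · vecℚ y + constantPart s l)) (λ i → ¬i (subst Integral (sym (full-affine s (vecℚ y) l)) i)))

    points-length : ∀ y → Feasible β (vecℚ y) → toℚ (ℤ.+ length (points (vecℚ y))) ≡ pointCount y
    points-length y f = trans (cong (λ l → toℚ (ℤ.+ l)) (Listₚ.length-map (point (vecℚ y)) (digitPairs (vecℚ y))))
      (trans (pairs-length (quotients (vecℚ y)) (box D)) (sumL-cong (box D) (λ s s∈ → quotients-length y s f s∈)))

  -- The partition function on a chamber

  Σᵐ-≢0 : ∀ {m} (f : Mask m → ℚ) → Σᵐ f ≢ 0ℚ → Σ (Mask m) λ t → f t ≢ 0ℚ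
  Σᵐ-≢0 {zero} f ne = [] , ne
  Σᵐ-≢0 {suc m} f ne = go (Σᵐ (λ t → f (true ∷ t)) ≟ 0ℚ)
    where
    go : Dec (Σᵐ (λ t → f (true ∷ t)) ≡ 0ℚ) → Σ (Mask (suc m)) λ t → f t ≢ 0ℚ
    go (no ne′) = let (t , h) = Σᵐ-≢0 (λ t → f (true ∷ t)) ne′ in true ∷ t , h
    go (yes e) = let (t , h) = Σᵐ-≢0 (λ t → f (false ∷ t))
                       (λ e′ → ne (trans (cong₂ _+_ e e′) (+-identityˡ 0ℚ))) in false ∷ t , h

  *-≢0ˡ : ∀ p q → p * q ≢ 0ℚ → p ≢ 0ℚ
  *-≢0ˡ p q h e = h (trans (cong (_* q) e) (*-zeroˡ q))

  *-≢0ʳ : ∀ p q → p * q ≢ 0ℚ → q ≢ 0ℚ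
  *-≢0ʳ p q h e = h (trans (cong (p *_) e) (*-zeroʳ p))

  ρ-cong : ∀ {m} (σ σ′ : Fin m → ℚ) (t : Mask m) → (∀ {j} → lookup t j ≡ false → σ j ≡ σ′ j) → ρ σ t ≡ ρ σ′ t
  ρ-cong σ σ′ t h = Π-cong go
    where
    go : ∀ j → off1 t σ j ≡ off1 t σ′ j
    go j with lookup t j | h {j}
    ... | true | _ = refl
    ... | false | e = e refl

  toℚ-mulVec : ∀ {k m} (B : Mat k m) (x : Vecℤ m) r → toℚ (mulVec B x r) ≡ lin (colℚ B) (toℚ ∘ x) r
  toℚ-mulVec B x r = trans (toℚ-Σ (λ j → B r j ℤ.* x j))
    (Σ-cong (λ j → trans (toℚ-* (B r j) (x j)) (*-comm (toℚ (B r j)) (toℚ (x j)))))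

  module Assembly {m k} (B : Mat k m) (pointed : Chambers.Pointed (colℚ B)) {t₀} (β₀ : Bases.Basis (colℚ B) t₀)
    {z : Vecℚ k} (gen : Chambers.Generic (colℚ B) z) (z∈ : InPosMat B z) where

    private
      g = colℚ B
      costs = Lawrence.nonDegenerate-cost g

    abstract
      e : Fin m → ℚ
      e = proj₁ costs

      0<e : ∀ j → 0ℚ < e j
      0<e = proj₁ (proj₂ costs)

      nondeg : Identity.NonDegenerate g e
      nondeg = proj₂ (proj₂ costs)

    open Chambers g
    open Identity g e
    open Lawrence.Optimum g e nondeg pointed β₀ using (identity)
    module At {t} (β : Basis t) = Count g e 0<e nondeg β

    -- The signed sum over the bases whose cone contains the generic point, with `ρ` taken at the
    -- signs of the slacks. It does not depend on which cones contain `y`, hence one formula serves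
    -- the whole chamber.
    Q : Vecℤ k → ℚ
    Q y = Σᵐ (λ t → onBasis t (λ β → 𝟙 (feasible? β z) * (ρ (At.η β) t * At.pointCount β y)))

    onBasis-quasiPoly : ∀ t {f : Basis t → Vecℤ k → ℚ} → (∀ β → IsQuasiPoly (f β)) → IsQuasiPoly (λ y → onBasis t (λ β → f β y))
    onBasis-quasiPoly t h with basis? t
    ... | yes β = h β
    ... | no _ = qp-const 0ℚ

    Q-quasiPoly : IsQuasiPoly Q
    Q-quasiPoly = qp-Σᵐ λ t → onBasis-quasiPoly t λ β →
      qp-* (qp-const (𝟙 (feasible? β z))) (qp-* (qp-const (ρ (At.η β) t)) (At.pointCount-quasiPoly β))

    onBasis-sumL : ∀ {A : Set} t (f : A → Basis t → ℚ) xs → sumL (λ x → onBasis t (f x)) xs ≡ onBasis t (λ β → sumL (λ x → f x β) xs)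
    onBasis-sumL t f xs with basis? t
    ... | yes β = refl
    ... | no _ = zeros xs
      where
      zeros : ∀ {A : Set} (xs : List A) → sumL (λ _ → 0ℚ) xs ≡ 0ℚ
      zeros [] = refl
      zeros (x ∷ xs) = trans (+-identityˡ (sumL (λ _ → 0ℚ) xs)) (zeros xs)

    slack-unique : ∀ {t} (β β′ : Basis t) j → slack β j ≡ slack β′ j
    slack-unique β β′ j = cong (_- e j) (trans (dualPoint-· β e (g j))
      (trans (Σ-cong (λ l → cong (e l *_) (W-unique β β′ l (g j)))) (sym (dualPoint-· β′ e (g j)))))

    region-unique : ∀ {t} (β β′ : Basis t) {y x} → At.Region β y x → At.Region β′ y x
    region-unique β β′ (h , V , c) = h , (λ j → subst (λ s → 0ℚ ≤ signs _ j * s) (slack-unique β β′ j) (V j)) , c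

    candidatesIf : ∀ {t} → Dec (Feasibleᵐ z t) → Vecℤ k → List (Vec ℤ m)
    candidatesIf (yes (β , _)) y = At.points β (vecℚ y)
    candidatesIf (no _) y = []

    -- The finite ground set for double counting: all points of the truncated polarised cones. Cones
    -- of different bases overlap, so repetitions are removed.
    candidates : Vecℤ k → List (Vec ℤ m)
    candidates y = deduplicate (Vecₚ.≡-dec ℤ._≟_) (concatMap (λ t → candidatesIf (feasibleᵐ? z t) y) (allMasks m))

    candidates-unique : ∀ y → Unique (candidates y)
    candidates-unique y = UniqueDecₚ.deduplicate-! (Vecₚ.≡-dec ℤ._≟_) _

    ∈-candidates⁺ : ∀ y x {t} (β : Basis t) → Feasible β z → At.Region β (vecℚ y) x → x ∈ candidates y
    ∈-candidates⁺ y x {t} β f R = ∈-deduplicate⁺ (Vecₚ.≡-dec ℤ._≟_)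
      (∈-concatMap⁺ (λ t → candidatesIf (feasibleᵐ? z t) y) (Any.map (λ { refl → go (feasibleᵐ? z t) }) (∈-allMasks t)))
      where
      go : (d : Dec (Feasibleᵐ z t)) → x ∈ candidatesIf d y
      go (yes (β′ , _)) = At.∈-points⁺ β′ (vecℚ y) x (region-unique β β′ {vecℚ y} {x} R)
      go (no ¬f) = ⊥-elim (¬f (β , f))

    ∈-candidates⁻ : ∀ y x → x ∈ candidates y → Σ (Mask m) λ t → Σ (Basis t) λ β → At.Region β (vecℚ y) x
    ∈-candidates⁻ y x x∈ =
      let (t , _ , x∈t) = find (∈-concatMap⁻ (λ t → candidatesIf (feasibleᵐ? z t) y) {xs = allMasks m}
            (∈-deduplicate⁻ (Vecₚ.≡-dec ℤ._≟_) _ x∈))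
      in t , go (feasibleᵐ? z t) x∈t
      where
      go : ∀ {t} (d : Dec (Feasibleᵐ z t)) → x ∈ candidatesIf d y → Σ (Basis t) λ β → At.Region β (vecℚ y) x
      go (yes (β , _)) x∈ = β , At.∈-points⁻ β (vecℚ y) x x∈

    module _ (y : Vecℤ k) (cell : MaskCell z (vecℚ y)) where

      xℚ : Vec ℤ m → Fin m → ℚ
      xℚ x j = toℚ (lookup x j)

      cell-lin : ∀ x → (∀ r → lin g x r ≡ vecℚ y r) → MaskCell z (lin g x)
      cell-lin x h β f j = subst (0ℚ ≤_) (·-congʳ (W β j) (λ r → sym (h r))) (cell β f j)

      nonNegᵛ? : (x : Vec ℤ m) → Dec (∀ j → 0ℚ ≤ xℚ x j)
      nonNegᵛ? x = nonNeg? (xℚ x)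

      solutions : List (Vec ℤ m)
      solutions = filter nonNegᵛ? (candidates y)

      vertexCount : ∀ {t} (β : Basis t) → Feasible β z → sumL (λ x → 𝟙 (vertex? (signs (xℚ x)) β)) (candidates y) ≡ At.pointCount β y
      vertexCount β f = trans (sumL-𝟙 V? (candidates y)) (trans (cong (λ n → toℚ (ℤ.+ n)) same) (At.points-length β y (cell β f)))
        where
        V? : (x : Vec ℤ m) → Dec (Vertex (signs (xℚ x)) β)
        V? x = vertex? (signs (xℚ x)) β
        same : length (filter V? (candidates y)) ≡ length (At.points β (vecℚ y))
        same = length-≡ (Uniqueₚ.filter⁺ V? (candidates-unique y)) (At.points-unique β (vecℚ y))
          (λ x x∈ → let (x∈L , V) = ∈-filter⁻ V? {xs = candidates y} x∈ ; (_ , _ , (h , _ , c)) = ∈-candidates⁻ y x x∈L in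
            At.∈-points⁺ β (vecℚ y) x (h , V , c))
          (λ x x∈ → let R = At.∈-points⁻ β (vecℚ y) x x∈ in
            ∈-filter⁺ V? (∈-candidates⁺ y x β f R) (proj₁ (proj₂ R)))

      basis-sum : ∀ t (β : Basis t) →
        sumL (λ x → vertexTerm (signs (xℚ x)) z β) (candidates y) ≡ 𝟙 (feasible? β z) * (ρ (At.η β) t * At.pointCount β y)
      basis-sum t β = trans (sumL-cong (candidates y) (λ x _ → row x))
        (trans (sumL-*ˡ (ρ η t * φ) (λ x → 𝟙 (vertex? (signs (xℚ x)) β)) (candidates y)) (finish (feasible? β z)))
        where
        η = At.η β
        φ = 𝟙 (feasible? β z)
        lem : ∀ v r f → v * r * f ≡ r * f * v
        lem = solve-∀ ℚ-ring
        lem₂ : ∀ r f v → r * f * v ≡ f * (r * v)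
        lem₂ = solve-∀ ℚ-ring
        row : ∀ x → vertexTerm (signs (xℚ x)) z β ≡ ρ η t * φ * 𝟙 (vertex? (signs (xℚ x)) β)
        row x = go (vertex? (signs (xℚ x)) β)
          where
          go : (d : Dec (Vertex (signs (xℚ x)) β)) → 𝟙 d * ρ (signs (xℚ x)) t * φ ≡ ρ η t * φ * 𝟙 d
          go (no _) = zeros (ρ (signs (xℚ x)) t) φ (ρ η t)
            where
            zeros : ∀ a b c → 0ℚ * a * b ≡ c * b * 0ℚ
            zeros = solve-∀ ℚ-ring
          go (yes V) = trans (cong (λ r → 1ℚ * r * φ) (ρ-cong (signs (xℚ x)) η t (At.vertex-signs β (signs (xℚ x)) (signs-± (xℚ x)) V)))
            (lem 1ℚ (ρ η t) φ)
        finish : (d : Dec (Feasible β z)) → ρ η t * 𝟙 d * sumL (λ x → 𝟙 (vertex? (signs (xℚ x)) β)) (candidates y) ≡ 𝟙 d * (ρ η t * At.pointCount β y)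
        finish (yes f) = trans (cong (ρ η t * 1ℚ *_) (vertexCount β f)) (lem₂ (ρ η t) 1ℚ (At.pointCount β y))
        finish (no _) = zeros (ρ η t) (sumL (λ x → 𝟙 (vertex? (signs (xℚ x)) β)) (candidates y)) (At.pointCount β y)
          where
          zeros : ∀ a b c → a * 0ℚ * b ≡ 0ℚ * (a * c)
          zeros = solve-∀ ℚ-ring

      -- The indicator identity is summed over the candidates and the two summations are
      -- interchanged: for each basis the inner sum counts one truncated cone.
      Q≡count : Q y ≡ toℚ (ℤ.+ length solutions)
      Q≡count = sym (begin
        toℚ (ℤ.+ length solutions) ≡⟨ sym (sumL-𝟙 nonNegᵛ? (candidates y)) ⟩
        sumL (λ x → 𝟙 (nonNegᵛ? x)) (candidates y)
          ≡⟨ sumL-cong (candidates y) (λ x x∈ → sym (identity gen z∈ (xℚ x)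
               (cell-lin (xℚ x) (proj₁ (proj₂ (proj₂ (∈-candidates⁻ y x x∈))))))) ⟩
        sumL (λ x → Σᵐ (λ t → onBasis t (vertexTerm (signs (xℚ x)) z))) (candidates y)
          ≡⟨ sumL-Σᵐ (λ x t → onBasis t (vertexTerm (signs (xℚ x)) z)) (candidates y) ⟩
        Σᵐ (λ t → sumL (λ x → onBasis t (vertexTerm (signs (xℚ x)) z)) (candidates y))
          ≡⟨ Σᵐ-cong (λ t → trans (onBasis-sumL t (λ x → vertexTerm (signs (xℚ x)) z) (candidates y)) (onBasis-cong t (basis-sum t))) ⟩
        Q y ∎)
        where open ≡-Reasoning

      -- For nonnegative `x` the identity has value one, so some term is nonzero and `x` lies in the
      -- polarised cone of a feasible basis. Truncation does not remove it, because its cost is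
      -- nonnegative.
      complete : ∀ x → (∀ r → lin g (xℚ x) r ≡ vecℚ y r) → (∀ j → 0ℚ ≤ xℚ x j) → x ∈ candidates y
      complete x h 0≤x = ∈-candidates⁺ y x β (𝟙-≢0 (feasible? β z) (*-≢0ʳ (V * R) F nz))
          (h , 𝟙-≢0 (vertex? (signs (xℚ x)) β) (*-≢0ˡ V R (*-≢0ˡ (V * R) F nz)) , Σ-0≤ (λ j → 0≤p*q (<⇒≤ (0<e j)) (0≤x j)))
        where
        sum≡1 : Σᵐ (λ t → onBasis t (vertexTerm (signs (xℚ x)) z)) ≡ 1ℚ
        sum≡1 = trans (identity gen z∈ (xℚ x) (cell-lin (xℚ x) h)) (𝟙-yes (nonNeg? (xℚ x)) 0≤x)
        some = Σᵐ-≢0 (λ t → onBasis t (vertexTerm (signs (xℚ x)) z)) (λ e → 1≢0 (trans (sym sum≡1) e))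
        b = onBasis-≢0 (proj₁ some) (proj₂ some)
        β = proj₁ b
        nz = proj₂ b
        V = 𝟙 (vertex? (signs (xℚ x)) β)
        R = ρ (signs (xℚ x)) (proj₁ some)
        F = 𝟙 (feasible? β z)

      count : PCount B y (length solutions)
      count = List.map (Vec.map ℤ.∣_∣) solutions , Listₚ.length-map (Vec.map ℤ.∣_∣) solutions
        , map-unique (Vec.map ℤ.∣_∣) injective (Uniqueₚ.filter⁺ nonNegᵛ? (candidates-unique y))
        , λ x → sound x , complete′ x
        where
        abs-nonNeg : ∀ i → 0ℚ ≤ toℚ i → ℤ.+ ℤ.∣ i ∣ ≡ i
        abs-nonNeg i h = let (n , e) = 0≤toℚ⇒ i h in trans (cong (λ i → ℤ.+ ℤ.∣ i ∣) e) (sym e)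
        back : ∀ x → x ∈ solutions → ∀ j → ℤ.+ lookup (Vec.map ℤ.∣_∣ x) j ≡ lookup x j
        back x x∈ j = trans (cong ℤ.+_ (Vecₚ.lookup-map j ℤ.∣_∣ x)) (abs-nonNeg (lookup x j) (proj₂ (∈-filter⁻ nonNegᵛ? {xs = candidates y} x∈) j))
        injective : ∀ x x′ → x ∈ solutions → x′ ∈ solutions → Vec.map ℤ.∣_∣ x ≡ Vec.map ℤ.∣_∣ x′ → x ≡ x′
        injective x x′ x∈ x′∈ eq = lookup-ext λ j → trans (sym (back x x∈ j)) (trans (cong (λ v → ℤ.+ lookup v j) eq) (back x′ x′∈ j))
        sound : ∀ x → x ∈ List.map (Vec.map ℤ.∣_∣) solutions → Sol B y x
        sound x x∈ = let (x′ , x′∈ , eq) = ∈-map⁻ (Vec.map ℤ.∣_∣) x∈ in subst (Sol B y) (sym eq) (λ r → toℚ-injective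
          (trans (toℚ-mulVec B (λ j → ℤ.+ lookup (Vec.map ℤ.∣_∣ x′) j) r)
            (trans (lin-cong g (λ j → cong toℚ (back x′ x′∈ j)) r)
              (proj₁ (proj₂ (proj₂ (∈-candidates⁻ y x′ (proj₁ (∈-filter⁻ nonNegᵛ? {xs = candidates y} x′∈))))) r))))
        complete′ : ∀ x → Sol B y x → x ∈ List.map (Vec.map ℤ.∣_∣) solutions
        complete′ x sol = subst (_∈ List.map (Vec.map ℤ.∣_∣) solutions) abs≡ (∈-map⁺ (Vec.map ℤ.∣_∣)
            (∈-filter⁺ nonNegᵛ? (complete x⁺ x⁺-lin 0≤x⁺) 0≤x⁺))
          where
          x⁺ = Vec.map ℤ.+_ x
          at : ∀ j → lookup x⁺ j ≡ ℤ.+ lookup x j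
          at j = Vecₚ.lookup-map j ℤ.+_ x
          abs≡ : Vec.map ℤ.∣_∣ x⁺ ≡ x
          abs≡ = lookup-ext λ j → trans (Vecₚ.lookup-map j ℤ.∣_∣ x⁺) (cong ℤ.∣_∣ (at j))
          0≤x⁺ : ∀ j → 0ℚ ≤ xℚ x⁺ j
          0≤x⁺ j = subst (λ i → 0ℚ ≤ toℚ i) (sym (at j)) (0≤toℚ (lookup x j))
          x⁺-lin : ∀ r → lin g (xℚ x⁺) r ≡ vecℚ y r
          x⁺-lin r = trans (lin-cong g (λ j → cong toℚ (at j)) r) (trans (sym (toℚ-mulVec B (λ j → ℤ.+ lookup x j) r)) (cong toℚ (sol r)))

  module Matrix {k m} (B : Mat k m) where
    private
      g = colℚ B
    open Chambers g

    pointedKernel⇒pointed : PointedKernel B → Pointed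
    pointedKernel⇒pointed pk x 0≤x h = pk x 0≤x (λ r → trans (Σ-cong (λ j → *-comm (toℚ (B r j)) (x j))) (h r))

    fullRank⇒basis : FullRank B → Σ (Mask m) Basis
    fullRank⇒basis (s , ind) = image s , tuple⇒basis s ind (image s) (image-enumerates s)

    cell⇒mask : ∀ {b y} → Cell B b y → MaskCell b y
    cell⇒mask cell β f = let (s , inj , ind , en) = basis⇒tuple β in
      inPos⇒feasible β s en (cell s (inj , ind) (feasible⇒inPos β s inj en f))

    -- Adding a positive combination of vectors spanning the chamber keeps every cone that contains
    -- `b`, and smallness adds no new one. So `z` determines the same cell as `b` and is generic as
    -- well.
    generic-point : FullRank B → ∀ b → IsChamberPt B b →
      Σ (Vecℚ k) λ z → Generic z × InPosMat B z × (∀ {y} → MaskCell z y → MaskCell b y) × (∀ {y} → MaskCell b y → MaskCell z y)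
    generic-point fr b (b∈ , v , v∈ , v-ind) = build (generic-perturbation b v (independent⇒spanning v v-ind))
      where
      carath = caratheodory (proj₂ (fullRank⇒basis fr)) b b∈
      Result : Set
      Result = Σ (Vecℚ k) λ z → Generic z × InPosMat B z × (∀ {y} → MaskCell z y → MaskCell b y) × (∀ {y} → MaskCell b y → MaskCell z y)
      build : (Σ (Vecℚ k) λ z → Σ (Fin k → ℚ) λ c → (∀ i → 0ℚ < c i) × (∀ r → z r ≡ b r + lin v c r) × Generic z
        × (∀ {t} (β : Basis t) → Feasible β z → Feasible β b)) → Result
      build (z , c , 0<c , eq , gen , z⇒b) = z , gen , z∈pos , (λ cell β f → cell β (b⇒z β f)) , (λ cell β f → cell β (z⇒b β f))
        where
        b⇒z : ∀ {t} (β : Basis t) → Feasible β b → Feasible β z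
        b⇒z β f j = subst (0ℚ ≤_) (sym (trans (·-congʳ (W β j) eq) (trans (·-+ʳ (W β j) b (lin v c)) (cong (W β j · b +_) (·-lin (W β j) v c)))))
          (0≤p+q (f j) (Σ-0≤ (λ i → 0≤p*q (<⇒≤ (0<c i)) (cell⇒mask (v∈ i) β f j))))
        z∈pos : InPosMat B z
        z∈pos = (λ j → W (proj₁ (proj₂ carath)) j · z) , b⇒z (proj₁ (proj₂ carath)) (proj₂ (proj₂ carath)) , expand (proj₁ (proj₂ carath)) z

    chamber-quasiPoly : FullRank B → PointedKernel B → ∀ b → IsChamberPt B b →
      Σ (Vecℤ k → ℚ) λ Q → IsQuasiPoly Q × AgreesOn B (Cell B b) Q
    chamber-quasiPoly fr pk b chamber = A.Q , A.Q-quasiPoly , λ y cell →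
        length (A.solutions y (b⇒z (cell⇒mask cell))) , A.count y (b⇒z (cell⇒mask cell)) , A.Q≡count y (b⇒z (cell⇒mask cell))
      where
      point = generic-point fr b chamber
      gen = proj₁ (proj₂ point)
      z∈ = proj₁ (proj₂ (proj₂ point))
      b⇒z : ∀ {y} → MaskCell b y → MaskCell (proj₁ point) y
      b⇒z = proj₂ (proj₂ (proj₂ (proj₂ point)))
      module A = Assembly B (pointedKernel⇒pointed pk) (proj₂ (fullRank⇒basis fr)) gen z∈

  -- Eliminating the external columns

  fin-case : ∀ ℓ {k} (P : Fin (ℓ ℕ.+ k) → Set) → (∀ i → P (i ↑ˡ k)) → (∀ i → P (ℓ ↑ʳ i)) → ∀ i → P i
  fin-case zero P f h i = h i
  fin-case (suc ℓ) P f h zero = f zero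
  fin-case (suc ℓ) P f h (suc i) = fin-case ℓ (P ∘ suc) (f ∘ suc) h i

  ↑ʳ≢↑ˡ : ∀ ℓ {k} (i : Fin ℓ) (j : Fin k) → ℓ ↑ʳ j ≢ i ↑ˡ k
  ↑ʳ≢↑ˡ (suc ℓ) zero j ()
  ↑ʳ≢↑ˡ (suc ℓ) (suc i) j e = ↑ʳ≢↑ˡ ℓ i j (Finₚ.suc-injective e)

  Σ-split : ∀ ℓ {m} (f : Fin (ℓ ℕ.+ m) → ℚ) → Σℚ f ≡ Σℚ (λ i → f (i ↑ˡ m)) + Σℚ (λ j → f (ℓ ↑ʳ j))
  Σ-split zero f = sym (+-identityˡ (Σℚ f))
  Σ-split (suc ℓ) {m} f = trans (cong (f zero +_) (Σ-split ℓ (f ∘ suc)))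
    (sym (+-assoc (f zero) (Σℚ (λ i → f (suc i ↑ˡ m))) (Σℚ (λ j → f (suc ℓ ↑ʳ j)))))

  join : ∀ {A : Set} ℓ {m} → (Fin ℓ → A) → (Fin m → A) → Fin (ℓ ℕ.+ m) → A
  join ℓ p q j = [ p , q ]′ (Fin.splitAt ℓ j)

  join-ˡ : ∀ {A : Set} ℓ {m} (p : Fin ℓ → A) (q : Fin m → A) i → join ℓ p q (i ↑ˡ m) ≡ p i
  join-ˡ ℓ {m} p q i = cong [ p , q ]′ (Finₚ.splitAt-↑ˡ ℓ i m)

  join-ʳ : ∀ {A : Set} ℓ {m} (p : Fin ℓ → A) (q : Fin m → A) j → join ℓ p q (ℓ ↑ʳ j) ≡ q j
  join-ʳ ℓ {m} p q j = cong [ p , q ]′ (Finₚ.splitAt-↑ʳ ℓ m j)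

  lin-split : ∀ ℓ {m d} (g : Fin (ℓ ℕ.+ m) → Vecℚ d) x r →
    lin g x r ≡ lin (λ i → g (i ↑ˡ m)) (λ i → x (i ↑ˡ m)) r + lin (λ j → g (ℓ ↑ʳ j)) (λ j → x (ℓ ↑ʳ j)) r
  lin-split ℓ g x r = Σ-split ℓ (λ j → x j * g j r)

  lin-join : ∀ ℓ {m d} (g : Fin (ℓ ℕ.+ m) → Vecℚ d) p q r →
    lin g (join ℓ p q) r ≡ lin (λ i → g (i ↑ˡ m)) p r + lin (λ j → g (ℓ ↑ʳ j)) q r
  lin-join ℓ {m} g p q r = trans (lin-split ℓ g (join ℓ p q) r)
    (cong₂ _+_ (lin-cong (λ i → g (i ↑ˡ m)) (join-ˡ ℓ p q) r) (lin-cong (λ j → g (ℓ ↑ʳ j)) (join-ʳ ℓ p q) r))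

  ·-- : ∀ {d} (w y y′ : Vecℚ d) → w · (λ r → y r - y′ r) ≡ w · y - w · y′
  ·-- w y y′ = trans (Σ-cong (λ r → lem (w r) (y r) (y′ r))) (Σ-- (λ r → w r * y r) (λ r → w r * y′ r))
    where
    lem : ∀ a b c → a * (b - c) ≡ a * b - a * c
    lem = solve-∀ ℚ-ring

  toℚ-dot : ∀ {d} (w v : Vecℤ d) → toℚ (dot w v) ≡ vecℚ w · vecℚ v
  toℚ-dot w v = trans (toℚ-Σ (λ i → w i ℤ.* v i)) (Σ-cong (λ i → toℚ-* (w i) (v i)))

  module Transport (ℓ k m : ℕ) (A : Mat (ℓ ℕ.+ k) (ℓ ℕ.+ m)) (full : FullRank A) (pk : PointedKernel A)
    (b₀ : Vecℚ (ℓ ℕ.+ k)) (chamber : IsChamberPt A b₀)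
    (externals : ∀ j → toℕ j ℕ.< ℓ → External A j × Cell A b₀ (colℚ A j))
    (v : Fin (ℓ ℕ.+ k) → Vecℤ (ℓ ℕ.+ k)) (multiples : ∀ i → PosMultiple (v (i ↑ˡ k)) (col A (i ↑ˡ m)))
    (M : Mat (ℓ ℕ.+ k) (ℓ ℕ.+ k)) (dualRays : IsDualRayMatrix v M) where

    B : Mat k m
    B i j = matMul M A (ℓ ↑ʳ i) (ℓ ↑ʳ j)

    private
      d = ℓ ℕ.+ k
      g = colℚ A

    gˡ : Fin ℓ → Vecℚ d
    gˡ i = g (i ↑ˡ m)

    gʳ : Fin m → Vecℚ d
    gʳ j = g (ℓ ↑ʳ j)

    w : Fin d → Vecℚ d
    w i = vecℚ (M i)

    w-v : ∀ i j → i ≢ j → w i · vecℚ (v j) ≡ 0ℚ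
    w-v i j ne = trans (sym (toℚ-dot (M i) (v j))) (cong toℚ (proj₁ (proj₂ (dualRays i)) j ne))

    0<w-v : ∀ i → 0ℚ < w i · vecℚ (v i)
    0<w-v i = subst (0ℚ <_) (toℚ-dot (M i) (v i)) (toℚ-mono-< (proj₂ (proj₂ (dualRays i))))

    w-lin-v : ∀ c i → w i · lin (λ j → vecℚ (v j)) c ≡ c i * (w i · vecℚ (v i))
    w-lin-v c i = trans (·-lin (w i) (λ j → vecℚ (v j)) c)
      (Σ-single (λ j → c j * (w i · vecℚ (v j))) i (λ j ne → trans (cong (c j *_) (w-v i j (ne ∘ sym))) (*-zeroʳ (c j))))

    v-independent : LinIndep (λ j → vecℚ (v j))
    v-independent c h i = *-cancelʳ-0 (0<⇒≢0 (0<w-v i)) (trans (sym (w-lin-v c i))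
      (Σ-0 (λ r → trans (cong (w i r *_) (h r)) (*-zeroʳ (w i r)))))

    v-spanning : Spanning (λ j → vecℚ (v j))
    v-spanning = independent⇒spanning (λ j → vecℚ (v j)) v-independent

    w-injective : ∀ y → (∀ i → w i · y ≡ 0ℚ) → ∀ r → y r ≡ 0ℚ
    w-injective y h r = let (c , y≡) = v-spanning y in trans (y≡ r) (Σ-0 (λ j → trans
      (cong (_* vecℚ (v j) r) (*-cancelʳ-0 {c j} (0<⇒≢0 (0<w-v j)) (trans (sym (w-lin-v c j)) (trans (·-congʳ (w j) (λ r → sym (y≡ r))) (h j)))))
      (*-zeroˡ (vecℚ (v j) r))))

    w-gˡ-scaled : ∀ r i → w r · vecℚ (v (i ↑ˡ k)) ≡ proj₁ (multiples i) * (w r · gˡ i)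
    w-gˡ-scaled r i = trans (·-congʳ (w r) (proj₂ (proj₂ (multiples i)))) (·-*ʳ (proj₁ (multiples i)) (w r) (gˡ i))

    w-gˡ : ∀ r i → r ≢ i ↑ˡ k → w r · gˡ i ≡ 0ℚ
    w-gˡ r i ne = *-cancelˡ-0 (0<⇒≢0 (proj₁ (proj₂ (multiples i)))) (trans (sym (w-gˡ-scaled r i)) (w-v r (i ↑ˡ k) ne))

    μ : Fin ℓ → ℚ
    μ i = w (i ↑ˡ k) · gˡ i

    μ≢0 : ∀ i → μ i ≢ 0ℚ
    μ≢0 i h = 0<⇒≢0 (0<w-v (i ↑ˡ k)) (trans (w-gˡ-scaled (i ↑ˡ k) i) (trans (cong (proj₁ (multiples i) *_) h) (*-zeroʳ (proj₁ (multiples i)))))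

    w-lin-gˡ : ∀ c i → w (i ↑ˡ k) · lin gˡ c ≡ c i * μ i
    w-lin-gˡ c i = trans (·-lin (w (i ↑ˡ k)) gˡ c) (Σ-single (λ j → c j * (w (i ↑ˡ k) · gˡ j)) i
      (λ j ne → trans (cong (c j *_) (w-gˡ (i ↑ˡ k) j (λ e → ne (sym (Finₚ.↑ˡ-injective k i j e))))) (*-zeroʳ (c j))))

    π : Vecℚ d → Vecℚ k
    π y i = w (ℓ ↑ʳ i) · y

    π-lin-gˡ : ∀ c r → π (lin gˡ c) r ≡ 0ℚ
    π-lin-gˡ c r = trans (·-lin (w (ℓ ↑ʳ r)) gˡ c)
      (Σ-0 (λ i → trans (cong (c i *_) (w-gˡ (ℓ ↑ʳ r) i (↑ʳ≢↑ˡ ℓ i r))) (*-zeroʳ (c i))))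

    colB : ∀ j r → colℚ B j r ≡ π (gʳ j) r
    colB j r = trans (toℚ-Σ (λ i → M (ℓ ↑ʳ r) i ℤ.* A i (ℓ ↑ʳ j))) (Σ-cong (λ i → toℚ-* (M (ℓ ↑ʳ r) i) (A i (ℓ ↑ʳ j))))

    π-lin-gʳ : ∀ x r → π (lin gʳ x) r ≡ lin (colℚ B) x r
    π-lin-gʳ x r = trans (·-lin (w (ℓ ↑ʳ r)) gʳ x) (Σ-cong (λ j → cong (x j *_) (sym (colB j r))))

    π-lin : ∀ x r → π (lin g x) r ≡ lin (colℚ B) (λ j → x (ℓ ↑ʳ j)) r
    π-lin x r = begin
      π (lin g x) r ≡⟨ ·-congʳ (w (ℓ ↑ʳ r)) (lin-split ℓ g x) ⟩
      w (ℓ ↑ʳ r) · (λ q → lin gˡ xˡ q + lin gʳ xʳ q) ≡⟨ ·-+ʳ (w (ℓ ↑ʳ r)) (lin gˡ xˡ) (lin gʳ xʳ) ⟩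
      π (lin gˡ xˡ) r + π (lin gʳ xʳ) r ≡⟨ cong₂ _+_ (π-lin-gˡ xˡ r) (π-lin-gʳ xʳ r) ⟩
      0ℚ + lin (colℚ B) xʳ r ≡⟨ +-identityˡ (lin (colℚ B) xʳ r) ⟩
      lin (colℚ B) xʳ r ∎
      where
      open ≡-Reasoning
      xˡ : Fin ℓ → ℚ
      xˡ i = x (i ↑ˡ m)
      xʳ : Fin m → ℚ
      xʳ j = x (ℓ ↑ʳ j)

    -- Each functional `w` of the first `ℓ` rows sees exactly one external column, so a combination
    -- of these columns can match `y` in all of them. The difference is killed by every row of `M`,
    -- hence zero.
    π-kernel : ∀ y → (∀ r → π y r ≡ 0ℚ) → ∀ r → y r ≡ lin gˡ (λ i → (w (i ↑ˡ k) · y) * inv (μ i)) r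
    π-kernel y h r = p-q≡0⇒p≡q (w-injective (λ r → y r - lin gˡ κ r) (fin-case ℓ (λ i → w i · (λ r → y r - lin gˡ κ r) ≡ 0ℚ) first last) r)
      where
      κ : Fin ℓ → ℚ
      κ i = (w (i ↑ˡ k) · y) * inv (μ i)
      first : ∀ i → w (i ↑ˡ k) · (λ r → y r - lin gˡ κ r) ≡ 0ℚ
      first i = trans (·-- (w (i ↑ˡ k)) y (lin gˡ κ)) (p≡q⇒p-q≡0 (sym (trans (w-lin-gˡ κ i) (div-* {w (i ↑ˡ k) · y} (μ≢0 i)))))
      last : ∀ i → w (ℓ ↑ʳ i) · (λ r → y r - lin gˡ κ r) ≡ 0ℚ
      last i = trans (·-- (w (ℓ ↑ʳ i)) y (lin gˡ κ)) (p≡q⇒p-q≡0 (trans (h i) (sym (π-lin-gˡ κ i))))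

    -- The only possible coefficients of the external columns once those of the other columns are
    -- fixed.
    lift-coefficients : Vecℚ d → (Fin m → ℚ) → Fin ℓ → ℚ
    lift-coefficients y x i = (w (i ↑ˡ k) · (λ r → y r - lin gʳ x r)) * inv (μ i)

    lift : ∀ y x → (∀ r → π y r ≡ lin (colℚ B) x r) → ∀ r → y r ≡ lin g (join ℓ (lift-coefficients y x) x) r
    lift y x h r = trans (lem (y r) (lin gʳ x r)) (trans (cong (_+ lin gʳ x r) (π-kernel (λ r → y r - lin gʳ x r) zeros r))
        (sym (lin-join ℓ g (lift-coefficients y x) x r)))
      where
      lem : ∀ a b → a ≡ a - b + b
      lem = solve-∀ ℚ-ring
      zeros : ∀ r → π (λ r → y r - lin gʳ x r) r ≡ 0ℚ
      zeros r = trans (·-- (w (ℓ ↑ʳ r)) y (lin gʳ x)) (p≡q⇒p-q≡0 (trans (h r) (sym (π-lin-gʳ x r))))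

    module CA = Chambers g
    module MA = Matrix A

    abstract
      zPoint : Σ (Vecℚ d) λ z → CA.Generic z × InPosMat A z × (∀ {y} → CA.MaskCell z y → CA.MaskCell b₀ y) × (∀ {y} → CA.MaskCell b₀ y → CA.MaskCell z y)
      zPoint = MA.generic-point full b₀ chamber

    z : Vecℚ d
    z = proj₁ zPoint

    cell⇒z : ∀ {y} → Cell A b₀ y → CA.MaskCell z y
    cell⇒z cell = proj₂ (proj₂ (proj₂ (proj₂ zPoint))) (MA.cell⇒mask cell)

    nonNeg-extends : ∀ x → CA.MaskCell z (lin g x) → (∀ j → 0ℚ ≤ x (ℓ ↑ʳ j)) → ∀ j → 0ℚ ≤ x j
    nonNeg-extends x cell 0≤x = CA.external-nonNeg (MA.pointedKernel⇒pointed pk) (proj₁ (proj₂ zPoint)) (proj₂ (MA.fullRank⇒basis full))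
      (proj₁ (proj₂ (proj₂ zPoint))) (λ j → toℕ j ℕ.< ℓ)
      (λ j j<ℓ → proj₁ (externals j j<ℓ) , cell⇒z (proj₂ (externals j j<ℓ))) x cell
      (fin-case ℓ (λ j → 0ℚ ≤ x j ⊎ toℕ j ℕ.< ℓ) (λ i → inj₂ (subst (ℕ._< ℓ) (sym (Finₚ.toℕ-↑ˡ i m)) (Finₚ.toℕ<n i))) (λ j → inj₁ (0≤x j)))

    cell-cong : ∀ {y y′} → (∀ r → y r ≡ y′ r) → CA.MaskCell z y → CA.MaskCell z y′
    cell-cong h cell β f j = subst (0ℚ ≤_) (·-congʳ (CA.W β j) h) (cell β f j)

    lift-nonNeg : ∀ y x → CA.MaskCell z y → (∀ j → 0ℚ ≤ x j) → (∀ r → π y r ≡ lin (colℚ B) x r) → ∀ i → 0ℚ ≤ lift-coefficients y x i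
    lift-nonNeg y x cell 0≤x h i = subst (0ℚ ≤_) (join-ˡ ℓ (lift-coefficients y x) x i)
      (nonNeg-extends (join ℓ (lift-coefficients y x) x) (cell-cong (lift y x h) cell)
        (λ j → subst (0ℚ ≤_) (sym (join-ʳ ℓ (lift-coefficients y x) x j)) (0≤x j)) (i ↑ˡ m))

    0≤join : ∀ {n} (p : Fin ℓ → ℚ) (q : Fin n → ℚ) → (∀ i → 0ℚ ≤ p i) → (∀ j → 0ℚ ≤ q j) → ∀ j → 0ℚ ≤ join ℓ p q j
    0≤join p q hp hq = fin-case ℓ (λ j → 0ℚ ≤ join ℓ p q j) (λ i → subst (0ℚ ≤_) (sym (join-ˡ ℓ p q i)) (hp i)) (λ j → subst (0ℚ ≤_) (sym (join-ʳ ℓ p q j)) (hq j))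

    -- The origin lies in every cell, so a nonnegative kernel vector of `B` lifts to a nonnegative
    -- kernel vector of `A`.
    B-pointed : PointedKernel B
    B-pointed x 0≤x h j = trans (sym (join-ʳ ℓ p x j)) (MA.pointedKernel⇒pointed pk (join ℓ p x)
        (0≤join p x (lift-nonNeg (λ _ → 0ℚ) x (λ β f j → ≤-reflexive (sym (·-0 (CA.W β j)))) 0≤x π0) 0≤x)
        (λ r → sym (lift (λ _ → 0ℚ) x π0 r)) (ℓ ↑ʳ j))
      where
      p = lift-coefficients (λ _ → 0ℚ) x
      ·-0 : ∀ u → u · (λ (_ : Fin d) → 0ℚ) ≡ 0ℚ
      ·-0 u = Σ-0 (λ r → *-zeroʳ (u r))
      π0 : ∀ r → π (λ _ → 0ℚ) r ≡ lin (colℚ B) x r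
      π0 r = trans (·-0 (w (ℓ ↑ʳ r))) (sym (trans (Σ-cong (λ j → *-comm (x j) (colℚ B j r))) (h r)))

    π-surjective : (y′ : Vecℚ k) → Σ (Vecℚ d) λ y → ∀ r → y′ r ≡ π y r
    π-surjective y′ = lin (λ j → vecℚ (v j)) c , λ r → sym (trans (w-lin-v c (ℓ ↑ʳ r))
        (trans (cong (_* (w (ℓ ↑ʳ r) · vecℚ (v (ℓ ↑ʳ r)))) (join-ʳ ℓ (λ _ → 0ℚ) c′ r)) (div-* {y′ r} (0<⇒≢0 (0<w-v (ℓ ↑ʳ r))))))
      where
      c′ : Fin k → ℚ
      c′ r = y′ r * inv (w (ℓ ↑ʳ r) · vecℚ (v (ℓ ↑ʳ r)))
      c = join ℓ (λ _ → 0ℚ) c′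

    B-fullRank : FullRank B
    B-fullRank = spanning⇒basis (colℚ B) λ y′ →
      let (y , y′≡) = π-surjective y′ ; β = proj₂ (MA.fullRank⇒basis full) ; x = λ j → CA.W β j · y in
      (λ j → x (ℓ ↑ʳ j)) , λ r → trans (y′≡ r) (trans (·-congʳ (w (ℓ ↑ʳ r)) (CA.expand β y)) (π-lin x r))

    module _ (s′ : Fin k → Fin m) where

      -- Simplicial cones of `B` are lifted to `A` by adjoining all external columns of the chamber.
      s : Fin d → Fin (ℓ ℕ.+ m)
      s = join ℓ (_↑ˡ m) (λ i → ℓ ↑ʳ s′ i)

      lin-s : ∀ c r → lin (g ∘ s) c r ≡ lin gˡ (λ i → c (i ↑ˡ k)) r + lin (gʳ ∘ s′) (λ i → c (ℓ ↑ʳ i)) r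
      lin-s c r = trans (Σ-split ℓ (λ i → c i * g (s i) r)) (cong₂ _+_
        (Σ-cong (λ i → cong (λ j → c (i ↑ˡ k) * g j r) (join-ˡ ℓ (_↑ˡ m) (λ i → ℓ ↑ʳ s′ i) i)))
        (Σ-cong (λ i → cong (λ j → c (ℓ ↑ʳ i) * g j r) (join-ʳ ℓ (_↑ˡ m) (λ i → ℓ ↑ʳ s′ i) i))))

      π-lin-s : ∀ c r → π (lin (g ∘ s) c) r ≡ lin (colℚ B ∘ s′) (λ i → c (ℓ ↑ʳ i)) r
      π-lin-s c r = begin
        π (lin (g ∘ s) c) r ≡⟨ ·-congʳ (w (ℓ ↑ʳ r)) (lin-s c) ⟩
        w (ℓ ↑ʳ r) · (λ q → lin gˡ cˡ q + lin (gʳ ∘ s′) cʳ q) ≡⟨ ·-+ʳ (w (ℓ ↑ʳ r)) (lin gˡ cˡ) (lin (gʳ ∘ s′) cʳ) ⟩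
        π (lin gˡ cˡ) r + w (ℓ ↑ʳ r) · lin (gʳ ∘ s′) cʳ
          ≡⟨ cong₂ _+_ (π-lin-gˡ cˡ r) (trans (·-lin (w (ℓ ↑ʳ r)) (gʳ ∘ s′) cʳ) (Σ-cong (λ i → cong (cʳ i *_) (sym (colB (s′ i) r))))) ⟩
        0ℚ + lin (colℚ B ∘ s′) cʳ r ≡⟨ +-identityˡ (lin (colℚ B ∘ s′) cʳ r) ⟩
        lin (colℚ B ∘ s′) cʳ r ∎
        where
        open ≡-Reasoning
        cˡ : Fin ℓ → ℚ
        cˡ i = c (i ↑ˡ k)
        cʳ : Fin k → ℚ
        cʳ i = c (ℓ ↑ʳ i)

      s-independent : LinIndep (colℚ B ∘ s′) → LinIndep (g ∘ s)
      s-independent ind c h = fin-case ℓ (λ i → c i ≡ 0ℚ) first rest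
        where
        w-0 : ∀ i → w i · lin (g ∘ s) c ≡ 0ℚ
        w-0 i = Σ-0 (λ r → trans (cong (w i r *_) (h r)) (*-zeroʳ (w i r)))
        rest : ∀ i → c (ℓ ↑ʳ i) ≡ 0ℚ
        rest = ind (λ i → c (ℓ ↑ʳ i)) (λ r → trans (sym (π-lin-s c r)) (w-0 (ℓ ↑ʳ r)))
        first : ∀ i → c (i ↑ˡ k) ≡ 0ℚ
        first i = *-cancelʳ-0 (μ≢0 i) (trans (sym (w-lin-gˡ (λ i → c (i ↑ˡ k)) i)) (trans (·-congʳ (w (i ↑ˡ k)) only-first) (w-0 (i ↑ˡ k))))
          where
          only-first : ∀ r → lin gˡ (λ i → c (i ↑ˡ k)) r ≡ lin (g ∘ s) c r
          only-first r = sym (trans (lin-s c r) (trans (cong (lin gˡ (λ i → c (i ↑ˡ k)) r +_)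
            (Σ-0 (λ i → trans (cong (_* gʳ (s′ i) r) (rest i)) (*-zeroˡ (gʳ (s′ i) r))))) (+-identityʳ (lin gˡ (λ i → c (i ↑ˡ k)) r))))

    -- A simplicial cone of `B` containing `π b₀` lifts to one of `A` that contains `b₀`, since the
    -- coefficients at external columns come out nonnegative. It therefore contains `y`, and
    -- projecting its coefficients gives the claim.
    cell-π : ∀ {y} → Cell A b₀ y → Cell B (π b₀) (π y)
    cell-π {y} cell s′ (_ , ind) (c′ , 0≤c′ , πb₀≡) =
        (λ i → c (ℓ ↑ʳ i)) , (λ i → 0≤c (ℓ ↑ʳ i)) , λ r → trans (·-congʳ (w (ℓ ↑ʳ r)) y≡) (π-lin-s s′ c r)
      where
      x′ = push s′ c′
      h : ∀ r → π b₀ r ≡ lin (colℚ B) x′ r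
      h r = trans (πb₀≡ r) (sym (Σ-push s′ c′ (λ j → colℚ B j r)))
      p = lift-coefficients b₀ x′
      b₀∈ : InCone A (s s′) b₀
      b₀∈ = join ℓ p c′
        , 0≤join p c′ (lift-nonNeg b₀ x′ (cell⇒z (λ _ _ b∈ → b∈)) (push-0≤ s′ c′ 0≤c′) h) 0≤c′
        , λ r → trans (lift b₀ x′ h r) (trans (lin-join ℓ g p x′ r) (sym (trans (lin-s s′ (join ℓ p c′) r)
            (cong₂ _+_ (lin-cong gˡ (join-ˡ ℓ p c′) r)
              (trans (lin-cong (gʳ ∘ s′) (join-ʳ ℓ p c′) r) (sym (Σ-push s′ c′ (λ j → gʳ j r))))))))
      s-ind = s-independent s′ ind
      y∈ = cell (s s′) (independent⇒injective g (s s′) s-ind , s-ind) b₀∈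
      c = proj₁ y∈
      0≤c = proj₁ (proj₂ y∈)
      y≡ = proj₂ (proj₂ y∈)

    B-chamber : IsChamberPt B (π b₀)
    B-chamber = inPos , (λ i → π (u (σ i))) , (λ i → cell-π (u∈ (σ i))) , proj₂ independent
      where
      inPos : InPosMat B (π b₀)
      inPos = let (c , 0≤c , b₀≡) = proj₁ chamber in
        (λ j → c (ℓ ↑ʳ j)) , (λ j → 0≤c (ℓ ↑ʳ j)) , λ r → trans (·-congʳ (w (ℓ ↑ʳ r)) b₀≡) (π-lin c r)
      u = proj₁ (proj₂ chamber)
      u∈ = proj₁ (proj₂ (proj₂ chamber))
      u-span = independent⇒spanning u (proj₂ (proj₂ (proj₂ chamber)))
      independent = spanning⇒basis (λ i → π (u i)) λ y′ →
        let (y , y′≡) = π-surjective y′ ; (c , y≡) = u-span y in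
        c , λ r → trans (y′≡ r) (trans (·-congʳ (w (ℓ ↑ʳ r)) y≡) (·-lin (w (ℓ ↑ʳ r)) u c))
      σ = proj₁ independent

    πℤ : Vecℤ d → Vecℤ k
    πℤ b i = mulVec M b (ℓ ↑ʳ i)

    πℤ-π : ∀ b r → vecℚ (πℤ b) r ≡ π (vecℚ b) r
    πℤ-π b r = toℚ-dot (M (ℓ ↑ʳ r)) b

    cell-resp : ∀ {k m} {B : Mat k m} {b y y′} → (∀ r → y r ≡ y′ r) → Cell B b y → Cell B b y′
    cell-resp h cell s sc b∈ = let (c , 0≤c , y≡) = cell s sc b∈ in c , 0≤c , λ r → trans (sym (h r)) (y≡ r)

    ℕℚ : ∀ {n} → Vec ℕ n → Fin n → ℚ
    ℕℚ x j = toℚ (ℤ.+ lookup x j)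

    module Counting (saturated : Saturated (λ r (i : Fin ℓ) → A r (i ↑ˡ m)) A) (b : Vecℤ d)
      (b∈cell : Cell A b₀ (vecℚ b)) (b∈S : InSemigroup A b) where

      sol⇒lin : ∀ {k n} {C : Mat k n} {y x} → Sol C y x → ∀ r → lin (colℚ C) (ℕℚ x) r ≡ toℚ (y r)
      sol⇒lin {C = C} {y} {x} sol r = trans (sym (toℚ-mulVec C (λ j → ℤ.+ lookup x j) r)) (cong toℚ (sol r))

      lin⇒sol : ∀ {k n} {C : Mat k n} {y x} → (∀ r → lin (colℚ C) (ℕℚ x) r ≡ toℚ (y r)) → Sol C y x
      lin⇒sol {C = C} {y} {x} h r = toℚ-injective (trans (toℚ-mulVec C (λ j → ℤ.+ lookup x j) r) (h r))

      sol? : ∀ x → Dec (Sol B (πℤ b) x)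
      sol? x = Finₚ.all? (λ r → mulVec B (λ j → ℤ.+ lookup x j) r ℤ.≟ πℤ b r)

      C : Mat d ℓ
      C r i = A r (i ↑ˡ m)

      remainder : Vec ℕ m → Vecℤ d
      remainder x r = b r ℤ.- mulVec (λ r j → A r (ℓ ↑ʳ j)) (λ j → ℤ.+ lookup x j) r

      remainder-ℚ : ∀ x r → toℚ (remainder x r) ≡ toℚ (b r) - lin gʳ (ℕℚ x) r
      remainder-ℚ x r = trans (toℚ-- (b r) (mulVec (λ r j → A r (ℓ ↑ʳ j)) (λ j → ℤ.+ lookup x j) r))
        (cong (λ q → toℚ (b r) - q) (toℚ-mulVec (λ r j → A r (ℓ ↑ʳ j)) (λ j → ℤ.+ lookup x j) r))

      -- What the external columns must produce lies in their cone, by nonnegativity of the lifted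
      -- coefficients, and in the lattice, because `b` is an integer combination of the columns.
      -- Saturation makes the coefficients natural numbers.
      remainder-semigroup : ∀ x → Sol B (πℤ b) x → InSemigroup C (remainder x)
      remainder-semigroup x sol = proj₂ (saturated (remainder x)) ((λs , inLattice) , (p , 0≤p , inPos))
        where
        h : ∀ r → π (vecℚ b) r ≡ lin (colℚ B) (ℕℚ x) r
        h r = trans (sym (πℤ-π b r)) (sym (sol⇒lin {C = B} {πℤ b} {x} sol r))
        p = lift-coefficients (vecℚ b) (ℕℚ x)
        0≤p = lift-nonNeg (vecℚ b) (ℕℚ x) (cell⇒z b∈cell) (λ j → 0≤toℚ (lookup x j)) h
        lem : ∀ a b → a + b - b ≡ a
        lem = solve-∀ ℚ-ring
        inPos : ∀ r → toℚ (remainder x r) ≡ lin gˡ p r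
        inPos r = trans (remainder-ℚ x r) (trans (cong (_- lin gʳ (ℕℚ x) r) (trans (lift (vecℚ b) (ℕℚ x) h r) (lin-join ℓ g p (ℕℚ x) r)))
          (lem (lin gˡ p r) (lin gʳ (ℕℚ x) r)))
        b-coeff = proj₁ b∈S
        λs : Fin (ℓ ℕ.+ m) → ℤ
        λs = join ℓ (λ i → ℤ.+ b-coeff (i ↑ˡ m)) (λ j → ℤ.+ b-coeff (ℓ ↑ʳ j) ℤ.- ℤ.+ lookup x j)
        lem₂ : ∀ a b c → a + b - c ≡ a + (b - c)
        lem₂ = solve-∀ ℚ-ring
        inLattice : ∀ r → remainder x r ≡ mulVec A λs r
        inLattice r = toℚ-injective (trans (remainder-ℚ x r) (trans
          (cong (_- lin gʳ (ℕℚ x) r) (trans (cong toℚ (proj₂ b∈S r)) (trans (toℚ-mulVec A (λ j → ℤ.+ b-coeff j) r) (lin-split ℓ g (λ j → toℚ (ℤ.+ b-coeff j)) r))))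
          (trans (lem₂ (lin gˡ bˡ r) (lin gʳ bʳ r) (lin gʳ (ℕℚ x) r))
            (trans (cong (lin gˡ bˡ r +_) (sym (lin-- gʳ bʳ (ℕℚ x) r)))
              (sym (trans (toℚ-mulVec A λs r) (trans (lin-split ℓ g (toℚ ∘ λs) r) (cong₂ _+_
                (lin-cong gˡ (λ i → cong toℚ (join-ˡ ℓ (λ i → ℤ.+ b-coeff (i ↑ˡ m)) (λ j → ℤ.+ b-coeff (ℓ ↑ʳ j) ℤ.- ℤ.+ lookup x j) i)) r)
                (lin-cong gʳ (λ j → trans (cong toℚ (join-ʳ ℓ (λ i → ℤ.+ b-coeff (i ↑ˡ m)) (λ j → ℤ.+ b-coeff (ℓ ↑ʳ j) ℤ.- ℤ.+ lookup x j) j))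
                  (toℚ-- (ℤ.+ b-coeff (ℓ ↑ʳ j)) (ℤ.+ lookup x j))) r)))))))))
          where
          bˡ : Fin ℓ → ℚ
          bˡ i = toℚ (ℤ.+ b-coeff (i ↑ˡ m))
          bʳ : Fin m → ℚ
          bʳ j = toℚ (ℤ.+ b-coeff (ℓ ↑ʳ j))

      -- Zeros off the solution set are an arbitrary default that makes the map total; it is
      -- injective anyway, since `x` remains as the second part.
      extendWith : ∀ x → Dec (Sol B (πℤ b) x) → Vec ℕ (ℓ ℕ.+ m)
      extendWith x (yes sol) = tabulate (proj₁ (remainder-semigroup x sol)) Vec.++ x
      extendWith x (no _) = Vec.replicate ℓ 0 Vec.++ x

      extend : Vec ℕ m → Vec ℕ (ℓ ℕ.+ m)
      extend x = extendWith x (sol? x)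

      extend-injective : ∀ {x x′} → extend x ≡ extend x′ → x ≡ x′
      extend-injective {x} {x′} = go (sol? x) (sol? x′)
        where
        go : ∀ d d′ → extendWith x d ≡ extendWith x′ d′ → x ≡ x′
        go (yes s) (yes s′) = Vecₚ.++-injectiveʳ (tabulate (proj₁ (remainder-semigroup x s))) (tabulate (proj₁ (remainder-semigroup x′ s′)))
        go (yes s) (no _) = Vecₚ.++-injectiveʳ (tabulate (proj₁ (remainder-semigroup x s))) (Vec.replicate ℓ 0)
        go (no _) (yes s′) = Vecₚ.++-injectiveʳ (Vec.replicate ℓ 0) (tabulate (proj₁ (remainder-semigroup x′ s′)))
        go (no _) (no _) = Vecₚ.++-injectiveʳ (Vec.replicate ℓ 0) (Vec.replicate ℓ 0)

      lin-++ : ∀ (x₁ : Vec ℕ ℓ) (x₂ : Vec ℕ m) r → lin g (ℕℚ (x₁ Vec.++ x₂)) r ≡ lin gˡ (ℕℚ x₁) r + lin gʳ (ℕℚ x₂) r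
      lin-++ x₁ x₂ r = trans (lin-split ℓ g (ℕℚ (x₁ Vec.++ x₂)) r) (cong₂ _+_
        (lin-cong gˡ (λ i → cong (λ n → toℚ (ℤ.+ n)) (Vecₚ.lookup-++ˡ x₁ x₂ i)) r)
        (lin-cong gʳ (λ j → cong (λ n → toℚ (ℤ.+ n)) (Vecₚ.lookup-++ʳ x₁ x₂ j)) r))

      extend-sol : ∀ x → Sol B (πℤ b) x → Sol A b (extend x)
      extend-sol x sol = go (sol? x)
        where
        lem : ∀ a b → a - b + b ≡ a
        lem = solve-∀ ℚ-ring
        go : ∀ d → Sol A b (extendWith x d)
        go (no ¬sol) = ⊥-elim (¬sol sol)
        go (yes s) = lin⇒sol {C = A} {b} {tabulate λs Vec.++ x} λ r → trans (lin-++ (tabulate λs) x r)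
            (trans (cong (_+ lin gʳ (ℕℚ x) r) (trans (lin-cong gˡ (λ i → cong (λ n → toℚ (ℤ.+ n)) (Vecₚ.lookup∘tabulate λs i)) r)
              (trans (sym (toℚ-mulVec C (λ i → ℤ.+ λs i) r)) (trans (cong toℚ (sym (proj₂ (remainder-semigroup x s) r))) (remainder-ℚ x r)))))
              (lem (toℚ (b r)) (lin gʳ (ℕℚ x) r)))
          where
          λs = proj₁ (remainder-semigroup x s)

      project-sol : ∀ (x₁ : Vec ℕ ℓ) (x₂ : Vec ℕ m) → Sol A b (x₁ Vec.++ x₂) → Sol B (πℤ b) x₂
      project-sol x₁ x₂ sol = lin⇒sol {C = B} {πℤ b} {x₂} λ r → sym (trans (πℤ-π b r)
        (trans (·-congʳ (w (ℓ ↑ʳ r)) (λ q → sym (sol⇒lin {C = A} {b} {x₁ Vec.++ x₂} sol q)))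
          (trans (π-lin (ℕℚ (x₁ Vec.++ x₂)) r) (lin-cong (colℚ B) (λ j → cong (λ n → toℚ (ℤ.+ n)) (Vecₚ.lookup-++ʳ x₁ x₂ j)) r))))

      -- The functional `w (i ↑ˡ k)` reads off the coefficient of the external column `i`, up to the
      -- nonzero factor `μ i`.
      first-unique : ∀ (x₁ x₁′ : Vec ℕ ℓ) (x₂ : Vec ℕ m) → Sol A b (x₁ Vec.++ x₂) → Sol A b (x₁′ Vec.++ x₂) → x₁ ≡ x₁′
      first-unique x₁ x₁′ x₂ sol sol′ = trans (sym (Vecₚ.tabulate∘lookup x₁)) (trans (Vecₚ.tabulate-cong at) (Vecₚ.tabulate∘lookup x₁′))
        where
        lin≡ : ∀ r → lin gˡ (ℕℚ x₁) r ≡ lin gˡ (ℕℚ x₁′) r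
        lin≡ r = cancel (trans (sym (lin-++ x₁ x₂ r)) (trans (sol⇒lin {C = A} {b} {x₁ Vec.++ x₂} sol r)
            (trans (sym (sol⇒lin {C = A} {b} {x₁′ Vec.++ x₂} sol′ r)) (lin-++ x₁′ x₂ r))))
          where
          cancel : ∀ {p q s} → p + s ≡ q + s → p ≡ q
          cancel {p} {q} {s} e = trans (lem p s) (trans (cong (_- s) e) (sym (lem q s)))
            where
            lem : ∀ p s → p ≡ p + s - s
            lem = solve-∀ ℚ-ring
        at : ∀ i → lookup x₁ i ≡ lookup x₁′ i
        at i = ℤₚ.+-injective (toℚ-injective (p-q≡0⇒p≡q (*-cancelʳ-0 (μ≢0 i) (trans (lem (ℕℚ x₁ i) (ℕℚ x₁′ i) (μ i))
            (p≡q⇒p-q≡0 (trans (sym (w-lin-gˡ (ℕℚ x₁) i)) (trans (·-congʳ (w (i ↑ˡ k)) lin≡) (w-lin-gˡ (ℕℚ x₁′) i))))))))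
          where
          lem : ∀ a b c → (a - b) * c ≡ a * c - b * c
          lem = solve-∀ ℚ-ring

      extend-project : ∀ (x₁ : Vec ℕ ℓ) (x₂ : Vec ℕ m) → Sol A b (x₁ Vec.++ x₂) → extend x₂ ≡ x₁ Vec.++ x₂
      extend-project x₁ x₂ sol = go (sol? x₂) (extend-sol x₂ (project-sol x₁ x₂ sol))
        where
        go : ∀ d → Sol A b (extendWith x₂ d) → extendWith x₂ d ≡ x₁ Vec.++ x₂
        go (yes s) sol′ = cong (Vec._++ x₂) (first-unique (tabulate (proj₁ (remainder-semigroup x₂ s))) x₁ x₂ sol′ sol)
        go (no ¬s) _ = ⊥-elim (¬s (project-sol x₁ x₂ sol))

      count-transport : ∀ {c} → PCount B (πℤ b) c → PCount A b c
      count-transport (L , len , uniq , spec) = List.map extend L , trans (Listₚ.length-map extend L) len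
        , Uniqueₚ.map⁺ extend-injective uniq , λ x → sound x , complete x
        where
        sound : ∀ x → x ∈ List.map extend L → Sol A b x
        sound x x∈ = let (x′ , x′∈ , x≡) = ∈-map⁻ extend x∈ in subst (Sol A b) (sym x≡) (extend-sol x′ (proj₁ (spec x′) x′∈))
        complete : ∀ x → Sol A b x → x ∈ List.map extend L
        complete x sol = let (x₁ , x₂ , x≡) = Vec.splitAt ℓ x ; sol′ = subst (Sol A b) x≡ sol in
          subst (_∈ List.map extend L) (trans (extend-project x₁ x₂ sol′) (sym x≡)) (∈-map⁺ extend (proj₂ (spec x₂) (project-sol x₁ x₂ sol′)))

    conclusion : Saturated (λ r (i : Fin ℓ) → A r (i ↑ˡ m)) A →
      Σ (Vecℤ k → ℚ) λ Q → IsQuasiPoly Q × AgreesOn B (Cell B (π b₀)) Q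
        × (∀ b → Cell A b₀ (vecℚ b) → InSemigroup A b → Σ ℕ λ c → PCount A b c × Q (πℤ b) ≡ fromℕℚ c)
    conclusion saturated = Q , proj₁ (proj₂ qp) , agrees , λ b b∈cell b∈S →
        let (c , count , Q≡) = agrees (πℤ b) (cell-resp {B = B} (λ r → sym (πℤ-π b r)) (cell-π b∈cell)) in
        c , Counting.count-transport saturated b b∈cell b∈S count , Q≡
      where
      qp = Matrix.chamber-quasiPoly B B-fullRank B-pointed (π b₀) B-chamber
      Q = proj₁ qp
      agrees = proj₂ (proj₂ qp)

open import Data.Nat using (ℕ; _+_; _<_)
open import Data.Product using (_,_; proj₂)

theorem4p2 : (ℓ k m : ℕ) (A : Mat (ℓ + k) (ℓ + m))
  → FullRank A
  → PointedKernel A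
  → (b₀ : Vecℚ (ℓ + k)) → IsChamberPt A b₀
  → (∀ (j : Fin (ℓ + m)) → ((External A j × Cell A b₀ (colℚ A j)) → toℕ j < ℓ)
                           × (toℕ j < ℓ → (External A j × Cell A b₀ (colℚ A j))))
  → Saturated (λ r (i : Fin ℓ) → A r (i ↑ˡ m)) A
  → (s : Fin (ℓ + k) → Fin (ℓ + m)) → SimplicialCone A s
  → (∀ y → Cell A b₀ y → InCone A s y)
  → (v : Fin (ℓ + k) → Vecℤ (ℓ + k))
  → (∀ i → MinRayGen (v i) (col A (s i)))
  → (∀ (i : Fin ℓ) → PosMultiple (v (i ↑ˡ k)) (col A (i ↑ˡ m)))
  → (M : Mat (ℓ + k) (ℓ + k)) → IsDualRayMatrix v M
  → Σ (Vecℚ k) λ b′ →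
      IsChamberPt (λ (i : Fin k) (j : Fin m) → matMul M A (ℓ ↑ʳ i) (ℓ ↑ʳ j)) b′
      × Σ (Vecℤ k → ℚ) λ Q → IsQuasiPoly Q
        × AgreesOn (λ (i : Fin k) (j : Fin m) → matMul M A (ℓ ↑ʳ i) (ℓ ↑ʳ j))
                   (Cell (λ (i : Fin k) (j : Fin m) → matMul M A (ℓ ↑ʳ i) (ℓ ↑ʳ j)) b′) Q
        × (∀ (b : Vecℤ (ℓ + k)) → Cell A b₀ (λ r → toℚ (b r)) → InSemigroup A b
             → Σ ℕ λ c → PCount A b c × Q (λ i → mulVec M b (ℓ ↑ʳ i)) ≡ fromℕℚ c)
theorem4p2 ℓ k m A full pk b₀ chamber externals saturated s _ _ v _ multiples M dualRays =
  -- The chamber of `B` is the cell of the image of the point that determines the chamber of `A`.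
  T.π b₀ , T.B-chamber , T.conclusion saturated
  where
  module T = VectorPartition.Transport ℓ k m A full pk b₀ chamber (λ j → proj₂ (externals j)) v multiples M dualRays
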